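{- Let $H_1$ and $H_2$ be graphs such that, if $\chi(H_2)\neq 4$, then \[e(H_1)>\frac{\mathrm{crit}(H_2)\cdot(\chi(H_2)-2)!\cdot(\chi(H_2)-2)^{v(H_2)-\chi(H_2)-k(H_2)+1}\cdot(\chi(H_1)-1)^{v(H_2)-k(H_2)}}{(\chi(H_2)-1)^{v(H_2)-k(H_2)}}\] and, if $\chi(H_2)=4$, then \[e(H_1)>\frac{\mathrm{crit}(H_2)\cdot 2^{v(H_2)-k(H_2)-1}\cdot(\chi(H_1)-1)^{v(H_2)-k(H_2)}}{3^{v(H_2)-k(H_2)}}.\] Then $(H_1,H_2)$ is not multiplicity good.
   Context: All graphs are finite and simple; $v(H)=|V(H)|$, $e(H)=|E(H)|$, $k(H)$ is the number of connected components, $\chi(H)$ the chromatic number, $\overline{G}$ the complement of $G$. An edge $e$ is critical if $\chi(H-e)<\chi(H)$; $\mathrm{crit}(H)$ is the number of critical edges of $H$. The homomorphism density $t(H,G)$ is the probability that a uniformly random map $V(H)\to V(G)$ sends every edge of $H$ to an edge of $G$. A pair $(H_1,H_2)$ is multiplicity good if \[(\chi(H_2)-1)^{v(H_1)-k(H_1)}\,t(H_1,G)+(\chi(H_1)-1)^{v(H_2)-k(H_2)}\,t(H_2,\overline{G})\geq 1-o(1)\] for all graphs $G$, where $o(1)\to 0$ as $v(G)\to\infty$.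
   Formalization: The graph H_2 is assumed to have at least one edge; for edgeless H_2 the factor (χ(H_2)−2)! is undefined and the pair (H_1,H_2) is always multiplicity good. -}

module Defs where

open import Data.Bool using (Bool; true; false; _∧_; _∨_; not; if_then_else_)
open import Data.Nat using (ℕ; zero; suc; _∸_; _^_; _<ᵇ_)
open import Data.Fin using (Fin; toℕ)
open import Data.Fin.Properties using (_≟_)
open import Data.Product using (_×_; _,_; proj₁; proj₂)
open import Data.List using (List; []; _∷_; [_]; map; concatMap; allFin)
open import Data.Bool.ListAction using (all; any)
open import Data.Vec using (Vec; lookup) renaming ([] to []ᵥ; _∷_ to _∷ᵥ_)
open import Data.Integer using (+_)
open import Data.Rational using (ℚ; _/_; 0ℚ)
open import Relation.Nullary.Decidable using (⌊_⌋; yes; no)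
open import Relation.Binary.PropositionalEquality using (_≡_; refl; cong; cong₂)
open import Data.Empty using (⊥-elim)
open import Data.Bool.Properties using (∨-comm; ∧-zeroʳ)
import Data.List
open import Data.Nat using (_≤_)
open import Data.Rational using (1ℚ) renaming (_<_ to _<ℚ_; _≤_ to _≤ℚ_; _+_ to _+ℚ_; _*_ to _*ℚ_; _-_ to _-ℚ_)
open import Data.Product using (Σ)

record Graph : Set where
  field
    n      : ℕ
    adj    : Fin n → Fin n → Bool
    sym    : ∀ i j → adj i j ≡ adj j i
    irrefl : ∀ i → adj i i ≡ false
open Graph public

v : Graph → ℕ
v = Graph.n

countB : {A : Set} → (A → Bool) → List A → ℕ
countB p []       = 0
countB p (x ∷ xs) = if p x then suc (countB p xs) else countB p xs

_==_ : {m : ℕ} → Fin m → Fin m → Bool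
i == j = ⌊ i ≟ j ⌋

allPairs : (m : ℕ) → List (Fin m × Fin m)
allPairs m = concatMap (λ i → map (λ j → (i , j)) (allFin m)) (allFin m)

upPairs : (m : ℕ) → List (Fin m × Fin m)
upPairs m = Data.List.filterᵇ (λ p → toℕ (proj₁ p) <ᵇ toℕ (proj₂ p)) (allPairs m)

allVecs : (c m : ℕ) → List (Vec (Fin c) m)
allVecs c zero    = [ []ᵥ ]
allVecs c (suc m) = concatMap (λ x → map (x ∷ᵥ_) (allVecs c m)) (allFin c)

e : Graph → ℕ
e H = countB (λ p → adj H (proj₁ p) (proj₂ p)) (upPairs (v H))

complement : Graph → Graph
complement G = record
  { n      = v G
  ; adj    = λ i j → not (adj G i j) ∧ not (i == j)
  ; sym    = symC
  ; irrefl = irrC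
  }
  where
    ==-sym : ∀ (i j : Fin (v G)) → (i == j) ≡ (j == i)
    ==-sym i j with i ≟ j | j ≟ i
    ... | yes _ | yes _ = refl
    ... | no _  | no _  = refl
    ... | yes refl | no ¬p = ⊥-elim (¬p refl)
    ... | no ¬p | yes refl = ⊥-elim (¬p refl)
    symC : ∀ i j → (not (adj G i j) ∧ not (i == j)) ≡ (not (adj G j i) ∧ not (j == i))
    symC i j = cong₂ (λ a b → not a ∧ not b) (sym G i j) (==-sym i j)
    irrC : ∀ i → (not (adj G i i) ∧ not (i == i)) ≡ false
    irrC i with i ≟ i
    ... | yes _ = ∧-zeroʳ _
    ... | no ¬p = ⊥-elim (¬p refl)

deleteEdge : (H : Graph) → Fin (v H) → Fin (v H) → Graph
deleteEdge H a b = record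
  { n      = v H
  ; adj    = λ i j → adj H i j ∧ not (isab i j ∨ isab j i)
  ; sym    = λ i j → cong₂ _∧_ (sym H i j) (cong not (∨-comm (isab i j) (isab j i)))
  ; irrefl = λ i → cong (_∧ not (isab i i ∨ isab i i)) (irrefl H i)
  }
  where
    isab : Fin (v H) → Fin (v H) → Bool
    isab i j = (i == a) ∧ (j == b)

proper : (H : Graph) {c : ℕ} → Vec (Fin c) (v H) → Bool
proper H f = all (λ p → not (adj H (proj₁ p) (proj₂ p))
                        ∨ not (lookup f (proj₁ p) == lookup f (proj₂ p)))
                 (allPairs (v H))

colourable : ℕ → Graph → Bool
colourable c H = any (proper H) (allVecs c (v H))

-- search c, c+1, …, (fuel many); v(H) colours always suffice
χsearch : Graph → ℕ → ℕ → ℕ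
χsearch H c zero       = c
χsearch H c (suc fuel) = if colourable c H then c else χsearch H (suc c) fuel

χ : Graph → ℕ
χ H = χsearch H 0 (v H)

crit : Graph → ℕ
crit H = countB (λ p → adj H (proj₁ p) (proj₂ p)
                       ∧ (χ (deleteEdge H (proj₁ p) (proj₂ p)) <ᵇ χ H))
                (upPairs (v H))

reach : (H : Graph) → ℕ → Fin (v H) → Fin (v H) → Bool
reach H zero    i j = i == j
reach H (suc t) i j = any (λ l → reach H t i l ∧ ((l == j) ∨ adj H l j)) (allFin (v H))

connected : (H : Graph) → Fin (v H) → Fin (v H) → Bool
connected H = reach H (v H)

-- count the vertices that are the least vertex of their component
k : Graph → ℕ
k H = countB (λ i → not (any (λ j → (toℕ j <ᵇ toℕ i) ∧ connected H i j) (allFin (v H))))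
             (allFin (v H))

isHom : (H G : Graph) → Vec (Fin (v G)) (v H) → Bool
isHom H G f = all (λ p → not (adj H (proj₁ p) (proj₂ p))
                         ∨ adj G (lookup f (proj₁ p)) (lookup f (proj₂ p)))
                  (allPairs (v H))

hom : Graph → Graph → ℕ
hom H G = countB (isHom H G) (allVecs (v G) (v H))

-- a / d in ℚ, with the (irrelevant) convention a / 0 = 0
frac : ℕ → ℕ → ℚ
frac a zero    = 0ℚ
frac a (suc d) = + a / suc d

t : Graph → Graph → ℚ
t H G = frac (hom H G) (v G ^ v H)

-- Multiplicity goodness:  the displayed sum is ≥ 1 - o(1) as v(G) → ∞,
-- i.e. for every ε > 0 there is N with the sum ≥ 1 - ε whenever v(G) ≥ N.

ℕtoℚ : ℕ → ℚ
ℕtoℚ m = + m / 1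

MultiplicityGood : Graph → Graph → Set
MultiplicityGood H₁ H₂ =
  ∀ (ε : ℚ) → 0ℚ <ℚ ε →
    Σ ℕ λ N → ∀ (G : Graph) → N ≤ v G →
      (1ℚ -ℚ ε) ≤ℚ
        ((ℕtoℚ ((χ H₂ ∸ 1) ^ (v H₁ ∸ k H₁)) *ℚ t H₁ G)
         +ℚ (ℕtoℚ ((χ H₁ ∸ 1) ^ (v H₂ ∸ k H₂)) *ℚ t H₂ (complement G)))

{-# OPTIONS --safe #-}
module Submission where

-- Write q = χ(H₂) - 1.  If G is a disjoint union of q complete M-partite graphs with equal parts, then the sum is
-- 1 - e(H₁)/M + c/M + O(1/M²), where c is a multiple of the number of maps V(H₂) → [q] with exactly one monochromatic
-- edge.  So it suffices to bound, for a critical edge uv, the number of q-colourings f of H₂ - uv; they all give u and v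
-- the same colour.  Reveal f along an order of the vertices: u and v first, then the neighbours of u in the order of a
-- permutation l, every other vertex as soon as it has a revealed neighbour.  If a(w) is the number of colours still
-- possible for w, then the sum of ∏ 1/a(w) over all f is at most 1, so by the AM-GM inequality it suffices to bound the
-- geometric mean of ∏ a(w) over l.  In general a(w) ≤ q - 1.  Moreover, since u can never be recoloured, for each colour
-- j ≠ f(u) some neighbour y of u with f(y) = j sees every other colour, and sees it early: as soon as a certain other
-- letter of l precedes y.  As in Brègman's theorem the geometric mean of a(y) is then at most ((q-1)!)^(1/(q-1)).

-- No fixed order is enough, since the neighbours of `u` that see many colours depend on the
-- colouring. Averaging over all words costs nothing, because the reciprocals sum to at most 1 for
-- each word separately. The bound `q - 1` alone would leave a factor `(q-1)^(q-1)` for the `q - 1`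
-- distinguished neighbours; the average lowers it to `(q-1)!`.
--
-- A neighbour of `y` that can be reached only through `y` is revealed after `y` and does not
-- restrict it, so it must not count as a witness that `y` sees a colour. This is harmless:
-- exchanging two colours on everything behind `y` lets `y` be recoloured whatever colours occur
-- there.
--
-- Each component of `H₂` that avoids the edge `uv` begins with a vertex that has all `q` colours;
-- together with `u` these vertices give the factor `q ^ k H₂`.
--
-- All estimates stay in `ℕ`: reciprocals are scaled by `q !`, and roots are avoided by comparing
-- powers. For `χ(H₂) = 4` the stated hypothesis implies the inequality of the generic case, so the
-- same graphs `G` serve both.

open import Defs
open import Data.Bool using (Bool; true; false; _∧_; _∨_; not; if_then_else_) renaming (T to True)
open import Data.Bool.ListAction using (any; all)
open import Data.Bool.Properties using (∧-zeroʳ; ∨-zeroʳ)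
import Data.Bool.Properties as Bool
open import Data.Empty using (⊥; ⊥-elim)
open import Data.Fin using (Fin; zero; suc; toℕ; remQuot; combine)
import Data.Fin as Fin
open import Data.Fin.Properties using (_≟_; toℕ<n; toℕ-injective)
import Data.Fin.Properties as Fin
open import Data.Integer using () renaming (+_ to pos_)
import Data.Integer as ℤ
import Data.Integer.Properties as ℤ
open import Data.List using (List; []; _∷_; map; length; _++_; concatMap; allFin; filter; filterᵇ; cartesianProduct)
open import Data.List.Membership.Propositional using (_∈_; _∉_)
open import Data.List.Membership.Propositional.Properties using (∈-allFin; ∈-map⁺; ∈-concatMap⁺; ∈-filter⁺; ∈-filter⁻; ∈-length; ∈-++⁻; ∈-cartesianProduct⁺)
open import Data.List.Membership.Propositional.Properties.WithK using (unique∧set⇒bag)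
import Data.List.Membership.DecPropositional as DecMembership
open import Data.List.Properties using (length-tabulate; ++-assoc; ++-identityʳ)
open import Data.List.Relation.Binary.BagAndSetEquality using (∼bag⇒↭)
open import Data.List.Relation.Binary.Permutation.Propositional using (_↭_; refl; prep; swap; trans)
open import Data.List.Relation.Binary.Permutation.Propositional.Properties using (↭-length)
open import Data.List.Relation.Unary.All using (All; []; _∷_)
import Data.List.Relation.Unary.All as All
open import Data.List.Relation.Unary.AllPairs using (AllPairs; []; _∷_)
open import Data.List.Relation.Unary.AllPairs.Properties using (tabulate⁺-<)
open import Data.List.Relation.Unary.Any using (Any; here; there)
open import Data.List.Relation.Unary.Unique.DecPropositional using (unique?)
open import Data.List.Relation.Unary.Unique.Propositional using (Unique)
open import Data.List.Relation.Unary.Unique.Propositional.Properties using (allFin⁺; map⁺; filter⁺; cartesianProduct⁺)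
open import Data.Nat hiding (_≟_)
open import Data.Nat.DivMod using (_/_; m/n*n≤m; m/n*n≡m)
open import Data.Nat.Divisibility using (∣-trans; m≤n⇒m!∣n!; m∣m*n)
open import Data.Nat.Properties hiding (_≟_)
open import Data.Nat.Properties using () renaming (_≟_ to _≟ℕ_)
open import Data.Nat.Tactic.RingSolver using (solve-∀)
open import Data.Product using (_×_; _,_; proj₁; proj₂; ∃; Σ; uncurry)
open import Data.Product.Properties using (≡-dec)
open import Data.Rational using (ℚ; 0ℚ; 1ℚ; fromℚᵘ) renaming (_<_ to _<ℚ_; _≤_ to _≤ℚ_; _+_ to _+ℚ_; _*_ to _*ℚ_; _-_ to _-ℚ_; -_ to -ℚ_)
import Data.Rational.Properties as ℚ
open import Data.Rational.Unnormalised using (mkℚᵘ; *≤*; *<*; *≡*) renaming (_+_ to _+ᵘ_; _*_ to _*ᵘ_)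
import Data.Rational.Unnormalised.Properties as ℚᵘ
open import Data.Sum using (_⊎_; inj₁; inj₂)
import Data.Sum as Sum
open import Data.Unit using (⊤; tt)
open import Data.Vec using (Vec; lookup; tabulate; _[_]≔_) renaming ([] to []ᵥ; _∷_ to _∷ᵥ_; map to mapᵥ)
open import Data.Vec.Properties using (lookup∘update; lookup∘update′; lookup∘tabulate; lookup-map; map-∘)
open import Function using (_∘_; id; mk⇔)
open import Relation.Binary.Definitions using (Tri; tri<; tri≈; tri>)
open import Relation.Binary.PropositionalEquality using (_≡_; _≢_; refl; cong; cong₂; subst; subst₂; module ≡-Reasoning) renaming (sym to ≡-sym; trans to ≡-trans)
open import Relation.Nullary using (¬_; Dec; yes; no; does; contradiction)
open import Relation.Nullary.Decidable using (_×-dec_; _⊎-dec_; _→-dec_; ¬?; decidable-stable; dec-true; dec-false; does-⇔)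

-- Finite sums and products

⟦_⟧ : Bool → ℕ
⟦ true ⟧ = 1
⟦ false ⟧ = 0

⟦⟧≤1 : ∀ b → ⟦ b ⟧ ≤ 1
⟦⟧≤1 true = ≤-refl
⟦⟧≤1 false = z≤n

∑ ∏ : {A : Set} → List A → (A → ℕ) → ℕ
∑ [] f = 0
∑ (x ∷ xs) f = f x + ∑ xs f
∏ [] f = 1
∏ (x ∷ xs) f = f x * ∏ xs f

∑-cong : ∀ {A : Set} {f g : A → ℕ} (xs : List A) → (∀ x → f x ≡ g x) → ∑ xs f ≡ ∑ xs g
∑-cong [] h = refl
∑-cong (x ∷ xs) h = cong₂ _+_ (h x) (∑-cong xs h)

∑-cong-∈ : ∀ {A : Set} {f g : A → ℕ} (xs : List A) → (∀ x → x ∈ xs → f x ≡ g x) → ∑ xs f ≡ ∑ xs g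
∑-cong-∈ [] h = refl
∑-cong-∈ (x ∷ xs) h = cong₂ _+_ (h x (here refl)) (∑-cong-∈ xs λ y y∈ → h y (there y∈))

∑-mono : ∀ {A : Set} {f g : A → ℕ} (xs : List A) → (∀ x → f x ≤ g x) → ∑ xs f ≤ ∑ xs g
∑-mono [] h = z≤n
∑-mono (x ∷ xs) h = +-mono-≤ (h x) (∑-mono xs h)

∑-mono-∈ : ∀ {A : Set} {f g : A → ℕ} (xs : List A) → (∀ x → x ∈ xs → f x ≤ g x) → ∑ xs f ≤ ∑ xs g
∑-mono-∈ [] h = z≤n
∑-mono-∈ (x ∷ xs) h = +-mono-≤ (h x (here refl)) (∑-mono-∈ xs λ y y∈ → h y (there y∈))

∑-distrib-+ : ∀ {A : Set} {f g : A → ℕ} (xs : List A) → ∑ xs (λ x → f x + g x) ≡ ∑ xs f + ∑ xs g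
∑-distrib-+ [] = refl
∑-distrib-+ {f = f} {g = g} (x ∷ xs) rewrite ∑-distrib-+ {f = f} {g = g} xs =
  +-interchange (f x) (g x) (∑ xs f) (∑ xs g)
  where
    +-interchange : ∀ a b c d → a + b + (c + d) ≡ a + c + (b + d)
    +-interchange = solve-∀

∑-*ˡ : ∀ {A : Set} {f : A → ℕ} c (xs : List A) → ∑ xs (λ x → c * f x) ≡ c * ∑ xs f
∑-*ˡ c [] = ≡-sym (*-zeroʳ c)
∑-*ˡ {f = f} c (x ∷ xs) rewrite ∑-*ˡ {f = f} c xs = ≡-sym (*-distribˡ-+ c (f x) (∑ xs f))

∑-*ʳ : ∀ {A : Set} {f : A → ℕ} c (xs : List A) → ∑ xs (λ x → f x * c) ≡ ∑ xs f * c
∑-*ʳ {f = f} c xs = ≡-trans (∑-cong xs λ x → *-comm (f x) c) (≡-trans (∑-*ˡ c xs) (*-comm c (∑ xs f)))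

∑-const : ∀ {A : Set} c (xs : List A) → ∑ xs (λ _ → c) ≡ length xs * c
∑-const c [] = refl
∑-const c (x ∷ xs) = cong (c +_) (∑-const c xs)

∑-swap : ∀ {A B : Set} (h : A → B → ℕ) (xs : List A) (ys : List B) →
  ∑ xs (λ x → ∑ ys (h x)) ≡ ∑ ys (λ y → ∑ xs (λ x → h x y))
∑-swap h [] ys = ≡-sym (≡-trans (∑-const 0 ys) (*-zeroʳ (length ys)))
∑-swap h (x ∷ xs) ys rewrite ∑-swap h xs ys = ≡-sym (∑-distrib-+ ys)

∑-map : ∀ {A B : Set} (h : A → B) (xs : List A) {f : B → ℕ} → ∑ (map h xs) f ≡ ∑ xs (f ∘ h)
∑-map h [] = refl
∑-map h (x ∷ xs) {f} = cong (f (h x) +_) (∑-map h xs)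

∑-++ : ∀ {A : Set} {f : A → ℕ} (xs ys : List A) → ∑ (xs ++ ys) f ≡ ∑ xs f + ∑ ys f
∑-++ [] ys = refl
∑-++ {f = f} (x ∷ xs) ys rewrite ∑-++ {f = f} xs ys = ≡-sym (+-assoc (f x) _ _)

∑-concatMap : ∀ {A B : Set} (h : A → List B) (xs : List A) {f : B → ℕ} → ∑ (concatMap h xs) f ≡ ∑ xs (λ x → ∑ (h x) f)
∑-concatMap h [] = refl
∑-concatMap h (x ∷ xs) {f} rewrite ∑-++ {f = f} (h x) (concatMap h xs) = cong (∑ (h x) f +_) (∑-concatMap h xs)

∑-single : ∀ {A : Set} (f : A → ℕ) {x : A} {xs : List A} → x ∈ xs → f x ≤ ∑ xs f
∑-single f (here refl) = m≤m+n (f _) _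
∑-single f {xs = y ∷ xs} (there x∈) = ≤-trans (∑-single f x∈) (m≤n+m _ (f y))

∏-cong : ∀ {A : Set} {f g : A → ℕ} (xs : List A) → (∀ x → f x ≡ g x) → ∏ xs f ≡ ∏ xs g
∏-cong [] h = refl
∏-cong (x ∷ xs) h = cong₂ _*_ (h x) (∏-cong xs h)

∏-cong-∈ : ∀ {A : Set} {f g : A → ℕ} (xs : List A) → (∀ x → x ∈ xs → f x ≡ g x) → ∏ xs f ≡ ∏ xs g
∏-cong-∈ [] h = refl
∏-cong-∈ (x ∷ xs) h = cong₂ _*_ (h x (here refl)) (∏-cong-∈ xs λ y y∈ → h y (there y∈))

∏-mono : ∀ {A : Set} {f g : A → ℕ} (xs : List A) → (∀ x → f x ≤ g x) → ∏ xs f ≤ ∏ xs g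
∏-mono [] h = ≤-refl
∏-mono (x ∷ xs) h = *-mono-≤ (h x) (∏-mono xs h)

∏-mono-∈ : ∀ {A : Set} {f g : A → ℕ} (xs : List A) → (∀ x → x ∈ xs → f x ≤ g x) → ∏ xs f ≤ ∏ xs g
∏-mono-∈ [] h = ≤-refl
∏-mono-∈ (x ∷ xs) h = *-mono-≤ (h x (here refl)) (∏-mono-∈ xs λ y y∈ → h y (there y∈))

*-interchange : ∀ a b c d → a * b * (c * d) ≡ a * c * (b * d)
*-interchange = solve-∀

∏-distrib-* : ∀ {A : Set} {f g : A → ℕ} (xs : List A) → ∏ xs (λ x → f x * g x) ≡ ∏ xs f * ∏ xs g
∏-distrib-* [] = refl
∏-distrib-* {f = f} {g = g} (x ∷ xs) rewrite ∏-distrib-* {f = f} {g = g} xs =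
  *-interchange (f x) (g x) (∏ xs f) (∏ xs g)

∏-const : ∀ {A : Set} c (xs : List A) → ∏ xs (λ _ → c) ≡ c ^ length xs
∏-const c [] = refl
∏-const c (x ∷ xs) = cong (c *_) (∏-const c xs)

∏-1 : ∀ {A : Set} (xs : List A) → ∏ xs (λ _ → 1) ≡ 1
∏-1 xs = ≡-trans (∏-const 1 xs) (^-zeroˡ (length xs))

∏-swap : ∀ {A B : Set} (h : A → B → ℕ) (xs : List A) (ys : List B) →
  ∏ xs (λ x → ∏ ys (h x)) ≡ ∏ ys (λ y → ∏ xs (λ x → h x y))
∏-swap h [] ys = ≡-sym (∏-1 ys)
∏-swap h (x ∷ xs) ys rewrite ∏-swap h xs ys = ≡-sym (∏-distrib-* ys)

^-distribʳ-* : ∀ a b c → (a * b) ^ c ≡ a ^ c * b ^ c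
^-distribʳ-* a b zero = refl
^-distribʳ-* a b (suc c) rewrite ^-distribʳ-* a b c = *-interchange a b (a ^ c) (b ^ c)

∏-^ : ∀ {A : Set} {f : A → ℕ} c (xs : List A) → ∏ xs (λ x → f x ^ c) ≡ ∏ xs f ^ c
∏-^ c [] = ≡-sym (^-zeroˡ c)
∏-^ {f = f} c (x ∷ xs) rewrite ∏-^ {f = f} c xs = ≡-sym (^-distribʳ-* (f x) (∏ xs f) c)

∏-exponents : ∀ {A : Set} c (h : A → ℕ) (xs : List A) → ∏ xs (λ x → c ^ h x) ≡ c ^ ∑ xs h
∏-exponents c h [] = refl
∏-exponents c h (x ∷ xs) rewrite ∏-exponents c h xs = ≡-sym (^-distribˡ-+-* c (h x) (∑ xs h))

∏-map : ∀ {A B : Set} (h : A → B) (xs : List A) {f : B → ℕ} → ∏ (map h xs) f ≡ ∏ xs (f ∘ h)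
∏-map h [] = refl
∏-map h (x ∷ xs) {f} = cong (f (h x) *_) (∏-map h xs)

∏-++ : ∀ {A : Set} {f : A → ℕ} (xs ys : List A) → ∏ (xs ++ ys) f ≡ ∏ xs f * ∏ ys f
∏-++ [] ys = ≡-sym (*-identityˡ _)
∏-++ {f = f} (x ∷ xs) ys rewrite ∏-++ {f = f} xs ys = ≡-sym (*-assoc (f x) _ _)

∏-concatMap : ∀ {A B : Set} (h : A → List B) (xs : List A) {f : B → ℕ} → ∏ (concatMap h xs) f ≡ ∏ xs (λ x → ∏ (h x) f)
∏-concatMap h [] = refl
∏-concatMap h (x ∷ xs) {f} rewrite ∏-++ {f = f} (h x) (concatMap h xs) = cong (∏ (h x) f *_) (∏-concatMap h xs)

∏-↭ : ∀ {A : Set} {f : A → ℕ} → {xs ys : List A} → xs ↭ ys → ∏ xs f ≡ ∏ ys f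
∏-↭ refl = refl
∏-↭ {f = f} (prep x p) = cong (f x *_) (∏-↭ p)
∏-↭ {f = f} (swap {xs = xs} {ys = ys} x y p) rewrite ∏-↭ {f = f} p =
  *-left-comm (f x) (f y) (∏ ys f)
  where
    *-left-comm : ∀ a b c → a * (b * c) ≡ b * (a * c)
    *-left-comm = solve-∀
∏-↭ (trans p p′) = ≡-trans (∏-↭ p) (∏-↭ p′)

∑-↭ : ∀ {A : Set} {f : A → ℕ} → {xs ys : List A} → xs ↭ ys → ∑ xs f ≡ ∑ ys f
∑-↭ refl = refl
∑-↭ {f = f} (prep x p) = cong (f x +_) (∑-↭ p)
∑-↭ {f = f} (swap {xs = xs} {ys = ys} x y p) rewrite ∑-↭ {f = f} p =
  +-left-comm (f x) (f y) (∑ ys f)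
  where
    +-left-comm : ∀ a b c → a + (b + c) ≡ b + (a + c)
    +-left-comm = solve-∀
∑-↭ (trans p p′) = ≡-trans (∑-↭ p) (∑-↭ p′)

∏-filter : ∀ {A : Set} {f : A → ℕ} → {P : A → Set} (P? : ∀ x → Dec (P x)) (xs : List A) →
  ∏ (filter P? xs) f ≡ ∏ xs (λ x → if does (P? x) then f x else 1)
∏-filter P? [] = refl
∏-filter {f = f} P? (x ∷ xs) with does (P? x)
... | true = cong (f x *_) (∏-filter P? xs)
... | false = ≡-trans (∏-filter P? xs) (≡-sym (*-identityˡ _))

countB-∑ : ∀ {A : Set} → (p : A → Bool) (xs : List A) → countB p xs ≡ ∑ xs (λ x → ⟦ p x ⟧)
countB-∑ p [] = refl
countB-∑ p (x ∷ xs) with p x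
... | true = cong suc (countB-∑ p xs)
... | false = countB-∑ p xs

==-refl : ∀ {n} (i : Fin n) → (i == i) ≡ true
==-refl i with i ≟ i
... | yes _ = refl
... | no i≢i = contradiction refl i≢i

==-≡ : ∀ {n} {i j : Fin n} → i ≡ j → (i == j) ≡ true
==-≡ {i = i} refl = ==-refl i

==-≢ : ∀ {n} {i j : Fin n} → i ≢ j → (i == j) ≡ false
==-≢ {i = i} {j} i≢j with i ≟ j
... | yes i≡j = contradiction i≡j i≢j
... | no _ = refl

==⇒≡ : ∀ {n} {i j : Fin n} → (i == j) ≡ true → i ≡ j
==⇒≡ {i = i} {j} p with i ≟ j
... | yes i≡j = i≡j

==-comm : ∀ {n} (i j : Fin n) → (i == j) ≡ (j == i)
==-comm i j with i ≟ j
... | yes refl = ≡-sym (==-refl i)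
... | no i≢j = ≡-sym (==-≢ (i≢j ∘ ≡-sym))

∑-δ-∉ : ∀ {n} {j : Fin n} (F : Fin n → ℕ) {xs} → All (λ x → j ≢ x) xs →
  ∑ xs (λ i → ⟦ i == j ⟧ * F i) ≡ 0
∑-δ-∉ F [] = refl
∑-δ-∉ F (j≢x ∷ a) rewrite ==-≢ (j≢x ∘ ≡-sym) = ∑-δ-∉ F a

∑-δ : ∀ {n} {j : Fin n} (F : Fin n → ℕ) {xs} → Unique xs → j ∈ xs →
  ∑ xs (λ i → ⟦ i == j ⟧ * F i) ≡ F j
∑-δ {j = j} F (a ∷ u) (here refl) rewrite ==-refl j | ∑-δ-∉ F a =
  ≡-trans (+-identityʳ _) (*-identityˡ _)
∑-δ {j = j} F {x ∷ xs} (a ∷ u) (there j∈) rewrite ==-≢ (All.lookup a j∈) = ∑-δ F u j∈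

∏-δ-∉ : ∀ {n} {j : Fin n} (F : Fin n → ℕ) {xs} → All (λ x → j ≢ x) xs →
  ∏ xs (λ i → if i == j then F i else 1) ≡ 1
∏-δ-∉ F [] = refl
∏-δ-∉ F (j≢x ∷ a) rewrite ==-≢ (j≢x ∘ ≡-sym) | ∏-δ-∉ F a = refl

∏-δ : ∀ {n} {j : Fin n} (F : Fin n → ℕ) {xs} → Unique xs → j ∈ xs →
  ∏ xs (λ i → if i == j then F i else 1) ≡ F j
∏-δ {j = j} F (a ∷ u) (here refl) rewrite ==-refl j | ∏-δ-∉ F a = *-identityʳ _
∏-δ {j = j} F {x ∷ xs} (a ∷ u) (there j∈) rewrite ==-≢ (All.lookup a j∈) = ≡-trans (+-identityʳ _) (∏-δ F u j∈)

unique∧complete⇒↭ : ∀ {A : Set} → {xs ys : List A} → Unique xs → Unique ys → (∀ x → x ∈ xs) → (∀ x → x ∈ ys) → xs ↭ ys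
unique∧complete⇒↭ u w c d = ∼bag⇒↭ (unique∧set⇒bag u w (λ {x} → mk⇔ (λ _ → d x) (λ _ → c x)))

-- The inequality of arithmetic and geometric means

^-cancelˡ-≤ : ∀ {a b} n .{{_ : NonZero n}} → a ^ n ≤ b ^ n → a ≤ b
^-cancelˡ-≤ {a} {b} n h with a ≤? b
... | yes a≤b = a≤b
... | no a≰b = contradiction h (<⇒≱ (^-monoˡ-< n (≰⇒> a≰b)))

2ab≤a²+b² : ∀ a b → 2 * (a * b) ≤ a * a + b * b
2ab≤a²+b² zero b = z≤n
2ab≤a²+b² (suc a) zero = ≤-trans (≤-reflexive (cong (2 *_) (*-zeroʳ (suc a)))) z≤n
2ab≤a²+b² (suc a) (suc b) = subst₂ _≤_ (lhs a b) (rhs a b) (+-monoˡ-≤ (2 * a + 2 * b + 2) (2ab≤a²+b² a b))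
  where
    lhs : ∀ a b → 2 * (a * b) + (2 * a + 2 * b + 2) ≡ 2 * ((1 + a) * (1 + b))
    lhs = solve-∀
    rhs : ∀ a b → a * a + b * b + (2 * a + 2 * b + 2) ≡ (1 + a) * (1 + a) + (1 + b) * (1 + b)
    rhs = solve-∀

-- Convexity: `s ^ suc n` lies above its tangent at `t`, with the negative term moved to the other
-- side. The induction multiplies by `s` and absorbs the mixed term with `2ab≤a²+b²`.
power-tangent : ∀ n s t → suc n * (s * t ^ n) ≤ s ^ suc n + n * t ^ suc n
power-tangent zero s t = ≤-reflexive (shape s)
  where
    shape : ∀ s → 1 * (s * 1) ≡ s * 1 + 0
    shape = solve-∀
power-tangent (suc n) s t = +-cancelˡ-≤ (n * (s * (t * p))) _ _ (begin
  n * (s * (t * p)) + suc (suc n) * (s * (t * p)) ≡⟨ step₁ n s t p ⟩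
  suc n * p * (2 * (s * t)) ≤⟨ *-monoʳ-≤ (suc n * p) (2ab≤a²+b² s t) ⟩
  suc n * p * (s * s + t * t) ≡⟨ step₂ n s t p ⟩
  s * (suc n * (s * p)) + suc n * (t * (t * p)) ≤⟨ +-monoˡ-≤ _ (*-monoʳ-≤ s (power-tangent n s t)) ⟩
  s * (s * s ^ n + n * (t * p)) + suc n * (t * (t * p)) ≡⟨ step₃ n s t p (s ^ n) ⟩
  n * (s * (t * p)) + (s * (s * s ^ n) + suc n * (t * (t * p))) ∎)
  where
    open ≤-Reasoning
    p = t ^ n
    step₁ : ∀ n s t p → n * (s * (t * p)) + (2 + n) * (s * (t * p)) ≡ (1 + n) * p * (2 * (s * t))
    step₁ = solve-∀
    step₂ : ∀ n s t p → (1 + n) * p * (s * s + t * t) ≡ s * ((1 + n) * (s * p)) + (1 + n) * (t * (t * p))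
    step₂ = solve-∀
    step₃ : ∀ n s t p r → s * (s * r + n * (t * p)) + (1 + n) * (t * (t * p)) ≡ n * (s * (t * p)) + (s * (s * r) + (1 + n) * (t * (t * p)))
    step₃ = solve-∀

-- The induction step of `am-gm`, where `a` stands for the sum of the first `n` numbers. It is the
-- tangent inequality for `n * (x + a)` and `suc n * a`, with a factor `n` cancelled.
am-gm-step : ∀ n a x → suc n ^ suc n * (a ^ n * x) ≤ n ^ n * (x + a) ^ suc n
am-gm-step zero a x = subst₂ _≤_ (lhs x) (rhs (x + a)) (m≤m+n x a)
  where
    lhs : ∀ x → x ≡ 1 * 1 * (1 * x)
    lhs = solve-∀
    rhs : ∀ y → y ≡ 1 * (y * 1)
    rhs = solve-∀
am-gm-step n@(suc n-1) a x = *-cancelˡ-≤ n (+-cancelʳ-≤ (n * b ^ suc n) _ _ (begin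
  n * (suc n ^ suc n * (a ^ n * x)) + n * (b * b ^ n) ≡⟨ cong (λ z → n * (suc n ^ suc n * (a ^ n * x)) + n * (b * z)) (^-distribʳ-* (suc n) a n) ⟩
  n * (suc n * suc n ^ n * (a ^ n * x)) + n * (b * (suc n ^ n * a ^ n)) ≡⟨ step₁ n a x (suc n ^ n) (a ^ n) ⟩
  suc n * (s * (suc n ^ n * a ^ n)) ≡⟨ cong (λ z → suc n * (s * z)) (^-distribʳ-* (suc n) a n) ⟨
  suc n * (s * b ^ n) ≤⟨ power-tangent n s b ⟩
  s ^ suc n + n * b ^ suc n ≡⟨ cong (_+ n * b ^ suc n) (^-distribʳ-* n (x + a) (suc n)) ⟩
  n * n ^ n * (x + a) ^ suc n + n * b ^ suc n ≡⟨ cong (_+ n * b ^ suc n) (*-assoc n (n ^ n) _) ⟩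
  n * (n ^ n * (x + a) ^ suc n) + n * b ^ suc n ∎))
  where
    open ≤-Reasoning
    s = n * (x + a)
    b = suc n * a
    step₁ : ∀ n a x p r → n * ((1 + n) * p * (r * x)) + n * ((1 + n) * a * (p * r)) ≡ (1 + n) * (n * (x + a) * (p * r))
    step₁ = solve-∀

am-gm : ∀ {A : Set} (xs : List A) (f : A → ℕ) → length xs ^ length xs * ∏ xs f ≤ ∑ xs f ^ length xs
am-gm [] f = ≤-refl
am-gm (x ∷ xs) f = lemma (length xs) refl
  where
    open ≤-Reasoning
    a = ∑ xs f
    lemma : ∀ n → length xs ≡ n → suc (length xs) ^ suc (length xs) * (f x * ∏ xs f) ≤ (f x + a) ^ suc (length xs)
    lemma n refl = *-cancelˡ-≤ (n ^ n) {{m^m≢0 n}} (begin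
      n ^ n * (suc n ^ suc n * (f x * ∏ xs f)) ≡⟨ shape (n ^ n) (suc n ^ suc n) (f x) (∏ xs f) ⟩
      suc n ^ suc n * (n ^ n * ∏ xs f * f x) ≤⟨ *-monoʳ-≤ (suc n ^ suc n) (*-monoˡ-≤ (f x) (am-gm xs f)) ⟩
      suc n ^ suc n * (a ^ n * f x) ≤⟨ am-gm-step n a (f x) ⟩
      n ^ n * (f x + a) ^ suc n ∎)
      where
        shape : ∀ a b c d → a * (b * (c * d)) ≡ b * (a * d * c)
        shape = solve-∀
        m^m≢0 : ∀ m → NonZero (m ^ m)
        m^m≢0 zero = _
        m^m≢0 m@(suc _) = m^n≢0 m m

_∈?_ : ∀ {n} (x : Fin n) (l : List (Fin n)) → Dec (x ∈ l)
_∈?_ = DecMembership._∈?_ _≟_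

-- Orderings of the vertices, and a Brègman-type averaging over them

exchange : ∀ {n} → Fin n → Fin n → Fin n → Fin n
exchange x y z = if z == x then y else (if z == y then x else z)

module _ {n : ℕ} (x y : Fin n) where

  exchange-left : exchange x y x ≡ y
  exchange-left rewrite ==-refl x = refl

  exchange-right : exchange x y y ≡ x
  exchange-right with y ≟ x
  ... | yes y≡x = y≡x
  ... | no _ rewrite ==-refl y = refl

  exchange-other : ∀ {z} → z ≢ x → z ≢ y → exchange x y z ≡ z
  exchange-other z≢x z≢y rewrite ==-≢ z≢x | ==-≢ z≢y = refl

  exchange-involutive : ∀ z → exchange x y (exchange x y z) ≡ z
  exchange-involutive z = cases (z ≟ x) (z ≟ y)
    where
      cases : Dec (z ≡ x) → Dec (z ≡ y) → exchange x y (exchange x y z) ≡ z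
      cases (yes refl) _ = ≡-trans (cong (exchange x y) exchange-left) exchange-right
      cases (no _) (yes refl) = ≡-trans (cong (exchange x y) exchange-right) exchange-left
      cases (no z≢x) (no z≢y) = ≡-trans (cong (exchange x y) (exchange-other z≢x z≢y)) (exchange-other z≢x z≢y)

  exchange-injective : ∀ {z w} → exchange x y z ≡ exchange x y w → z ≡ w
  exchange-injective {z} {w} h =
    ≡-trans (≡-sym (exchange-involutive z)) (≡-trans (cong (exchange x y) h) (exchange-involutive w))

∏-allFin-exchange : ∀ {n} (x y : Fin n) (F : Fin n → ℕ) → ∏ (allFin n) F ≡ ∏ (allFin n) (F ∘ exchange x y)
∏-allFin-exchange {n} x y F = ≡-trans
  (∏-↭ (unique∧complete⇒↭ (allFin⁺ n) (map⁺ (exchange-injective x y) (allFin⁺ n)) ∈-allFin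
    (λ z → subst (_∈ map (exchange x y) (allFin n)) (exchange-involutive x y z) (∈-map⁺ _ (∈-allFin (exchange x y z))))))
  (∏-map (exchange x y) (allFin n))

words : (n L : ℕ) → List (List (Fin n))
words n zero = [] ∷ []
words n (suc L) = concatMap (λ x → map (x ∷_) (words n L)) (allFin n)

∏-words-suc : ∀ n L (F : List (Fin n) → ℕ) →
  ∏ (words n (suc L)) F ≡ ∏ (allFin n) (λ x → ∏ (words n L) (λ l → F (x ∷ l)))
∏-words-suc n L F = ≡-trans (∏-concatMap _ (allFin n)) (∏-cong (allFin n) λ x → ∏-map (x ∷_) (words n L))

∏-words-exchange : ∀ {n} (x y : Fin n) L (F : List (Fin n) → ℕ) →
  ∏ (words n L) F ≡ ∏ (words n L) (F ∘ map (exchange x y))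
∏-words-exchange x y zero F = refl
∏-words-exchange {n} x y (suc L) F = begin
  ∏ (words n (suc L)) F ≡⟨ ∏-words-suc n L F ⟩
  ∏ (allFin n) (λ z → ∏ (words n L) (λ l → F (z ∷ l))) ≡⟨ ∏-allFin-exchange x y _ ⟩
  ∏ (allFin n) (λ z → ∏ (words n L) (λ l → F (exchange x y z ∷ l))) ≡⟨ ∏-cong (allFin n) (λ z → ∏-words-exchange x y L (λ l → F (exchange x y z ∷ l))) ⟩
  ∏ (allFin n) (λ z → ∏ (words n L) (λ l → F (map (exchange x y) (z ∷ l)))) ≡⟨ ∏-words-suc n L _ ⟨
  ∏ (words n (suc L)) (F ∘ map (exchange x y)) ∎
  where open ≡-Reasoning

∈-words : ∀ {n L} (l : List (Fin n)) → length l ≡ L → l ∈ words n L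
∈-words [] refl = here refl
∈-words {n} (x ∷ l) refl = ∈-concatMap⁺ (λ x → map (x ∷_) (words n (length l))) (lemma (∈-allFin x))
  where
    lemma : ∀ {ys} → x ∈ ys → Any (λ y → (x ∷ l) ∈ map (y ∷_) (words n (length l))) ys
    lemma (here refl) = here (∈-map⁺ _ (∈-words l refl))
    lemma (there x∈) = there (lemma x∈)

IsOrder : ∀ {n} → List (Fin n) → Set
IsOrder l = Unique l × (∀ x → x ∈ l)

isOrder? : ∀ {n} (l : List (Fin n)) → Dec (IsOrder l)
isOrder? l = unique? _≟_ l ×-dec Fin.all? (λ x → x ∈? l)

-- Permutations are cut out of all words of length `n`: on words the invariance under exchanging two
-- letters follows letter by letter, and the filter respects it.
orders : (n : ℕ) → List (List (Fin n))
orders n = filter isOrder? (words n n)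

orders-sound : ∀ {n l} → l ∈ orders n → IsOrder l
orders-sound {n} {l} l∈ = proj₂ (∈-filter⁻ isOrder? {v = l} {xs = words n n} l∈)

orders-nonempty : ∀ n → 1 ≤ length (orders n)
orders-nonempty n =
  ∈-length (∈-filter⁺ isOrder? {xs = words n n} (∈-words {L = n} (allFin n) (length-tabulate id)) (allFin⁺ n , ∈-allFin))

IsOrder-exchange : ∀ {n} (x y : Fin n) {l} → IsOrder l → IsOrder (map (exchange x y) l)
IsOrder-exchange x y {l} (u , c) = map⁺ (exchange-injective x y) u ,
  λ z → subst (_∈ map (exchange x y) l) (exchange-involutive x y z) (∈-map⁺ _ (c (exchange x y z)))

map-exchange-involutive : ∀ {n} (x y : Fin n) l → map (exchange x y) (map (exchange x y) l) ≡ l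
map-exchange-involutive x y [] = refl
map-exchange-involutive x y (z ∷ l) = cong₂ _∷_ (exchange-involutive x y z) (map-exchange-involutive x y l)

∏-orders-exchange : ∀ {n} (x y : Fin n) (F : List (Fin n) → ℕ) →
  ∏ (orders n) F ≡ ∏ (orders n) (F ∘ map (exchange x y))
∏-orders-exchange {n} x y F = begin
  ∏ (orders n) F ≡⟨ ∏-filter isOrder? (words n n) ⟩
  ∏ (words n n) (λ l → if does (isOrder? l) then F l else 1) ≡⟨ ∏-words-exchange x y n _ ⟩
  ∏ (words n n) (λ l → if does (isOrder? (π l)) then F (π l) else 1) ≡⟨ ∏-cong (words n n) (λ l → cong (if_then F (π l) else 1) (same l)) ⟩
  ∏ (words n n) (λ l → if does (isOrder? l) then F (π l) else 1) ≡⟨ ∏-filter isOrder? (words n n) ⟨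
  ∏ (orders n) (F ∘ π) ∎
  where
    open ≡-Reasoning
    π = map (exchange x y)
    same : ∀ l → does (isOrder? (π l)) ≡ does (isOrder? l)
    same l = does-⇔ (mk⇔ (λ o → subst IsOrder (map-exchange-involutive x y l) (IsOrder-exchange x y o)) (IsOrder-exchange x y))
      (isOrder? (π l)) (isOrder? l)

prefix : ∀ {n} → List (Fin n) → Fin n → List (Fin n)
prefix [] w = []
prefix (z ∷ l) w = if z == w then [] else z ∷ prefix l w

falling rising : ℕ → ℕ → ℕ
falling a zero = 1
falling a (suc s) = a * falling (a ∸ 1) s
rising a zero = 1
rising a (suc s) = a * rising (suc a) s

falling-+ : ∀ a s s′ → falling a (s + s′) ≡ falling a s * falling (a ∸ s) s′
falling-+ a zero s′ = ≡-sym (*-identityˡ _)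
falling-+ a (suc s) s′ rewrite falling-+ (a ∸ 1) s s′ | ∸-+-assoc a 1 s = ≡-sym (*-assoc a _ _)

falling-! : ∀ a → falling a a ≡ a !
falling-! zero = refl
falling-! (suc a) = cong (suc a *_) (falling-! a)

rising-last : ∀ a s → rising a (suc s) ≡ (a + s) * rising a s
rising-last a zero = cong (_* 1) (≡-sym (+-identityʳ a))
rising-last a (suc s) rewrite rising-last (suc a) s | +-suc a s = lemma a (suc (a + s)) (rising (suc a) s)
  where
    lemma : ∀ a b c → a * (b * c) ≡ b * (a * c)
    lemma = solve-∀

falling-rising : ∀ a s → falling (a + s) (suc s) ≡ rising a (suc s)
falling-rising a zero rewrite +-identityʳ a = refl
falling-rising a (suc s) rewrite rising-last a (suc s) | +-suc a s = cong (suc (a + s) *_) (falling-rising a s)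

-- The factors are paired as `(y + i - t) * (y + j + t)`. Both factors of a pair lie between `y` and
-- `y + (i + j)` and have the same sum as these two, so their product is at least as large. The
-- condition `s ≤ suc i` keeps every falling factor at least `y`.
product-spread : ∀ y i j s → s ≤ suc i → (y * (y + (i + j))) ^ s ≤ falling (y + i) s * rising (y + j) s
product-spread y i j zero _ = ≤-refl
product-spread y i j (suc s) (s≤s s≤i) = ≤-trans (*-mono-≤ head (tail i s≤i))
  (≤-reflexive (*-interchange (y + i) (y + j) _ _))
  where
    head : y * (y + (i + j)) ≤ (y + i) * (y + j)
    head = ≤-trans (m≤m+n _ (i * j)) (≤-reflexive (expand y i j))
      where
        expand : ∀ y i j → y * (y + (i + j)) + i * j ≡ (y + i) * (y + j)
        expand = solve-∀
    tail : ∀ i → s ≤ i → (y * (y + (i + j))) ^ s ≤ falling (y + i ∸ 1) s * rising (suc (y + j)) s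
    tail zero z≤n = ≤-refl
    tail (suc i) s≤ = subst₂ (λ a b → (y * (y + a)) ^ s ≤ falling (y + suc i ∸ 1) s * rising b s) (+-suc i j) (+-suc y j)
      (subst (λ a → (y * (y + (i + suc j))) ^ s ≤ falling a s * rising (y + suc j) s) (cong (_∸ 1) (≡-sym (+-suc y i)))
        (product-spread y i (suc j) s s≤))

module Averaging {n : ℕ} (g : Fin n → ℕ) where

  before : List (Fin n) → Fin n → ℕ
  before l w = ∑ (prefix l w) g

  before-≤ : ∀ {l w} → w ∈ l → before l w + g w ≤ ∑ l g
  before-≤ {z ∷ l} {w} (here refl) rewrite ==-refl w = m≤m+n (g w) _
  before-≤ {z ∷ l} {w} (there w∈) with z ≟ w
  ... | yes refl = m≤m+n (g w) _
  ... | no _ = ≤-trans (≤-reflexive (+-assoc (g z) _ _)) (+-monoʳ-≤ (g z) (before-≤ w∈))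

  -- The product of `k - rank` over the `g x` tokens of `x`, when all tokens are ranked from 0 along
  -- `l`.
  block : ℕ → List (Fin n) → Fin n → ℕ
  block k l x = falling (k ∸ before l x) (g x)

  -- Successive letters occupy successive intervals of ranks, so the falling factorials concatenate.
  ∏-block : ∀ k {l} → Unique l → ∏ l (block k l) ≡ falling k (∑ l g)
  ∏-block k [] = refl
  ∏-block k {z ∷ l} (z∉ ∷ u) = ≡-trans (cong₂ _*_ head tail) (≡-sym (falling-+ k (g z) (∑ l g)))
    where
      head : block k (z ∷ l) z ≡ falling k (g z)
      head rewrite ==-refl z = refl
      tail : ∏ l (block k (z ∷ l)) ≡ falling (k ∸ g z) (∑ l g)
      tail = ≡-trans (∏-cong-∈ l each) (∏-block (k ∸ g z) u)
        where
          each : ∀ x → x ∈ l → block k (z ∷ l) x ≡ block (k ∸ g z) l x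
          each x x∈ rewrite ==-≢ (All.lookup z∉ x∈) = cong (λ a → falling a (g x)) (≡-sym (∸-+-assoc k (g z) _))

  private
    π : Fin n → Fin n → List (Fin n) → List (Fin n)
    π x y = map (exchange x y)

  before-here : ∀ {z w} l → z ≡ w → before (z ∷ l) w ≡ 0
  before-here {z} l refl rewrite ==-refl z = refl

  before-there : ∀ {z w} l → z ≢ w → before (z ∷ l) w ≡ g z + before l w
  before-there l z≢w rewrite ==-≢ z≢w = refl

  before-exchange-∉ : ∀ {x y} {σ : Fin n → Fin n} → σ y ≡ x → (∀ {z} → z ≢ x → z ≢ y → σ z ≡ z) →
    ∀ {l} → All (x ≢_) l → before (map σ l) x ≡ before l y
  before-exchange-∉ σy σz [] = refl
  before-exchange-∉ {x} {y} {σ} σy σz {z ∷ l} (x≢z ∷ a) = cases (z ≟ y)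
    where
      cases : Dec (z ≡ y) → before (map σ (z ∷ l)) x ≡ before (z ∷ l) y
      cases (yes refl) = ≡-trans (before-here (map σ l) σy) (≡-sym (before-here {y} l refl))
      cases (no z≢y) = ≡-trans (cong (λ w → before (w ∷ map σ l) x) (σz (x≢z ∘ ≡-sym) z≢y))
        (≡-trans (before-there (map σ l) (x≢z ∘ ≡-sym))
          (≡-trans (cong (g z +_) (before-exchange-∉ σy σz a)) (≡-sym (before-there l z≢y))))

  -- Here `x` precedes `y` in `l`, and the two have changed places in `l′`. The weight `c` in front
  -- of both and the weight `b` between them are the same in both words.
  record Exchanged (l l′ : List (Fin n)) (x y : Fin n) : Set where
    constructor exchanged
    field
      c b : ℕ
      before-x : before l x ≡ c
      before-y : before l y ≡ c + g x + b
      before-y′ : before l′ y ≡ c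
      before-x′ : before l′ x ≡ c + g y + b

  exchange-positions : ∀ x y → x ≢ y → ∀ {l} → Unique l → x ∈ l → y ∈ l →
    Exchanged l (π x y l) x y ⊎ Exchanged (π x y l) l x y
  exchange-positions x y x≢y {z ∷ l} (z∉ ∷ u) x∈ y∈ = cases (z ≟ x) (z ≟ y)
    where
      l′ = π x y l
      Goal : List (Fin n) → Set
      Goal l″ = Exchanged (z ∷ l) l″ x y ⊎ Exchanged l″ (z ∷ l) x y
      tail : ∀ {w} → w ∈ z ∷ l → w ≢ z → w ∈ l
      tail (here w≡z) w≢z = contradiction w≡z w≢z
      tail (there w∈) _ = w∈
      shift : ∀ {l₁ l₂} → z ≢ x → z ≢ y → Exchanged l₁ l₂ x y → Exchanged (z ∷ l₁) (z ∷ l₂) x y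
      shift {l₁} {l₂} z≢x z≢y (exchanged c b p₁ p₂ p₃ p₄) = exchanged (g z + c) b
        (≡-trans (before-there l₁ z≢x) (cong (g z +_) p₁))
        (≡-trans (before-there l₁ z≢y) (≡-trans (cong (g z +_) p₂) (assoc (g z) c (g x) b)))
        (≡-trans (before-there l₂ z≢y) (cong (g z +_) p₃))
        (≡-trans (before-there l₂ z≢x) (≡-trans (cong (g z +_) p₄) (assoc (g z) c (g y) b)))
        where
          assoc : ∀ a b c d → a + (b + c + d) ≡ a + b + c + d
          assoc = solve-∀
      cases : Dec (z ≡ x) → Dec (z ≡ y) → Goal (π x y (z ∷ l))
      cases (yes refl) _ = subst (λ w → Goal (w ∷ l′)) (≡-sym (exchange-left x y))
        (inj₁ (exchanged 0 (before l y) (before-here {x} l refl) (before-there l x≢y) (before-here {y} l′ refl)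
          (≡-trans (before-there l′ (x≢y ∘ ≡-sym))
            (cong (g y +_) (before-exchange-∉ {x} {y} (exchange-right x y) (exchange-other x y) z∉)))))
      cases (no _) (yes refl) = subst (λ w → Goal (w ∷ l′)) (≡-sym (exchange-right x y))
        (inj₂ (exchanged 0 (before l x) (before-here {x} l′ refl)
          (≡-trans (before-there l′ x≢y)
            (cong (g x +_) (before-exchange-∉ {y} {x} (exchange-left x y) (λ p r → exchange-other x y r p) z∉)))
          (before-here {y} l refl) (before-there l (x≢y ∘ ≡-sym))))
      cases (no z≢x) (no z≢y) = subst (λ w → Goal (w ∷ l′)) (≡-sym (exchange-other x y z≢x z≢y))
        (Sum.map (shift z≢x z≢y) (shift z≢x z≢y)
          (exchange-positions x y x≢y u (tail x∈ (z≢x ∘ ≡-sym)) (tail y∈ (z≢y ∘ ≡-sym))))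

  -- Put `Y = k ∸ before l y`. Because `g y ≡ 1`, the two blocks of `x` are a falling product from
  -- `Y + g x + b` and, read backwards, a rising product from `Y`. So `product-spread` applies
  -- between `Y` and `k ∸ before l′ y`.
  exchanged-block : ∀ k {l l′ x y} → Exchanged l l′ x y → g y ≡ 1 → before l y + 1 ≤ k →
    ((k ∸ before l y) * (k ∸ before l′ y)) ^ g x ≤ block k l x * block k l′ x
  exchanged-block k {x = x} {y} (exchanged c b p₁ p₂ p₃ p₄) gy h
    rewrite p₁ | p₂ | p₃ | p₄ | gy = lemma (g x) refl (k ∸ (c + g x + b)) (≡-sym (m∸n+n≡m (≤-trans (m≤m+n _ 1) h)))
    where
      lemma : ∀ s → s ≡ g x → ∀ Y → k ≡ Y + (c + g x + b) →
        (Y * (k ∸ c)) ^ g x ≤ falling (k ∸ c) (g x) * falling (k ∸ (c + 1 + b)) (g x)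
      lemma zero eq Y _ rewrite ≡-sym eq = ≤-refl
      lemma (suc s) eq Y k≡ rewrite ≡-sym eq =
        subst₂ (λ p r → (Y * p) ^ suc s ≤ falling p (suc s) * falling r (suc s)) (≡-sym k∸c) (≡-sym k∸)
          (subst₂ (λ p r → (Y * (Y + p)) ^ suc s ≤ falling (Y + (suc s + b)) (suc s) * r) (+-identityʳ (suc s + b))
            (≡-trans (cong (λ a → rising a (suc s)) (+-identityʳ Y)) (≡-sym (falling-rising Y s)))
            (product-spread Y (suc s + b) 0 (suc s) (≤-trans (m≤m+n _ b) (n≤1+n _))))
        where
          k∸c : k ∸ c ≡ Y + (suc s + b)
          k∸c = ≡-trans (cong (_∸ c) (≡-trans k≡ (shape Y c (suc s) b))) (m+n∸n≡m (Y + (suc s + b)) c)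
            where
              shape : ∀ Y c s b → Y + (c + s + b) ≡ Y + (s + b) + c
              shape = solve-∀
          k∸ : k ∸ (c + 1 + b) ≡ Y + s
          k∸ = ≡-trans (cong (_∸ (c + 1 + b)) (≡-trans k≡ (shape Y c s b))) (m+n∸n≡m (Y + s) (c + 1 + b))
            where
              shape : ∀ Y c s b → Y + (c + (1 + s) + b) ≡ Y + s + (c + 1 + b)
              shape = solve-∀

  module _ {k : ℕ} {y : Fin n} (gy : g y ≡ 1) (∑g : ∑ (allFin n) g ≡ k) where

    ∑-order : ∀ {l} → IsOrder l → ∑ l g ≡ k
    ∑-order (u , c) = ≡-trans (∑-↭ (unique∧complete⇒↭ u (allFin⁺ n) c ∈-allFin)) ∑g

    exchange-block : ∀ {x l} → x ≢ y → IsOrder l →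
      ((k ∸ before l y) * (k ∸ before (π x y l) y)) ^ g x ≤ block k l x * block k (π x y l) x
    exchange-block {x} {l} x≢y o@(u , c) = cases (exchange-positions x y x≢y u (c x) (c y))
      where
        room : ∀ {l} → IsOrder l → before l y + 1 ≤ k
        room {l} o = subst₂ (λ a b → before l y + a ≤ b) gy (∑-order o) (before-≤ (proj₂ o y))
        cases : Exchanged l (π x y l) x y ⊎ Exchanged (π x y l) l x y →
          ((k ∸ before l y) * (k ∸ before (π x y l) y)) ^ g x ≤ block k l x * block k (π x y l) x
        cases (inj₁ e) = exchanged-block k e gy (room o)
        cases (inj₂ e) = subst₂ (λ a b → a ^ g x ≤ b) (*-comm _ (k ∸ before l y)) (*-comm _ (block k l x))
          (exchanged-block k e gy (room (IsOrder-exchange x y o)))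

    private
      Ω = orders n

    -- Exchanging `x` and `y` permutes the orders. In the square of each side every order can
    -- therefore be paired with its exchanged order, and `exchange-block` compares the pairs.
    block-average : ∀ x → ∏ Ω (λ l → (k ∸ before l y) ^ g x) ≤ ∏ Ω (λ l → block k l x)
    block-average x with x ≟ y
    ... | yes refl rewrite gy = ∏-mono Ω λ l → ≤-refl
    ... | no x≢y = ^-cancelˡ-≤ 2 (subst₂ _≤_ (square (∏ Ω a)) (square (∏ Ω b)) (begin
      ∏ Ω a * ∏ Ω a ≡⟨ cong (∏ Ω a *_) (∏-orders-exchange x y a) ⟩
      ∏ Ω a * ∏ Ω (a ∘ π x y) ≡⟨ ∏-distrib-* Ω ⟨
      ∏ Ω (λ l → a l * a (π x y l)) ≡⟨ ∏-cong Ω (λ l → ^-distribʳ-* _ _ (g x)) ⟨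
      ∏ Ω (λ l → ((k ∸ before l y) * (k ∸ before (π x y l) y)) ^ g x)
            ≤⟨ ∏-mono-∈ Ω (λ l l∈ → exchange-block x≢y (orders-sound l∈)) ⟩
      ∏ Ω (λ l → b l * b (π x y l)) ≡⟨ ∏-distrib-* Ω ⟩
      ∏ Ω b * ∏ Ω (b ∘ π x y) ≡⟨ cong (∏ Ω b *_) (∏-orders-exchange x y b) ⟨
      ∏ Ω b * ∏ Ω b ∎))
      where
        open ≤-Reasoning
        a b : List (Fin n) → ℕ
        a l = (k ∸ before l y) ^ g x
        b l = block k l x
        square : ∀ m → m * m ≡ m ^ 2
        square m = cong (m *_) (≡-sym (*-identityʳ m))

    -- Think of x as g x consecutive tokens.  For each order the k tokens have the ranks 0, …, k - 1, and exchanging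
    -- x with y shows that the logarithm of k - rank is for y at most what it is on average for the tokens of x.
    bregman : ∏ Ω (λ l → k ∸ before l y) ^ k ≤ (k !) ^ length Ω
    bregman = begin
      ∏ Ω (λ l → k ∸ before l y) ^ k ≡⟨ cong (∏ Ω (λ l → k ∸ before l y) ^_) ∑g ⟨
      ∏ Ω (λ l → k ∸ before l y) ^ ∑ (allFin n) g ≡⟨ ∏-exponents _ g (allFin n) ⟨
      ∏ (allFin n) (λ x → ∏ Ω (λ l → k ∸ before l y) ^ g x) ≡⟨ ∏-cong (allFin n) (λ x → ∏-^ (g x) Ω) ⟨
      ∏ (allFin n) (λ x → ∏ Ω (λ l → (k ∸ before l y) ^ g x)) ≤⟨ ∏-mono (allFin n) block-average ⟩
      ∏ (allFin n) (λ x → ∏ Ω (λ l → block k l x)) ≡⟨ ∏-swap (λ x l → block k l x) (allFin n) Ω ⟩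
      ∏ Ω (λ l → ∏ (allFin n) (block k l)) ≡⟨ ∏-cong-∈ Ω (λ l l∈ → total (orders-sound l∈)) ⟩
      ∏ Ω (λ l → k !) ≡⟨ ∏-const (k !) Ω ⟩
      (k !) ^ length Ω ∎
      where
        open ≤-Reasoning
        total : ∀ {l} → IsOrder l → ∏ (allFin n) (block k l) ≡ k !
        total {l} o@(u , c) = ≡-trans (∏-↭ (unique∧complete⇒↭ (allFin⁺ n) u ∈-allFin c))
          (≡-trans (∏-block k u) (≡-trans (cong (falling k) (∑-order o)) (falling-! k)))

-- Counting colourings by revealing the vertices one at a time

module _ {q : ℕ} where

  ∑-allVecs-suc : ∀ m (F : Vec (Fin q) (suc m) → ℕ) →
    ∑ (allVecs q (suc m)) F ≡ ∑ (allFin q) (λ c → ∑ (allVecs q m) (λ f → F (c ∷ᵥ f)))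
  ∑-allVecs-suc m F = ≡-trans (∑-concatMap _ (allFin q)) (∑-cong (allFin q) λ c → ∑-map (c ∷ᵥ_) (allVecs q m))

  length-allFin : length (allFin q) ≡ q
  length-allFin = length-tabulate id

  ∑-resample : ∀ {m} (w : Fin m) (F : Vec (Fin q) m → ℕ) →
    q * ∑ (allVecs q m) F ≡ ∑ (allVecs q m) (λ f → ∑ (allFin q) (λ c → F (f [ w ]≔ c)))
  ∑-resample {suc m} zero F = ≡-sym (begin
    ∑ (allVecs q (suc m)) (λ f → ∑ (allFin q) (λ c → F (f [ zero ]≔ c))) ≡⟨ ∑-allVecs-suc m _ ⟩
    ∑ (allFin q) (λ _ → ∑ (allVecs q m) (λ f → ∑ (allFin q) (λ c → F (c ∷ᵥ f)))) ≡⟨ ∑-const _ (allFin q) ⟩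
    length (allFin q) * ∑ (allVecs q m) (λ f → ∑ (allFin q) (λ c → F (c ∷ᵥ f))) ≡⟨ cong₂ _*_ length-allFin (∑-swap (λ f c → F (c ∷ᵥ f)) (allVecs q m) (allFin q)) ⟩
    q * ∑ (allFin q) (λ c → ∑ (allVecs q m) (λ f → F (c ∷ᵥ f))) ≡⟨ cong (q *_) (∑-allVecs-suc m F) ⟨
    q * ∑ (allVecs q (suc m)) F ∎)
    where open ≡-Reasoning
  ∑-resample {suc m} (suc w) F = begin
    q * ∑ (allVecs q (suc m)) F ≡⟨ cong (q *_) (∑-allVecs-suc m F) ⟩
    q * ∑ (allFin q) (λ d → ∑ (allVecs q m) (λ f → F (d ∷ᵥ f))) ≡⟨ ∑-*ˡ q (allFin q) ⟨
    ∑ (allFin q) (λ d → q * ∑ (allVecs q m) (λ f → F (d ∷ᵥ f))) ≡⟨ ∑-cong (allFin q) (λ d → ∑-resample w (λ f → F (d ∷ᵥ f))) ⟩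
    ∑ (allFin q) (λ d → ∑ (allVecs q m) (λ f → ∑ (allFin q) (λ c → F (d ∷ᵥ (f [ w ]≔ c))))) ≡⟨ ∑-allVecs-suc m _ ⟨
    ∑ (allVecs q (suc m)) (λ f → ∑ (allFin q) (λ c → F (f [ suc w ]≔ c))) ∎
    where open ≡-Reasoning

  ∑-allVecs-1 : ∀ m → ∑ (allVecs q m) (λ _ → 1) ≡ q ^ m
  ∑-allVecs-1 zero = refl
  ∑-allVecs-1 (suc m) = ≡-trans (∑-allVecs-suc m _)
    (≡-trans (∑-const _ (allFin q)) (cong₂ _*_ length-allFin (∑-allVecs-1 m)))

module Sequential {m q : ℕ} (γ : List (Fin m) → Fin m → Vec (Fin q) m → ℕ) (M : Fin m → ℕ) where

  -- Up to the scale `M w`, the number `γ P w f` plays the conditional probability of the colour of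
  -- `w` given the colours on `P`. Lists grow at the front: the head is the vertex revealed last.
  weight : List (Fin m) → Vec (Fin q) m → ℕ
  weight [] f = 1
  weight (w ∷ P) f = γ P w f * weight P f

  Layer : List (Fin m) → Fin m → Set
  Layer P w = w ∉ P ×
    (∀ x c f → x ∉ P → x ≢ w → γ P w (f [ x ]≔ c) ≡ γ P w f) ×
    (∀ f → ∑ (allFin q) (λ c → γ P w (f [ w ]≔ c)) ≤ M w)

  Layered : List (Fin m) → Set
  Layered [] = ⊤
  Layered (w ∷ P) = Layer P w × Layered P

  weight-update : ∀ {P} → Layered P → ∀ x c f → x ∉ P → weight P (f [ x ]≔ c) ≡ weight P f
  weight-update {[]} _ x c f x∉ = refl
  weight-update {w ∷ P} ((w∉ , local , _) , L) x c f x∉ =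
    cong₂ _*_ (local x c f (x∉ ∘ there) (x∉ ∘ here)) (weight-update L x c f (x∉ ∘ there))

  -- The colour of the last revealed vertex is summed out first, since the weight of the rest does
  -- not depend on it. The powers of `q` account for the coordinates outside `P`, over which the sum
  -- still runs; they cancel once `P` contains all vertices.
  weight-bound : ∀ {P} → Layered P → q ^ length P * ∑ (allVecs q m) (weight P) ≤ q ^ m * ∏ P M
  weight-bound {[]} _ = ≤-reflexive (≡-trans (+-identityʳ _) (≡-trans (∑-allVecs-1 m) (≡-sym (*-identityʳ _))))
  weight-bound {w ∷ P} ((w∉ , local , total) , L) = begin
    q * q ^ length P * ∑ V (weight (w ∷ P)) ≡⟨ shape₁ q (q ^ length P) _ ⟩
    q ^ length P * (q * ∑ V (weight (w ∷ P))) ≡⟨ cong (q ^ length P *_) (∑-resample w (weight (w ∷ P))) ⟩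
    q ^ length P * ∑ V (λ f → ∑ (allFin q) (λ c → weight (w ∷ P) (f [ w ]≔ c))) ≤⟨ *-monoʳ-≤ (q ^ length P) (∑-mono V inner) ⟩
    q ^ length P * ∑ V (λ f → M w * weight P f) ≡⟨ cong (q ^ length P *_) (∑-*ˡ (M w) V) ⟩
    q ^ length P * (M w * ∑ V (weight P)) ≡⟨ shape₂ (q ^ length P) (M w) _ ⟩
    M w * (q ^ length P * ∑ V (weight P)) ≤⟨ *-monoʳ-≤ (M w) (weight-bound L) ⟩
    M w * (q ^ m * ∏ P M) ≡⟨ shape₂ (M w) (q ^ m) _ ⟩
    q ^ m * (M w * ∏ P M) ∎
    where
      open ≤-Reasoning
      V = allVecs q m
      shape₁ : ∀ a b c → a * b * c ≡ b * (a * c)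
      shape₁ = solve-∀
      shape₂ : ∀ a b c → a * (b * c) ≡ b * (a * c)
      shape₂ = solve-∀
      inner : ∀ f → ∑ (allFin q) (λ c → weight (w ∷ P) (f [ w ]≔ c)) ≤ M w * weight P f
      inner f = begin
        ∑ (allFin q) (λ c → γ P w (f [ w ]≔ c) * weight P (f [ w ]≔ c)) ≡⟨ ∑-cong (allFin q) (λ c → cong (γ P w (f [ w ]≔ c) *_) (weight-update L w c f w∉)) ⟩
        ∑ (allFin q) (λ c → γ P w (f [ w ]≔ c) * weight P f) ≡⟨ ∑-*ʳ (weight P f) (allFin q) ⟩
        ∑ (allFin q) (λ c → γ P w (f [ w ]≔ c)) * weight P f ≤⟨ *-monoˡ-≤ (weight P f) (total f) ⟩
        M w * weight P f ∎

any-cong-∈ : {A : Set} {p r : A → Bool} (xs : List A) → (∀ x → x ∈ xs → p x ≡ r x) → any p xs ≡ any r xs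
any-cong-∈ [] h = refl
any-cong-∈ (x ∷ xs) h = cong₂ _∨_ (h x (here refl)) (any-cong-∈ xs λ y y∈ → h y (there y∈))

any-true⁺ : {A : Set} {p : A → Bool} {xs : List A} {x : A} → x ∈ xs → p x ≡ true → any p xs ≡ true
any-true⁺ (here refl) px rewrite px = refl
any-true⁺ {p = p} {y ∷ xs} (there x∈) px with p y
... | true = refl
... | false = any-true⁺ {p = p} x∈ px

any-true⁻ : {A : Set} {p : A → Bool} (xs : List A) → any p xs ≡ true → ∃ λ x → x ∈ xs × p x ≡ true
any-true⁻ {p = p} (x ∷ xs) h with p x in eq
... | true = x , here refl , eq
... | false = let y , y∈ , py = any-true⁻ {p = p} xs h in y , there y∈ , py

module Reveal {m q : ℕ} (E : Fin m → Fin m → Bool) (u v : Fin m) where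

  seen : List (Fin m) → Fin m → (Fin m → Fin q) → Fin q → Bool
  seen P w φ c = any (λ p → E p w ∧ (φ p == c)) P

  unseen : List (Fin m) → Fin m → (Fin m → Fin q) → ℕ
  unseen P w φ = ∑ (allFin q) (λ c → ⟦ not (seen P w φ c) ⟧)

  unseen≤q : ∀ P w φ → unseen P w φ ≤ q
  unseen≤q P w φ = ≤-trans (∑-mono (allFin q) (λ c → ⟦⟧≤1 (not (seen P w φ c))))
    (≤-reflexive (≡-trans (∑-const 1 (allFin q)) (≡-trans (*-identityʳ _) length-allFin)))

  -- The reciprocal `1 / a` scaled by `q !`, which makes it an integer for `1 ≤ a ≤ q`. A vertex
  -- with no colour left gets 0.
  share : ℕ → ℕ
  share zero = 0
  share a@(suc _) = q ! / a

  share-≤ : ∀ a → a * share a ≤ q !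
  share-≤ zero = z≤n
  share-≤ a@(suc _) = ≤-trans (≤-reflexive (*-comm a _)) (m/n*n≤m (q !) a)

  share-≡ : ∀ {a} → 1 ≤ a → a ≤ q → share a * a ≡ q !
  share-≡ {a@(suc b)} _ a≤q = m/n*n≡m (∣-trans (m∣m*n (b !)) (m≤n⇒m!∣n! a≤q))

  -- The vertex `v` has to copy the colour of `u`, so that the two together account for only `q`
  -- choices.
  γ : List (Fin m) → Fin m → Vec (Fin q) m → ℕ
  γ P w f = if w == u then 1 else (if w == v
    then (if does (u ∈? P) then ⟦ lookup f v == lookup f u ⟧ else 1)
    else ⟦ not (seen P w (lookup f) (lookup f w)) ⟧ * share (unseen P w (lookup f)))

  M : Fin m → ℕ
  M w = if w == u then q else (if w == v then 1 else q !)

  open Sequential γ M public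

  data Based : List (Fin m) → Set where
    base : Based (v ∷ u ∷ [])
    step : ∀ {w P} → w ∉ P → Based P → Based (w ∷ P)

  u∈ : ∀ {P} → Based P → u ∈ P
  u∈ base = there (here refl)
  u∈ (step _ B) = there (u∈ B)

  v∈ : ∀ {P} → Based P → v ∈ P
  v∈ base = here refl
  v∈ (step _ B) = there (v∈ B)

  2≤length : ∀ {P} → Based P → 2 ≤ length P
  2≤length base = ≤-refl
  2≤length (step _ B) = ≤-trans (2≤length B) (n≤1+n _)

  cost : List (Fin m) → (Fin m → Fin q) → ℕ
  cost [] φ = 1
  cost (w ∷ P) φ = (if w == u then 1 else (if w == v then 1 else unseen P w φ)) * cost P φ

  module _ (v≢u : v ≢ u) where

    ∏-M : ∀ {P} → Based P → ∏ P M ≡ q * (q !) ^ (length P ∸ 2)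
    ∏-M base rewrite ==-≢ v≢u | ==-refl v | ==-refl u = shape q
      where
        shape : ∀ q → 1 * (q * 1) ≡ q * 1
        shape = solve-∀
    ∏-M (step {w} {P} w∉ B) rewrite ==-≢ {i = w} {u} (λ { refl → w∉ (u∈ B) }) | ==-≢ {i = w} {v} (λ { refl → w∉ (v∈ B) }) | ∏-M B =
      ≡-trans (shape (q !) q _) (cong (λ e → q * (q !) ^ e) (≡-sym (+-∸-assoc 1 (2≤length B))))
      where
        shape : ∀ a b c → a * (b * c) ≡ b * (a * c)
        shape = solve-∀

    seen-update : ∀ {P} w x c (f : Vec (Fin q) m) d → x ∉ P → seen P w (lookup (f [ x ]≔ c)) d ≡ seen P w (lookup f) d
    seen-update {P} w x c f d x∉ = any-cong-∈ P λ p p∈ →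
      cong (λ i → E p w ∧ (i == d)) (lookup∘update′ (λ p≡x → x∉ (subst (_∈ P) p≡x p∈)) f c)

    unseen-update : ∀ {P} w x c (f : Vec (Fin q) m) → x ∉ P → unseen P w (lookup (f [ x ]≔ c)) ≡ unseen P w (lookup f)
    unseen-update w x c f x∉ = ∑-cong (allFin q) λ d → cong (⟦_⟧ ∘ not) (seen-update w x c f d x∉)

    layered : ∀ {P} → Based P → Layered P
    layered base = layer-v , layer-u , tt
      where
        layer-u : Layer [] u
        layer-u = (λ ()) , local , total
          where
            local : ∀ x c f → x ∉ [] → x ≢ u → γ [] u (f [ x ]≔ c) ≡ γ [] u f
            local x c f _ _ rewrite ==-refl u = refl
            total : ∀ f → ∑ (allFin q) (λ c → γ [] u (f [ u ]≔ c)) ≤ M u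
            total f rewrite ==-refl u = ≤-reflexive (≡-trans (∑-const 1 (allFin q)) (≡-trans (*-identityʳ _) length-allFin))
        layer-v : Layer (u ∷ []) v
        layer-v = (λ { (here v≡u) → v≢u v≡u }) , local , total
          where
            local : ∀ x c f → x ∉ u ∷ [] → x ≢ v → γ (u ∷ []) v (f [ x ]≔ c) ≡ γ (u ∷ []) v f
            local x c f x∉ x≢v rewrite ==-≢ v≢u | ==-refl v | lookup∘update′ {i = v} (x≢v ∘ ≡-sym) f c
              | lookup∘update′ {i = u} (λ u≡x → x∉ (here (≡-sym u≡x))) f c = refl
            total : ∀ f → ∑ (allFin q) (λ c → γ (u ∷ []) v (f [ v ]≔ c)) ≤ M v
            total f rewrite ==-≢ v≢u | ==-refl v | dec-true (u ∈? (u ∷ [])) (here refl) = ≤-reflexive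
              (≡-trans (∑-cong (allFin q) each) (∑-δ (λ _ → 1) (allFin⁺ q) (∈-allFin (lookup f u))))
              where
                each : ∀ c → ⟦ lookup (f [ v ]≔ c) v == lookup (f [ v ]≔ c) u ⟧ ≡ ⟦ c == lookup f u ⟧ * 1
                each c rewrite lookup∘update v f c | lookup∘update′ {i = u} (v≢u ∘ ≡-sym) f c = ≡-sym (*-identityʳ _)
    layered (step {w} {P} w∉ B) = (w∉ , local , total) , layered B
      where
        w≢u : w ≢ u
        w≢u refl = w∉ (u∈ B)
        w≢v : w ≢ v
        w≢v refl = w∉ (v∈ B)
        local : ∀ x c f → x ∉ P → x ≢ w → γ P w (f [ x ]≔ c) ≡ γ P w f
        local x c f x∉ x≢w rewrite ==-≢ w≢u | ==-≢ w≢v | lookup∘update′ {i = w} (x≢w ∘ ≡-sym) f c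
          | seen-update w x c f (lookup f w) x∉ | unseen-update w x c f x∉ = refl
        total : ∀ f → ∑ (allFin q) (λ c → γ P w (f [ w ]≔ c)) ≤ M w
        total f rewrite ==-≢ w≢u | ==-≢ w≢v = begin
          ∑ (allFin q) (λ c → ⟦ not (seen P w (lookup (f [ w ]≔ c)) (lookup (f [ w ]≔ c) w)) ⟧ * share (unseen P w (lookup (f [ w ]≔ c))))
            ≡⟨ ∑-cong (allFin q) (λ c → cong₂ (λ s r → ⟦ not s ⟧ * share r)
                 (≡-trans (cong (seen P w (lookup (f [ w ]≔ c))) (lookup∘update w f c)) (seen-update w w c f c w∉))
                 (unseen-update w w c f w∉)) ⟩
          ∑ (allFin q) (λ c → ⟦ not (seen P w (lookup f) c) ⟧ * share (unseen P w (lookup f)))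
            ≡⟨ ∑-*ʳ (share (unseen P w (lookup f))) (allFin q) ⟩
          unseen P w (lookup f) * share (unseen P w (lookup f))
            ≤⟨ share-≤ (unseen P w (lookup f)) ⟩
          q ! ∎
          where open ≤-Reasoning

    -- For such a colouring all indicators equal 1, and every vertex other than `u` and `v`
    -- contributes `share a * a`, which is `q !`.
    weight-cost : ∀ f → (∀ x y → E x y ≡ true → lookup f x ≢ lookup f y) → lookup f v ≡ lookup f u →
      ∀ {P} → Based P → weight P f * cost P (lookup f) ≡ (q !) ^ (length P ∸ 2)
    weight-cost f proper same base rewrite ==-≢ v≢u | ==-refl v | ==-refl u
      | dec-true (u ∈? (u ∷ [])) (here refl) | same | ==-refl (lookup f u) = refl
    weight-cost f proper same (step {w} {P} w∉ B)
      rewrite ==-≢ {i = w} {u} (λ { refl → w∉ (u∈ B) }) | ==-≢ {i = w} {v} (λ { refl → w∉ (v∈ B) }) = begin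
      ⟦ not (seen P w φ (φ w)) ⟧ * share a * weight P f * (a * cost P φ) ≡⟨ cong (λ s → ⟦ not s ⟧ * share a * weight P f * (a * cost P φ)) own-unseen ⟩
      1 * share a * weight P f * (a * cost P φ) ≡⟨ shape (share a) (weight P f) a (cost P φ) ⟩
      share a * a * (weight P f * cost P φ) ≡⟨ cong₂ _*_ (share-≡ a-positive (unseen≤q P w φ)) (weight-cost f proper same B) ⟩
      q ! * (q !) ^ (length P ∸ 2) ≡⟨ cong ((q !) ^_) (+-∸-assoc 1 (2≤length B)) ⟨
      (q !) ^ (suc (length P) ∸ 2) ∎
      where
        open ≡-Reasoning
        φ = lookup f
        a = unseen P w φ
        shape : ∀ s g a c → 1 * s * g * (a * c) ≡ s * a * (g * c)
        shape = solve-∀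
        own-unseen : seen P w φ (φ w) ≡ false
        own-unseen with seen P w φ (φ w) in eq
        ... | false = refl
        ... | true = let p , p∈ , h = any-true⁻ P eq in
          contradiction (==⇒≡ (∧-trueʳ h)) (proper p w (∧-trueˡ h))
          where
            ∧-trueˡ : ∀ {a b} → a ∧ b ≡ true → a ≡ true
            ∧-trueˡ {true} _ = refl
            ∧-trueʳ : ∀ {a b} → a ∧ b ≡ true → b ≡ true
            ∧-trueʳ {true} h = h
        a-positive : 1 ≤ a
        a-positive = ≤-trans (≤-reflexive (≡-trans (cong (⟦_⟧ ∘ not) (≡-sym own-unseen)) refl))
          (∑-single (λ c → ⟦ not (seen P w φ c) ⟧) (∈-allFin (φ w)))

    module _ {L : Set} {Ω : List L} (order : L → List (Fin m)) (nonempty : 1 ≤ length Ω) (1≤q : 1 ≤ q)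
      (based : ∀ l → l ∈ Ω → Based (order l)) (complete : ∀ l → l ∈ Ω → length (order l) ≡ m) where

      private
        N T : ℕ
        N = (q !) ^ (m ∸ 2)
        T = length Ω
        V = allVecs q m
        instance
          q≢0 : NonZero q
          q≢0 = >-nonZero 1≤q
          T≢0 : NonZero T
          T≢0 = >-nonZero nonempty

      total-weight : ∀ l → l ∈ Ω → ∑ V (weight (order l)) ≤ q * N
      total-weight l l∈ = *-cancelˡ-≤ (q ^ m) {{m^n≢0 q m}}
        (subst₂ (λ a b → q ^ a * ∑ V (weight (order l)) ≤ q ^ m * (q * (q !) ^ (b ∸ 2))) (complete l l∈) (complete l l∈)
          (≤-trans (weight-bound (layered (based l l∈))) (≤-reflexive (cong (q ^ m *_) (∏-M (based l l∈))))))

      -- By `weight-cost` the product of the weights over `Ω` is `N ^ T` divided by the product of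
      -- the costs, hence at least `(N / B) ^ T`. By `am-gm` the mean weight is then at least
      -- `N / B`.
      mean-weight : ∀ f → (∀ x y → E x y ≡ true → lookup f x ≢ lookup f y) → lookup f v ≡ lookup f u →
        ∀ {B} → ∏ Ω (λ l → cost (order l) (lookup f)) ≤ B ^ T → T * N ≤ B * ∑ Ω (λ l → weight (order l) f)
      mean-weight f proper same {B} cheap = ^-cancelˡ-≤ T (begin
        (T * N) ^ T ≡⟨ ^-distribʳ-* T N T ⟩
        T ^ T * N ^ T ≡⟨ cong (T ^ T *_) (∏-const N Ω) ⟨
        T ^ T * ∏ Ω (λ _ → N) ≡⟨ cong (T ^ T *_) (∏-cong-∈ Ω each) ⟩
        T ^ T * ∏ Ω (λ l → weight (order l) f * cost (order l) (lookup f)) ≡⟨ cong (T ^ T *_) (∏-distrib-* Ω) ⟩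
        T ^ T * (∏ Ω (λ l → weight (order l) f) * ∏ Ω (λ l → cost (order l) (lookup f))) ≡⟨ *-assoc (T ^ T) _ _ ⟨
        T ^ T * ∏ Ω (λ l → weight (order l) f) * ∏ Ω (λ l → cost (order l) (lookup f)) ≤⟨ *-mono-≤ (am-gm Ω (λ l → weight (order l) f)) cheap ⟩
        ∑ Ω (λ l → weight (order l) f) ^ T * B ^ T ≡⟨ *-comm _ (B ^ T) ⟩
        B ^ T * ∑ Ω (λ l → weight (order l) f) ^ T ≡⟨ ^-distribʳ-* B _ T ⟨
        (B * ∑ Ω (λ l → weight (order l) f)) ^ T ∎)
        where
          open ≤-Reasoning
          each : ∀ l → l ∈ Ω → N ≡ weight (order l) f * cost (order l) (lookup f)
          each l l∈ = ≡-sym (≡-trans (weight-cost f proper same (based l l∈)) (cong (λ a → (q !) ^ (a ∸ 2)) (complete l l∈)))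

      -- Double counting of weights: each order distributes at most `q * N`, while each admissible
      -- colouring collects at least `T * N / B` over all orders.
      count-bound : ∀ (adm : Vec (Fin q) m → Bool) {B} →
        (∀ f → adm f ≡ true → (∀ x y → E x y ≡ true → lookup f x ≢ lookup f y) × lookup f v ≡ lookup f u ×
          ∏ Ω (λ l → cost (order l) (lookup f)) ≤ B ^ T) →
        countB adm V ≤ q * B
      count-bound adm {B} good = *-cancelʳ-≤ _ _ (T * N) {{m*n≢0 T N {{T≢0}} {{m^n≢0 (q !) (m ∸ 2) {{q !≢0}}}}}} (begin
        countB adm V * (T * N) ≡⟨ cong (_* (T * N)) (countB-∑ adm V) ⟩
        ∑ V (λ f → ⟦ adm f ⟧) * (T * N) ≡⟨ ∑-*ʳ (T * N) V ⟨
        ∑ V (λ f → ⟦ adm f ⟧ * (T * N)) ≤⟨ ∑-mono V each ⟩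
        ∑ V (λ f → B * ∑ Ω (λ l → weight (order l) f)) ≡⟨ ∑-*ˡ B V ⟩
        B * ∑ V (λ f → ∑ Ω (λ l → weight (order l) f)) ≡⟨ cong (B *_) (∑-swap (λ f l → weight (order l) f) V Ω) ⟩
        B * ∑ Ω (λ l → ∑ V (weight (order l))) ≤⟨ *-monoʳ-≤ B (∑-mono-∈ Ω total-weight) ⟩
        B * ∑ Ω (λ l → q * N) ≡⟨ cong (B *_) (∑-const (q * N) Ω) ⟩
        B * (T * (q * N)) ≡⟨ shape B T q N ⟩
        q * B * (T * N) ∎)
        where
          open ≤-Reasoning
          shape : ∀ b t q n → b * (t * (q * n)) ≡ q * b * (t * n)
          shape = solve-∀
          each : ∀ f → ⟦ adm f ⟧ * (T * N) ≤ B * ∑ Ω (λ l → weight (order l) f)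
          each f with adm f in eq
          ... | false = z≤n
          ... | true = let proper , same , cheap = good f eq in
            ≤-trans (≤-reflexive (*-identityˡ _)) (mean-weight f proper same {B} cheap)

-- Pigeonhole for lists without repetition

unique-δ-≤1 : ∀ {m} {P : List (Fin m)} → Unique P → ∀ i → ∑ P (λ x → ⟦ x == i ⟧) ≤ 1
unique-δ-≤1 {P = P} U i with i ∈? P
... | yes i∈ = ≤-reflexive (≡-trans (∑-cong P λ x → ≡-sym (*-identityʳ ⟦ x == i ⟧)) (∑-δ (λ _ → 1) U i∈))
... | no i∉ = ≤-trans (≤-reflexive (≡-trans (∑-cong P λ x → ≡-sym (*-identityʳ ⟦ x == i ⟧))
  (∑-δ-∉ (λ _ → 1) (All.tabulate λ x∈ → λ { refl → i∉ x∈ })))) z≤n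

unique⇒length≤ : ∀ {m} {P : List (Fin m)} → Unique P → length P ≤ m
unique⇒length≤ {m} {P} U = begin
  length P ≡⟨ *-identityʳ _ ⟨
  length P * 1 ≡⟨ ∑-const 1 P ⟨
  ∑ P (λ _ → 1) ≡⟨ ∑-cong P (λ x → ∑-δ (λ _ → 1) (allFin⁺ m) (∈-allFin x)) ⟨
  ∑ P (λ x → ∑ (allFin m) (λ i → ⟦ i == x ⟧ * 1)) ≡⟨ ∑-swap (λ x i → ⟦ i == x ⟧ * 1) P (allFin m) ⟩
  ∑ (allFin m) (λ i → ∑ P (λ x → ⟦ i == x ⟧ * 1)) ≡⟨ ∑-cong (allFin m) (λ i → ∑-cong P (λ x → ≡-trans (*-identityʳ _) (cong ⟦_⟧ (==-comm i x)))) ⟩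
  ∑ (allFin m) (λ i → ∑ P (λ x → ⟦ x == i ⟧)) ≤⟨ ∑-mono (allFin m) (unique-δ-≤1 U) ⟩
  ∑ (allFin m) (λ _ → 1) ≡⟨ ∑-const 1 (allFin m) ⟩
  length (allFin m) * 1 ≡⟨ ≡-trans (*-identityʳ _) (length-tabulate id) ⟩
  m ∎
  where open ≤-Reasoning

-- The reveal orders: after u and v the neighbours S of u come in the order of a given word l, and
-- every other vertex is revealed as soon as it has a revealed neighbour.

module Search {m : ℕ} (E : Fin m → Fin m → Bool) (u v : Fin m) where

  S : Fin m → Bool
  S = E u

  -- Vertices of `S` are excluded. They wait until the word calls them, so that their position among
  -- each other is that of the word.
  Candidate : List (Fin m) → Fin m → Set
  Candidate P w = w ∉ P × S w ≡ false × ∃ λ p → p ∈ P × E p w ≡ true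

  candidate? : ∀ P w → Dec (Candidate P w)
  candidate? P w = ¬? (w ∈? P) ×-dec (S w Bool.≟ false) ×-dec Fin.any? (λ p → (p ∈? P) ×-dec (E p w Bool.≟ true))

  Closed : List (Fin m) → Set
  Closed P = ∀ w → ¬ Candidate P w

  closed-∈ : ∀ {P p w} → Closed P → p ∈ P → E p w ≡ true → S w ≡ false → w ∈ P
  closed-∈ {P} {p} {w} C p∈ Epw Sw = decidable-stable (w ∈? P) λ w∉ → C w (w∉ , Sw , p , p∈ , Epw)

  grow : ℕ → List (Fin m) → List (Fin m)
  grow zero P = P
  grow (suc t) P with Fin.any? (candidate? P)
  ... | yes (w , _) = grow t (w ∷ P)
  ... | no _ = P

  grow-⊇ : ∀ t {P x} → x ∈ P → x ∈ grow t P
  grow-⊇ zero x∈ = x∈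
  grow-⊇ (suc t) {P} x∈ with Fin.any? (candidate? P)
  ... | yes _ = grow-⊇ t (there x∈)
  ... | no _ = x∈

  -- Minimality of the closure. It is used to see that whatever belongs to `closure (x ∷ [])` has
  -- been revealed as soon as `x` lies in a closed list of revealed vertices.
  grow-⊆ : ∀ t {P Q} → (∀ {x} → x ∈ P → x ∈ Q) → Closed Q → ∀ {x} → x ∈ grow t P → x ∈ Q
  grow-⊆ zero P⊆Q C x∈ = P⊆Q x∈
  grow-⊆ (suc t) {P} P⊆Q C x∈ with Fin.any? (candidate? P)
  ... | yes (w , _ , Sw , p , p∈ , Epw) = grow-⊆ t (λ { (here refl) → closed-∈ C (P⊆Q p∈) Epw Sw ; (there x∈) → P⊆Q x∈ }) C x∈
  ... | no _ = P⊆Q x∈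

  ∉⇒unique : ∀ {w} {P : List (Fin m)} → w ∉ P → Unique P → Unique (w ∷ P)
  ∉⇒unique w∉ U = All.tabulate (λ x∈ → λ { refl → w∉ x∈ }) ∷ U

  -- When the fuel is spent, the list has at least `m` distinct entries, and a further candidate
  -- would violate the pigeonhole principle.
  grow-closed : ∀ t {P} → Unique P → m ≤ length P + t → Closed (grow t P)
  grow-closed zero {P} U h w (w∉ , _) = <⇒≱ (unique⇒length≤ (∉⇒unique w∉ U))
    (≤-trans h (≤-reflexive (+-identityʳ (length P))))
  grow-closed (suc t) {P} U h with Fin.any? (candidate? P)
  ... | yes (w , w∉ , _) = grow-closed t (∉⇒unique w∉ U) (≤-trans h (≤-reflexive (+-suc (length P) t)))
  ... | no none = λ w c → none (w , c)

  closure : List (Fin m) → List (Fin m)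
  closure = grow m

  closure-closed : ∀ {P} → Unique P → Closed (closure P)
  closure-closed {P} U = grow-closed m U (m≤n+m m (length P))

  -- The argument `R P w` is a certificate about the moment when `w` is revealed and exactly `P` has
  -- been revealed before.
  data Built (R : List (Fin m) → Fin m → Set) : List (Fin m) → Set where
    base : Built R (v ∷ u ∷ [])
    step : ∀ {w P} → w ∉ P → R P w → Built R P → Built R (w ∷ P)

  module _ {R : List (Fin m) → Fin m → Set} where

    built-unique : v ≢ u → ∀ {P} → Built R P → Unique P
    built-unique v≢u base = (v≢u ∷ []) ∷ [] ∷ []
    built-unique v≢u (step w∉ _ B) = ∉⇒unique w∉ (built-unique v≢u B)

    built-u : ∀ {P} → Built R P → u ∈ P
    built-u base = there (here refl)
    built-u (step _ _ B) = there (built-u B)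

    built-v : ∀ {P} → Built R P → v ∈ P
    built-v base = here refl
    built-v (step _ _ B) = there (built-v B)

    grow-built : (∀ {P w} → Candidate P w → R P w) → ∀ t {P} → Built R P → Built R (grow t P)
    grow-built cand zero B = B
    grow-built cand (suc t) {P} B with Fin.any? (candidate? P)
    ... | yes (w , c@(w∉ , _)) = grow-built cand t (step w∉ (cand c) B)
    ... | no _ = B

  insert : Fin m → List (Fin m) → List (Fin m)
  insert x P with x ∈? P
  ... | yes _ = P
  ... | no _ = closure (x ∷ P)

  insert-∋ : ∀ x P → x ∈ insert x P
  insert-∋ x P with x ∈? P
  ... | yes x∈ = x∈
  ... | no _ = grow-⊇ m (here refl)

  insert-⊇ : ∀ x {P z} → z ∈ P → z ∈ insert x P
  insert-⊇ x {P} z∈ with x ∈? P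
  ... | yes _ = z∈
  ... | no _ = grow-⊇ m (there z∈)

  insert-closed : ∀ x {P} → Unique P → Closed P → Closed (insert x P)
  insert-closed x {P} U C with x ∈? P
  ... | yes _ = C
  ... | no x∉ = closure-closed (∉⇒unique x∉ U)

  insert-built : ∀ {R} x → (∀ {P w} → Candidate P w → R P w) → ∀ {P} → (x ∉ P → R P x) → Built R P → Built R (insert x P)
  insert-built x cand {P} r B with x ∈? P
  ... | yes _ = B
  ... | no x∉ = grow-built cand m (step x∉ (r x∉) B)

  revealS revealAll : List (Fin m) → List (Fin m) → List (Fin m)
  revealS P [] = P
  revealS P (x ∷ xs) = revealS (if S x then insert x P else P) xs
  revealAll P [] = P
  revealAll P (x ∷ xs) = revealAll (insert x P) xs

  component : List (Fin m) → List (Fin m)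
  component l = revealS (closure (v ∷ u ∷ [])) l

  reveal : List (Fin m) → List (Fin m)
  reveal l = revealAll (component l) (allFin m)

  FullyClosed : List (Fin m) → Set
  FullyClosed P = ∀ {p w} → p ∈ P → E p w ≡ true → w ∈ P

  -- Certifies that `b` is the least vertex of its component: all smaller vertices lie in a region
  -- that no edge leaves, and `b` does not. As the region includes `component l`, it contains both
  -- ends of the deleted edge and stays closed when that edge is restored.
  record Fresh (P₁ : List (Fin m)) (b : Fin m) : Set where
    field
      region : List (Fin m)
      region-⊇ : ∀ {x} → x ∈ P₁ → x ∈ region
      region-closed : FullyClosed region
      region-smaller : ∀ {j} → j Fin.< b → j ∈ region
      region-∌ : b ∉ region

  -- The first half costs a vertex that is not fresh at least one colour. The second half serves the
  -- finer bound for a vertex of `S`: the letters of `S` before it have been revealed, and so has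
  -- everything reached from them.
  Revealed : List (Fin m) → List (Fin m) → Fin m → Set
  Revealed l P w = ((∃ λ p → p ∈ P × E p w ≡ true) ⊎ Fresh (component l) w) ×
    (S w ≡ true → Closed P × (∀ x → S x ≡ true → x ∈ prefix l w → x ∈ P))

  ∈-prefix-++ : ∀ {x w} done {rest : List (Fin m)} → x ∈ prefix (done ++ w ∷ rest) w → x ∈ done
  ∈-prefix-++ {w = w} [] x∈ rewrite ==-refl w with () ← x∈
  ∈-prefix-++ {w = w} (z ∷ done) x∈ with z ≟ w
  ∈-prefix-++ {w = w} (z ∷ done) () | yes _
  ∈-prefix-++ {w = w} (z ∷ done) (here refl) | no _ = here refl
  ∈-prefix-++ {w = w} (z ∷ done) (there x∈) | no _ = there (∈-prefix-++ done x∈)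

  module _ (v≢u : v ≢ u) (l : List (Fin m)) where

    private
      R = Revealed l

    candidate-revealed : ∀ {P w} → Candidate P w → R P w
    candidate-revealed (w∉ , Sw , p , p∈ , Epw) = inj₁ (p , p∈ , Epw) , λ Sw′ → contradiction (≡-trans (≡-sym Sw′) Sw) λ ()

    revealS-correct : ∀ {P} done rest → l ≡ done ++ rest → Built R P → Closed P →
      (∀ x → S x ≡ true → x ∈ done → x ∈ P) →
      Built R (revealS P rest) × Closed (revealS P rest) × (∀ x → S x ≡ true → x ∈ l → x ∈ revealS P rest)
    revealS-correct {P} done [] l≡ B C S⊆ = B , C , λ x Sx x∈ → S⊆ x Sx (subst (x ∈_) (≡-trans l≡ (++-identityʳ done)) x∈)
    revealS-correct {P} done (y ∷ rest) l≡ B C S⊆ with S y in Sy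
    ... | true = revealS-correct (done ++ y ∷ []) rest (≡-trans l≡ (≡-sym (++-assoc done (y ∷ []) rest)))
        (insert-built y candidate-revealed (λ _ → inj₁ (u , built-u B , Sy) , λ _ → C ,
          λ x Sx x∈ → S⊆ x Sx (∈-prefix-++ done (subst (λ l′ → x ∈ prefix l′ y) l≡ x∈))) B)
        (insert-closed y (built-unique v≢u B) C)
        (λ x Sx x∈ → snoc x Sx (∈-++⁻ done x∈))
      where
        snoc : ∀ x → S x ≡ true → x ∈ done ⊎ x ∈ y ∷ [] → x ∈ insert y P
        snoc x Sx (inj₁ x∈) = insert-⊇ y (S⊆ x Sx x∈)
        snoc x Sx (inj₂ (here refl)) = insert-∋ y P
    ... | false = revealS-correct (done ++ y ∷ []) rest (≡-trans l≡ (≡-sym (++-assoc done (y ∷ []) rest))) B C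
        (λ x Sx x∈ → snoc x Sx (∈-++⁻ done x∈))
      where
        snoc : ∀ x → S x ≡ true → x ∈ done ⊎ x ∈ y ∷ [] → x ∈ P
        snoc x Sx (inj₁ x∈) = S⊆ x Sx x∈
        snoc x Sx (inj₂ (here refl)) = contradiction (≡-trans (≡-sym Sx) Sy) λ ()

    closed⇒fully : ∀ {P} → Closed P → (∀ x → S x ≡ true → x ∈ P) → FullyClosed P
    closed⇒fully C S⊆ {w = w} p∈ Epw with S w in Sw
    ... | true = S⊆ w Sw
    ... | false = closed-∈ C p∈ Epw Sw

    -- The indices are scanned in increasing order. When an unrevealed vertex is met, all smaller
    -- vertices have been revealed and no edge leaves the revealed set, so the vertex is fresh.
    revealAll-correct : ∀ {P} rest → AllPairs Fin._<_ rest → Built R P → Closed P →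
      (∀ x → S x ≡ true → x ∈ P) → (∀ {x} → x ∈ component l → x ∈ P) → (∀ x → x ∈ P ⊎ x ∈ rest) →
      Built R (revealAll P rest) × (∀ x → x ∈ revealAll P rest)
    revealAll-correct {P} [] _ B C S⊆ K⊆ cover = B , λ x → left (cover x)
      where
        left : ∀ {x} → x ∈ P ⊎ x ∈ [] → x ∈ P
        left (inj₁ x∈) = x∈
    revealAll-correct {P} (y ∷ rest) (y< ∷ sorted) B C S⊆ K⊆ cover =
      revealAll-correct rest sorted
        (insert-built y candidate-revealed (λ y∉ → inj₂ (record
          { region = P ; region-⊇ = K⊆ ; region-closed = closed⇒fully C S⊆
          ; region-smaller = smaller ; region-∌ = y∉ }) , λ Sy → contradiction (S⊆ y Sy) y∉) B)
        (insert-closed y (built-unique v≢u B) C)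
        (λ x Sx → insert-⊇ y (S⊆ x Sx)) (λ x∈ → insert-⊇ y (K⊆ x∈)) (λ x → shrink (cover x))
      where
        smaller : ∀ {j} → j Fin.< y → j ∈ P
        smaller {j} j<y with cover j
        ... | inj₁ j∈ = j∈
        ... | inj₂ (here refl) = contradiction j<y (<-irrefl refl)
        ... | inj₂ (there j∈) = contradiction j<y (<-asym (All.lookup y< j∈))
        shrink : ∀ {x} → x ∈ P ⊎ x ∈ y ∷ rest → x ∈ insert y P ⊎ x ∈ rest
        shrink (inj₁ x∈) = inj₁ (insert-⊇ y x∈)
        shrink (inj₂ (here refl)) = inj₁ (insert-∋ y P)
        shrink (inj₂ (there x∈)) = inj₂ x∈

    module _ (complete : ∀ x → x ∈ l) where

      component-correct : Built R (component l) × Closed (component l) × (∀ x → S x ≡ true → x ∈ l → x ∈ component l)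
      component-correct = revealS-correct [] l refl (grow-built candidate-revealed m base)
        (closure-closed (built-unique {R = R} v≢u base)) (λ x Sx ())

      component-closed : FullyClosed (component l)
      component-closed = closed⇒fully (proj₁ (proj₂ component-correct)) λ x Sx → proj₂ (proj₂ component-correct) x Sx (complete x)

      component-∋u : u ∈ component l
      component-∋u = built-u (proj₁ component-correct)

      component-∋v : v ∈ component l
      component-∋v = built-v (proj₁ component-correct)

      reveal-correct : Built R (reveal l) × (∀ x → x ∈ reveal l)
      reveal-correct = revealAll-correct (allFin m) (tabulate⁺-< (λ i<j → i<j)) B C (λ x Sx → S⊆ x Sx (complete x)) (λ x∈ → x∈) (λ x → inj₂ (∈-allFin x))
        where
          B = proj₁ component-correct
          C = proj₁ (proj₂ component-correct)
          S⊆ = proj₂ (proj₂ component-correct)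

-- Recolouring

module Recolour {m q : ℕ} (E : Fin m → Fin m → Bool) (u v : Fin m) (E-sym : ∀ x y → E x y ≡ E y x) where

  open Search E u v

  Proper : (Fin m → Fin q) → Set
  Proper φ = ∀ x y → E x y ≡ true → φ x ≢ φ y

  -- The vertex z is revealed before y as soon as a suitable letter other than y precedes y.
  Reached : Fin m → Fin m → Set
  Reached y z = S z ≡ true ⊎ z ∈ closure (v ∷ u ∷ []) ⊎ ∃ λ x → S x ≡ true × x ≢ y × z ∈ closure (x ∷ [])

  reached? : ∀ y z → Dec (Reached y z)
  reached? y z = (S z Bool.≟ true) ⊎-dec (z ∈? closure (v ∷ u ∷ [])) ⊎-dec
    Fin.any? (λ x → (S x Bool.≟ true) ×-dec ¬? (x ≟ y) ×-dec (z ∈? closure (x ∷ [])))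

  module _ (v≢u : v ≢ u) where

    -- A closure can be left only into `S`, and a vertex of `S` other than `y` is itself an
    -- admissible starting letter. So `y` separates the unreached vertices from the other reached
    -- ones.
    reached-neighbour : ∀ {y z w} → E z w ≡ true → w ≢ y → Reached y w → Reached y z
    reached-neighbour {y} {z} {w} Ezw w≢y r with S z in Sz
    ... | true = inj₁ refl
    ... | false = inj₂ (via r)
      where
        Ewz : E w z ≡ true
        Ewz = ≡-trans (E-sym w z) Ezw
        via : Reached y w → z ∈ closure (v ∷ u ∷ []) ⊎ ∃ λ x → S x ≡ true × x ≢ y × z ∈ closure (x ∷ [])
        via (inj₁ Sw) = inj₂ (w , Sw , w≢y , closed-∈ (closure-closed ([] ∷ [])) (grow-⊇ m (here refl)) Ewz Sz)
        via (inj₂ (inj₁ w∈)) = inj₁ (closed-∈ (closure-closed ((v≢u ∷ []) ∷ [] ∷ [])) w∈ Ewz Sz)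
        via (inj₂ (inj₂ (x , Sx , x≢y , w∈))) = inj₂ (x , Sx , x≢y , closed-∈ (closure-closed ([] ∷ [])) w∈ Ewz Sz)

    unreached-neighbour : ∀ {y z w} → ¬ Reached y z → E z w ≡ true → Reached y w → w ≡ y
    unreached-neighbour {y} {z} {w} ¬r Ezw r = decidable-stable (w ≟ y) λ w≢y → ¬r (reached-neighbour Ezw w≢y r)

    -- Such an `i` is a colour that `x` can move to. Among its neighbours only unreached ones may
    -- have this colour, and these are recoloured along with `x`.
    Blocked : (Fin m → Fin q) → Fin m → Fin q → Set
    Blocked φ x i = i ≢ φ x × ∀ w → E x w ≡ true → φ w ≡ i → ¬ Reached x w

    recolour : (Fin m → Fin q) → Fin m → Fin q → Fin m → Fin q
    recolour φ x i w = if w == x then i else (if does (reached? x w) then φ w else exchange i (φ x) (φ w))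

    module _ {φ : Fin m → Fin q} {x : Fin m} {i : Fin q} where

      recolour-here : recolour φ x i x ≡ i
      recolour-here rewrite ==-refl x = refl

      recolour-reached : ∀ {w} → w ≢ x → Reached x w → recolour φ x i w ≡ φ w
      recolour-reached {w} w≢x r rewrite ==-≢ w≢x | dec-true (reached? x w) r = refl

      recolour-unreached : ∀ {w} → w ≢ x → ¬ Reached x w → recolour φ x i w ≡ exchange i (φ x) (φ w)
      recolour-unreached {w} w≢x ¬r rewrite ==-≢ w≢x | dec-false (reached? x w) ¬r = refl

      -- Edges between the reached and the unreached vertices end in `x`. Among the unreached
      -- vertices an exchange of two colours preserves properness, and a neighbour of `x` there
      -- could receive `i` only if it had the colour `φ x` before.
      recolour-proper : Proper φ → Blocked φ x i → Proper (recolour φ x i)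
      recolour-proper proper (i≢ , blocked) a b Eab = cases (a ≟ x) (b ≟ x) (reached? x a) (reached? x b)
        where
          ψ = recolour φ x i
          around : ∀ {w} → E x w ≡ true → w ≢ x → Dec (Reached x w) → ψ w ≢ i
          around {w} Exw w≢x (yes r) ψw≡i = blocked w Exw (≡-trans (≡-sym (recolour-reached w≢x r)) ψw≡i) r
          around {w} Exw w≢x (no ¬r) ψw≡i = proper x w Exw (≡-sym (exchange-injective i (φ x)
            (≡-trans (≡-sym (recolour-unreached w≢x ¬r)) (≡-trans ψw≡i (≡-sym (exchange-right i (φ x)))))))
          cases : Dec (a ≡ x) → Dec (b ≡ x) → Dec (Reached x a) → Dec (Reached x b) → ψ a ≢ ψ b
          cases (yes refl) (yes refl) _ _ _ = proper a b Eab refl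
          cases (yes refl) (no b≢x) _ rb eq = around Eab b≢x rb (≡-trans (≡-sym eq) recolour-here)
          cases (no a≢x) (yes refl) ra _ eq = around (≡-trans (E-sym b a) Eab) a≢x ra (≡-trans eq recolour-here)
          cases (no a≢x) (no b≢x) (yes ra) (yes rb) eq =
            proper a b Eab (≡-trans (≡-sym (recolour-reached a≢x ra)) (≡-trans eq (recolour-reached b≢x rb)))
          cases (no a≢x) (no b≢x) (no ¬ra) (no ¬rb) eq = proper a b Eab (exchange-injective i (φ x)
            (≡-trans (≡-sym (recolour-unreached a≢x ¬ra)) (≡-trans eq (recolour-unreached b≢x ¬rb))))
          cases (no a≢x) (no b≢x) (yes ra) (no ¬rb) _ = a≢x (unreached-neighbour ¬rb (≡-trans (E-sym b a) Eab) ra)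
          cases (no a≢x) (no b≢x) (no ¬ra) (yes rb) _ = b≢x (unreached-neighbour ¬ra Eab rb)

    module _ {φ : Fin m → Fin q} (proper : Proper φ) (j : Fin q)
      (allBlocked : ∀ x → S x ≡ true → φ x ≡ j → ∃ (Blocked φ x)) where

      -- The field `changed` keeps successive recolourings from interfering: a changed vertex is a
      -- letter of colour `j` treated before or lies behind one, so the neighbours of the next
      -- letter to be treated still have their colours under `φ`.
      record Repaired (xs : List (Fin m)) : Set where
        field
          ψ : Fin m → Fin q
          ψ-proper : Proper ψ
          ψ≢j : ∀ x → x ∈ xs → S x ≡ true → ψ x ≢ j
          changed : ∀ w → ψ w ≢ φ w → ∃ λ x → x ∈ xs × S x ≡ true × φ x ≡ j × (w ≡ x ⊎ ¬ Reached x w)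

      repair : ∀ xs → Repaired xs
      repair [] = record { ψ = φ ; ψ-proper = proper ; ψ≢j = λ x () ; changed = λ w ψw≢ → contradiction refl ψw≢ }
      repair (x ∷ xs) with repair xs
      ... | record { ψ = ψ ; ψ-proper = ψ-proper ; ψ≢j = ψ≢j ; changed = changed } = decide (S x Bool.≟ true) (ψ x ≟ j)
        where
          later : ∀ w → ψ w ≢ φ w → ∃ λ y → y ∈ x ∷ xs × S y ≡ true × φ y ≡ j × (w ≡ y ⊎ ¬ Reached y w)
          later w ψw≢ = let y , y∈ , rest = changed w ψw≢ in y , there y∈ , rest
          decide : Dec (S x ≡ true) → Dec (ψ x ≡ j) → Repaired (x ∷ xs)
          decide (no ¬Sx) _ = record
            { ψ = ψ ; ψ-proper = ψ-proper ; changed = later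
            ; ψ≢j = λ { y (here refl) Sy → contradiction Sy ¬Sx ; y (there y∈) Sy → ψ≢j y y∈ Sy } }
          decide (yes _) (no ψx≢j) = record
            { ψ = ψ ; ψ-proper = ψ-proper ; changed = later
            ; ψ≢j = λ { y (here refl) Sy → ψx≢j ; y (there y∈) Sy → ψ≢j y y∈ Sy } }
          decide (yes Sx) (yes ψx≡j) = record
            { ψ = recolour ψ x i ; ψ-proper = recolour-proper ψ-proper blockedψ ; ψ≢j = new≢j ; changed = new-changed }
            where
              x∉xs : x ∉ xs
              x∉xs x∈ = ψ≢j x x∈ Sx ψx≡j
              φx≡j : φ x ≡ j
              φx≡j with ψ x ≟ φ x
              ... | yes ψx≡φx = ≡-trans (≡-sym ψx≡φx) ψx≡j
              ... | no ψx≢φx = origin (changed x ψx≢φx)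
                where
                  origin : (∃ λ y → y ∈ xs × S y ≡ true × φ y ≡ j × (x ≡ y ⊎ ¬ Reached y x)) → φ x ≡ j
                  origin (y , _ , _ , _ , inj₂ ¬r) = contradiction (inj₁ Sx) ¬r
                  origin (y , _ , _ , φy≡j , inj₁ refl) = φy≡j
              blocked = allBlocked x Sx φx≡j
              i = proj₁ blocked
              i≢j : i ≢ j
              i≢j i≡j = proj₁ (proj₂ blocked) (≡-trans i≡j (≡-sym φx≡j))
              -- A changed neighbour of `x` would either be a letter of colour `j`, the colour of
              -- `x` itself, or lie behind an earlier letter `y` and be adjacent to `x`, which
              -- forces `x ≡ y`.
              unchanged : ∀ w → E x w ≡ true → ψ w ≡ φ w
              unchanged w Exw with ψ w ≟ φ w
              ... | yes eq = eq
              ... | no ψw≢φw = impossible (changed w ψw≢φw)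
                where
                  impossible : (∃ λ y → y ∈ xs × S y ≡ true × φ y ≡ j × (w ≡ y ⊎ ¬ Reached y w)) → ψ w ≡ φ w
                  impossible (y , _ , _ , φy≡j , inj₁ refl) = contradiction (≡-trans φx≡j (≡-sym φy≡j)) (proper x w Exw)
                  impossible (y , y∈ , _ , _ , inj₂ ¬r) = contradiction y∈ (subst (_∉ xs)
                    (unreached-neighbour ¬r (≡-trans (E-sym w x) Exw) (inj₁ Sx)) x∉xs)
              blockedψ : Blocked ψ x i
              blockedψ = (λ i≡ψx → i≢j (≡-trans i≡ψx ψx≡j)) ,
                λ w Exw ψw≡i → proj₂ (proj₂ blocked) w Exw (≡-trans (≡-sym (unchanged w Exw)) ψw≡i)
              new≢j : ∀ y → y ∈ x ∷ xs → S y ≡ true → recolour ψ x i y ≢ j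
              new≢j y (here refl) Sy eq = i≢j (≡-trans (≡-sym (recolour-here {ψ} {x} {i})) eq)
              new≢j y (there y∈) Sy eq = ψ≢j y y∈ Sy (≡-trans (≡-sym (recolour-reached {ψ} {x} {i}
                (λ { refl → x∉xs y∈ }) (inj₁ Sy))) eq)
              new-changed : ∀ w → recolour ψ x i w ≢ φ w →
                ∃ λ y → y ∈ x ∷ xs × S y ≡ true × φ y ≡ j × (w ≡ y ⊎ ¬ Reached y w)
              new-changed w new≢ = cases (w ≟ x) (reached? x w)
                where
                  cases : Dec (w ≡ x) → Dec (Reached x w) →
                    ∃ λ y → y ∈ x ∷ xs × S y ≡ true × φ y ≡ j × (w ≡ y ⊎ ¬ Reached y w)
                  cases (yes w≡x) _ = x , here refl , Sx , φx≡j , inj₁ w≡x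
                  cases (no _) (no ¬r) = x , here refl , Sx , φx≡j , inj₂ ¬r
                  cases (no w≢x) (yes r) = later w λ ψw≡φw → new≢ (≡-trans (recolour-reached {ψ} {x} {i} w≢x r) ψw≡φw)

    Dominant : (Fin m → Fin q) → Fin q → Fin m → Set
    Dominant φ j y = S y ≡ true × φ y ≡ j × ∀ i → i ≢ j → ∃ λ w → E y w ≡ true × φ w ≡ i × Reached y w

    -- Otherwise all vertices of colour j in S can be moved away from j, after which u can take the colour j.
    dominant : (∀ φ → Proper φ → φ u ≡ φ v) → ∀ φ → Proper φ → ∀ j → j ≢ φ u → ∃ (Dominant φ j)
    dominant frozen φ proper j j≢φu with Fin.any? dominant?
      where
        dominant? : ∀ y → Dec (Dominant φ j y)
        dominant? y = (S y Bool.≟ true) ×-dec (φ y ≟ j) ×-dec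
          Fin.all? (λ i → ¬? (i ≟ j) →-dec Fin.any? (λ w → (E y w Bool.≟ true) ×-dec (φ w ≟ i) ×-dec reached? y w))
    ... | yes found = found
    ... | no none = contradiction (frozen ζ ζ-proper) ζu≢ζv
      where
        blocked? : ∀ x i → Dec (Blocked φ x i)
        blocked? x i = ¬? (i ≟ φ x) ×-dec
          Fin.all? (λ w → (E x w Bool.≟ true) →-dec ((φ w ≟ i) →-dec ¬? (reached? x w)))
        allBlocked : ∀ x → S x ≡ true → φ x ≡ j → ∃ (Blocked φ x)
        allBlocked x Sx φx≡j = decidable-stable (Fin.any? (blocked? x)) λ unblocked →
          none (x , Sx , φx≡j , λ i i≢j → decidable-stable
            (Fin.any? (λ w → (E x w Bool.≟ true) ×-dec (φ w ≟ i) ×-dec reached? x w))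
            λ nowhere → unblocked (i , (λ i≡φx → i≢j (≡-trans i≡φx φx≡j)) ,
              λ w Exw φw≡i r → nowhere (w , Exw , φw≡i , r)))
        open Repaired (repair proper j allBlocked (allFin m))
        fixed : ∀ w → S w ≡ false → w ∈ closure (v ∷ u ∷ []) → ψ w ≡ φ w
        fixed w Sw w∈ = decidable-stable (ψ w ≟ φ w) λ ψw≢ → absurd (changed w ψw≢)
          where
            absurd : ¬ (∃ λ x → x ∈ allFin m × S x ≡ true × φ x ≡ j × (w ≡ x ⊎ ¬ Reached x w))
            absurd (x , _ , Sx , _ , inj₁ refl) = contradiction (≡-trans (≡-sym Sx) Sw) λ ()
            absurd (x , _ , _ , _ , inj₂ ¬r) = ¬r (inj₂ (inj₁ w∈))
        Sv : S v ≡ false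
        Sv with S v in eq
        ... | false = refl
        ... | true = contradiction (frozen φ proper) (proper u v eq)
        ζ : Fin m → Fin q
        ζ w = if w == u then j else ψ w
        ζ-u : ζ u ≡ j
        ζ-u rewrite ==-refl u = refl
        ζ-other : ∀ {w} → w ≢ u → ζ w ≡ ψ w
        ζ-other w≢u rewrite ==-≢ w≢u = refl
        ζ-proper : Proper ζ
        ζ-proper a b Eab = cases (a ≟ u) (b ≟ u)
          where
            cases : Dec (a ≡ u) → Dec (b ≡ u) → ζ a ≢ ζ b
            cases (yes refl) (yes refl) _ = proper a b Eab refl
            cases (yes refl) (no b≢u) eq = ψ≢j b (∈-allFin b) Eab (≡-trans (≡-sym (ζ-other b≢u)) (≡-trans (≡-sym eq) ζ-u))
            cases (no a≢u) (yes refl) eq = ψ≢j a (∈-allFin a) (≡-trans (E-sym b a) Eab)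
              (≡-trans (≡-sym (ζ-other a≢u)) (≡-trans eq ζ-u))
            cases (no a≢u) (no b≢u) eq = ψ-proper a b Eab (≡-trans (≡-sym (ζ-other a≢u)) (≡-trans eq (ζ-other b≢u)))
        -- The vertex `v` lies in the closure of `v` and `u` and outside `S`, so it keeps the colour
        -- `φ v`, which equals `φ u`, while `u` now has the colour `j`.
        ζu≢ζv : ζ u ≢ ζ v
        ζu≢ζv eq = j≢φu (≡-trans (≡-sym ζ-u) (≡-trans eq (≡-trans (ζ-other v≢u)
          (≡-trans (fixed v Sv (grow-⊇ m (here refl))) (≡-sym (frozen φ proper))))))

-- Colourings in which two vertices are forced to have the same colour

∑-≢ : ∀ {k} (c : Fin (suc k)) → ∑ (allFin (suc k)) (λ i → ⟦ not (i == c) ⟧) ≡ k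
∑-≢ {k} c = suc-injective (begin
  1 + ∑ F (λ i → ⟦ not (i == c) ⟧) ≡⟨ cong (_+ ∑ F (λ i → ⟦ not (i == c) ⟧)) (∑-δ (λ _ → 1) (allFin⁺ (suc k)) (∈-allFin c)) ⟨
  ∑ F (λ i → ⟦ i == c ⟧ * 1) + ∑ F (λ i → ⟦ not (i == c) ⟧) ≡⟨ ∑-distrib-+ {f = λ i → ⟦ i == c ⟧ * 1} {g = λ i → ⟦ not (i == c) ⟧} F ⟨
  ∑ F (λ i → ⟦ i == c ⟧ * 1 + ⟦ not (i == c) ⟧) ≡⟨ ∑-cong F (λ i → split (i == c)) ⟩
  ∑ F (λ _ → 1) ≡⟨ ∑-const 1 F ⟩
  length F * 1 ≡⟨ ≡-trans (*-identityʳ _) (length-tabulate id) ⟩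
  suc k ∎)
  where
    open ≡-Reasoning
    F = allFin (suc k)
    split : ∀ b → ⟦ b ⟧ * 1 + ⟦ not b ⟧ ≡ 1
    split true = refl
    split false = refl

∈-prefix-self : ∀ {n} l (w : Fin n) → w ∉ prefix l w
∈-prefix-self (z ∷ l) w w∈ with z ≟ w
∈-prefix-self (z ∷ l) w (here refl) | no z≢w = z≢w refl
∈-prefix-self (z ∷ l) w (there w∈) | no _ = ∈-prefix-self l w w∈

∈-prefix⇒∈ : ∀ {n} l (w : Fin n) {x} → x ∈ prefix l w → x ∈ l
∈-prefix⇒∈ (z ∷ l) w x∈ with z ≟ w
∈-prefix⇒∈ (z ∷ l) w (here refl) | no _ = here refl
∈-prefix⇒∈ (z ∷ l) w (there x∈) | no _ = there (∈-prefix⇒∈ l w x∈)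

prefix-unique : ∀ {n} {l} (w : Fin n) → Unique l → Unique (prefix l w)
prefix-unique w [] = []
prefix-unique {l = z ∷ l} w (z∉ ∷ U) with z ≟ w
... | yes _ = []
... | no _ = All.tabulate (λ x∈ → All.lookup z∉ (∈-prefix⇒∈ l w x∈)) ∷ prefix-unique w U

-- Raising factors `k` to `suc k` until there are `σ` of the latter only enlarges the product. If
-- there are at most `σ` factors in all, the truncated exponent is 0.
power-trade : ∀ {k} a b {σ} → a ≤ σ → suc k ^ a * k ^ b ≤ suc k ^ σ * k ^ (a + b ∸ σ)
power-trade {k} a b {σ} a≤σ with a + b ∸ σ in eq
... | suc r = begin
  suc k ^ a * k ^ b ≡⟨ cong (λ s → suc k ^ a * k ^ s) b≡ ⟩
  suc k ^ a * k ^ (σ ∸ a + suc r) ≡⟨ cong (suc k ^ a *_) (^-distribˡ-+-* k (σ ∸ a) (suc r)) ⟩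
  suc k ^ a * (k ^ (σ ∸ a) * k ^ suc r) ≤⟨ *-monoʳ-≤ (suc k ^ a) (*-monoˡ-≤ (k ^ suc r) (^-monoˡ-≤ (σ ∸ a) (n≤1+n k))) ⟩
  suc k ^ a * (suc k ^ (σ ∸ a) * k ^ suc r) ≡⟨ *-assoc (suc k ^ a) _ _ ⟨
  suc k ^ a * suc k ^ (σ ∸ a) * k ^ suc r ≡⟨ cong (_* k ^ suc r) (^-distribˡ-+-* (suc k) a (σ ∸ a)) ⟨
  suc k ^ (a + (σ ∸ a)) * k ^ suc r ≡⟨ cong (λ s → suc k ^ s * k ^ suc r) (m+[n∸m]≡n a≤σ) ⟩
  suc k ^ σ * k ^ suc r ∎
  where
    open ≤-Reasoning
    b≡ : b ≡ σ ∸ a + suc r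
    b≡ = +-cancelˡ-≡ a b _ (≡-trans (≡-sym (m∸n+n≡m {a + b} {σ} (<⇒≤ (m∸n≢0⇒n<m λ z → contradiction (≡-trans (≡-sym eq) z) λ ()))))
      (≡-trans (cong (_+ σ) eq) (≡-trans (+-comm (suc r) σ)
        (≡-trans (cong (_+ suc r) (≡-sym (m+[n∸m]≡n a≤σ))) (+-assoc a (σ ∸ a) (suc r))))))
... | zero = begin
  suc k ^ a * k ^ b ≤⟨ *-monoʳ-≤ (suc k ^ a) (^-monoˡ-≤ b (n≤1+n k)) ⟩
  suc k ^ a * suc k ^ b ≡⟨ ^-distribˡ-+-* (suc k) a b ⟨
  suc k ^ (a + b) ≤⟨ ^-monoʳ-≤ (suc k) {a + b} {σ} (m∸n≡0⇒m≤n eq) ⟩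
  suc k ^ σ ≡⟨ *-identityʳ _ ⟨
  suc k ^ σ * 1 ∎
  where open ≤-Reasoning

module Frozen {m k : ℕ} (E : Fin m → Fin m → Bool) (u v : Fin m) (E-sym : ∀ x y → E x y ≡ E y x) (v≢u : v ≢ u) where

  private
    q = suc k

  open Search E u v
  open Recolour {q = q} E u v E-sym
  module R = Reveal {q = q} E u v

  -- The vertex ρ i is a letter of the word; if it comes before y then y sees the colour i when it is revealed.
  module Tokens (φ : Fin m → Fin q) (proper : Proper φ) {j : Fin q} {y : Fin m} (j≢φu : j ≢ φ u) (dom : Dominant v≢u φ j y) where

    private
      Sy = proj₁ dom
      φy≡j = proj₁ (proj₂ dom)
      witness = proj₂ (proj₂ dom)

    Trigger : Fin q → Fin m → Set
    Trigger i x = x ≢ y × (∀ {l P} → Closed P → (∀ z → S z ≡ true → z ∈ prefix l y → z ∈ P) → u ∈ P → v ∈ P →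
      x ∈ prefix l y → ∃ λ w → w ∈ P × E w y ≡ true × φ w ≡ i)

    trigger : ∀ i → i ≢ j → ∃ (Trigger i)
    trigger i i≢j with witness i i≢j
    ... | w , Eyw , φw≡i , inj₁ Sw = w , (λ { refl → i≢j (≡-trans (≡-sym φw≡i) φy≡j) }) ,
      λ C S⊆ _ _ w∈ → w , S⊆ w Sw w∈ , ≡-trans (E-sym w y) Eyw , φw≡i
    -- Here `w` is revealed before `y` whatever the word is, so any letter other than `y` may serve
    -- as the trigger.
    ... | w , Eyw , φw≡i , inj₂ (inj₁ w∈) = u , (λ { refl → proper u u Sy refl }) ,
      λ {l} {P} C S⊆ u∈ v∈ _ → w , grow-⊆ m (λ { (here refl) → v∈ ; (there (here refl)) → u∈ }) C w∈ , ≡-trans (E-sym w y) Eyw , φw≡i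
    ... | w , Eyw , φw≡i , inj₂ (inj₂ (x , Sx , x≢y , w∈)) = x , x≢y ,
      λ C S⊆ _ _ x∈ → w , grow-⊆ m (λ { (here refl) → S⊆ x Sx x∈ }) C w∈ , ≡-trans (E-sym w y) Eyw , φw≡i

    ρ : Fin q → Fin m
    ρ i with i ≟ j
    ... | yes _ = y
    ... | no i≢j = proj₁ (trigger i i≢j)

    ρ-self : ρ j ≡ y
    ρ-self with j ≟ j
    ... | yes _ = refl
    ... | no j≢j = contradiction refl j≢j

    ρ-trigger : ∀ i → i ≢ j → Trigger i (ρ i)
    ρ-trigger i i≢j with i ≟ j
    ... | yes i≡j = contradiction i≡j i≢j
    ... | no i≢j′ = proj₂ (trigger i i≢j′)

    -- One token for each colour other than `φ u`, placed on the letter that triggers it. The colour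
    -- `φ u` gets none because `y`, a neighbour of `u`, sees it from the start.
    g : Fin m → ℕ
    g x = ∑ (allFin q) (λ i → ⟦ not (i == φ u) ⟧ * ⟦ ρ i == x ⟧)

    open Averaging g

    g-y : g y ≡ 1
    g-y = ≡-trans (∑-cong (allFin q) each) (∑-δ (λ _ → 1) (allFin⁺ q) (∈-allFin j))
      where
        each : ∀ i → ⟦ not (i == φ u) ⟧ * ⟦ ρ i == y ⟧ ≡ ⟦ i == j ⟧ * 1
        each i = cases (i ≟ j)
          where
            cases : Dec (i ≡ j) → ⟦ not (i == φ u) ⟧ * ⟦ ρ i == y ⟧ ≡ ⟦ i == j ⟧ * 1
            cases (yes refl) rewrite ==-≢ j≢φu | ρ-self | ==-refl y | ==-refl j = refl
            cases (no i≢j) rewrite ==-≢ (proj₁ (ρ-trigger i i≢j)) | ==-≢ i≢j = *-zeroʳ ⟦ not (i == φ u) ⟧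

    ∑g : ∑ (allFin m) g ≡ k
    ∑g = begin
      ∑ (allFin m) g ≡⟨ ∑-swap (λ x i → ⟦ not (i == φ u) ⟧ * ⟦ ρ i == x ⟧) (allFin m) (allFin q) ⟩
      ∑ (allFin q) (λ i → ∑ (allFin m) (λ x → ⟦ not (i == φ u) ⟧ * ⟦ ρ i == x ⟧)) ≡⟨ ∑-cong (allFin q) each ⟩
      ∑ (allFin q) (λ i → ⟦ not (i == φ u) ⟧) ≡⟨ ∑-≢ (φ u) ⟩
      k ∎
      where
        open ≡-Reasoning
        each : ∀ i → ∑ (allFin m) (λ x → ⟦ not (i == φ u) ⟧ * ⟦ ρ i == x ⟧) ≡ ⟦ not (i == φ u) ⟧
        each i = ≡-trans (∑-*ˡ ⟦ not (i == φ u) ⟧ (allFin m)) (≡-trans (cong (⟦ not (i == φ u) ⟧ *_)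
          (≡-trans (∑-cong (allFin m) λ x → ≡-trans (cong ⟦_⟧ (==-comm (ρ i) x)) (≡-sym (*-identityʳ _)))
            (∑-δ (λ _ → 1) (allFin⁺ m) (∈-allFin (ρ i))))) (*-identityʳ _))

    -- A colour other than `φ u` is either unseen or has its token before `y`, never both, since
    -- that token would have made it seen. The colour `φ u` is neither.
    unseen-bound : ∀ {l P} → Unique l → Closed P → (∀ z → S z ≡ true → z ∈ prefix l y → z ∈ P) → u ∈ P → v ∈ P →
      R.unseen P y φ ≤ k ∸ before l y
    unseen-bound {l} {P} U C S⊆ u∈ v∈ = m+n≤o⇒m≤o∸n _ (begin
      R.unseen P y φ + before l y ≡⟨ cong (R.unseen P y φ +_) (∑-swap (λ x i → ⟦ not (i == φ u) ⟧ * ⟦ ρ i == x ⟧) (prefix l y) (allFin q)) ⟩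
      R.unseen P y φ + ∑ (allFin q) (λ i → ∑ (prefix l y) (λ x → ⟦ not (i == φ u) ⟧ * ⟦ ρ i == x ⟧))
            ≡⟨ ∑-distrib-+ {f = λ i → ⟦ not (R.seen P y φ i) ⟧} {g = λ i → ∑ (prefix l y) (λ x → ⟦ not (i == φ u) ⟧ * ⟦ ρ i == x ⟧)} (allFin q) ⟨
      ∑ (allFin q) (λ i → ⟦ not (R.seen P y φ i) ⟧ + ∑ (prefix l y) (λ x → ⟦ not (i == φ u) ⟧ * ⟦ ρ i == x ⟧))
            ≤⟨ ∑-mono (allFin q) each ⟩
      ∑ (allFin q) (λ i → ⟦ not (i == φ u) ⟧) ≡⟨ ∑-≢ (φ u) ⟩
      k ∎)
      where
        open ≤-Reasoning
        sees : ∀ {i w} → w ∈ P → E w y ≡ true → φ w ≡ i → R.seen P y φ i ≡ true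
        sees {i} {w} w∈ Ewy refl = any-true⁺ {p = λ p → E p y ∧ (φ p == i)} w∈ (cong₂ _∧_ Ewy (==-refl (φ w)))
        inner : ∀ i → ∑ (prefix l y) (λ x → ⟦ not (i == φ u) ⟧ * ⟦ ρ i == x ⟧) ≡ ⟦ not (i == φ u) ⟧ * ∑ (prefix l y) (λ x → ⟦ x == ρ i ⟧)
        inner i = ≡-trans (∑-*ˡ ⟦ not (i == φ u) ⟧ (prefix l y)) (cong (⟦ not (i == φ u) ⟧ *_) (∑-cong (prefix l y) λ x → cong ⟦_⟧ (==-comm (ρ i) x)))
        each : ∀ i → ⟦ not (R.seen P y φ i) ⟧ + ∑ (prefix l y) (λ x → ⟦ not (i == φ u) ⟧ * ⟦ ρ i == x ⟧) ≤ ⟦ not (i == φ u) ⟧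
        each i rewrite inner i = cases (i ≟ φ u) (ρ i ∈? prefix l y)
          where
            seen-i : ρ i ∈ prefix l y → R.seen P y φ i ≡ true
            seen-i ρi∈ = let w , w∈ , Ewy , φw≡i = proj₂ (ρ-trigger i i≢j) {l} C S⊆ u∈ v∈ ρi∈ in sees w∈ Ewy φw≡i
              where
                i≢j : i ≢ j
                i≢j refl = ∈-prefix-self l y (subst (_∈ prefix l y) ρ-self ρi∈)
            ∑-0 : ρ i ∉ prefix l y → ∑ (prefix l y) (λ x → ⟦ x == ρ i ⟧) ≡ 0
            ∑-0 ρi∉ = ≡-trans (∑-cong (prefix l y) λ x → ≡-sym (*-identityʳ ⟦ x == ρ i ⟧))
              (∑-δ-∉ (λ _ → 1) (All.tabulate λ x∈ → λ { refl → ρi∉ x∈ }))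
            cases : Dec (i ≡ φ u) → Dec (ρ i ∈ prefix l y) →
              ⟦ not (R.seen P y φ i) ⟧ + ⟦ not (i == φ u) ⟧ * ∑ (prefix l y) (λ x → ⟦ x == ρ i ⟧) ≤ ⟦ not (i == φ u) ⟧
            cases (yes refl) _ rewrite ==-refl (φ u) | sees u∈ Sy refl = z≤n
            cases (no i≢φu) (yes ρi∈) rewrite ==-≢ i≢φu | seen-i ρi∈ = ≤-trans (≤-reflexive (+-identityʳ _)) (unique-δ-≤1 (prefix-unique y U) (ρ i))
            cases (no i≢φu) (no ρi∉) rewrite ==-≢ i≢φu | ∑-0 ρi∉ = ≤-trans (≤-reflexive (+-identityʳ _)) (⟦⟧≤1 (not (R.seen P y φ i)))

  module _ (frozen : ∀ φ → Proper φ → φ u ≡ φ v) (initial : List (Fin m) → Fin m → Bool)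
    (fresh⇒initial : ∀ {l w} → l ∈ orders m → Fresh (component l) w → initial l w ≡ true) where

    module Cost (φ : Fin m → Fin q) (proper : Proper φ) where

      dom : ∀ j → j ≢ φ u → ∃ (Dominant v≢u φ j)
      dom = dominant v≢u frozen φ proper

      y : Fin q → Fin m
      y j with j ≟ φ u
      ... | yes _ = u
      ... | no j≢φu = proj₁ (dom j j≢φu)

      -- The colour of `u` has no dominant vertex; it gets the neutral factor 1, and `y` has a dummy
      -- value there that `isDom` rejects.
      F : List (Fin m) → Fin q → ℕ
      F l j with j ≟ φ u
      ... | yes _ = 1
      ... | no j≢φu = k ∸ Averaging.before (Tokens.g φ proper j≢φu (proj₂ (dom j j≢φu))) l (proj₁ (dom j j≢φu))

      isDom : Fin m → Bool
      isDom w = not (φ w == φ u) ∧ (w == y (φ w))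

      free : Fin m → Bool
      free w = not (w == u) ∧ (not (w == v) ∧ not (isDom w))

      -- A bound for the factor of `w` that does not mention the list revealed before `w`, so that
      -- the product over `reveal l` can be rearranged over `allFin m`. It equals 1 at `u` and `v`.
      D h : List (Fin m) → Fin m → ℕ
      D l w = if isDom w then F l (φ w) else 1
      h l w = D l w * (if free w then (if initial l w then q else k) else 1)

      φ-y : ∀ j → j ≢ φ u → φ (y j) ≡ j
      φ-y j j≢φu with j ≟ φ u
      ... | yes j≡φu = contradiction j≡φu j≢φu
      ... | no j≢ = proj₁ (proj₂ (proj₂ (dom j j≢)))

      F-φu : ∀ l → F l (φ u) ≡ 1
      F-φu l with φ u ≟ φ u
      ... | yes _ = refl
      ... | no φu≢ = contradiction refl φu≢

      revealed-bound : ∀ {l P w} → l ∈ orders m → w ≢ u → w ≢ v → u ∈ P → v ∈ P → Revealed l P w →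
        R.unseen P w φ ≤ h l w
      revealed-bound {l} {P} {w} l∈ w≢u w≢v u∈ v∈ (before-or-fresh , S-info) with isDom w in eq
      ... | true = ≤-trans (as-dominant (φ w ≟ φ u) eq) (≤-reflexive (≡-sym (≡-trans (cong (F l (φ w) *_) not-free) (*-identityʳ _))))
        where
          not-free : (if not (w == u) ∧ (not (w == v) ∧ false) then (if initial l w then q else k) else 1) ≡ 1
          not-free rewrite ==-≢ w≢u | ==-≢ w≢v = refl
          as-dominant : Dec (φ w ≡ φ u) → isDom w ≡ true → R.unseen P w φ ≤ F l (φ w)
          as-dominant (yes φw≡φu) d = contradiction (≡-trans (≡-sym d) (cong (λ b → not b ∧ (w == y (φ w))) (≡-trans (cong (_== φ u) φw≡φu) (==-refl (φ u))))) λ ()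
          as-dominant (no φw≢φu) d = bound (==⇒≡ (≡-trans (≡-sym (cong (λ b → not b ∧ (w == y (φ w))) (==-≢ φw≢φu))) d))
            where
              bound : w ≡ y (φ w) → R.unseen P w φ ≤ F l (φ w)
              bound w≡y with φ w ≟ φ u
              ... | yes φw≡φu = contradiction φw≡φu φw≢φu
              ... | no φw≢ = subst (λ x → R.unseen P x φ ≤ k ∸ Averaging.before (Tokens.g φ proper φw≢ (proj₂ (dom (φ w) φw≢))) l (proj₁ (dom (φ w) φw≢))) (≡-sym w≡y)
                (Tokens.unseen-bound φ proper φw≢ (proj₂ (dom (φ w) φw≢)) (proj₁ (orders-sound l∈)) C
                  (λ z Sz z∈ → S⊆ z Sz (subst (λ x → z ∈ prefix l x) (≡-sym w≡y) z∈)) u∈ v∈)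
                where
                  Sw : S w ≡ true
                  Sw = subst (λ x → S x ≡ true) (≡-sym w≡y) (proj₁ (proj₂ (dom (φ w) φw≢)))
                  C = proj₁ (S-info Sw)
                  S⊆ = proj₂ (S-info Sw)
      ... | false rewrite ==-≢ w≢u | ==-≢ w≢v = ≤-trans (ordinary before-or-fresh) (≤-reflexive (≡-sym (*-identityˡ _)))
        where
          ordinary : ((∃ λ p → p ∈ P × E p w ≡ true) ⊎ Fresh (component l) w) → R.unseen P w φ ≤ (if initial l w then q else k)
          ordinary (inj₂ fr) rewrite fresh⇒initial l∈ fr = R.unseen≤q P w φ
          ordinary (inj₁ (p , p∈ , Epw)) = ≤-trans unseen≤k k≤
            where
              k≤ : k ≤ (if initial l w then q else k)
              k≤ with initial l w
              ... | true = n≤1+n k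
              ... | false = ≤-refl
              unseen≤k : R.unseen P w φ ≤ k
              unseen≤k = ≤-trans (∑-mono (allFin q) each) (≤-reflexive (∑-≢ (φ p)))
                where
                  each : ∀ i → ⟦ not (R.seen P w φ i) ⟧ ≤ ⟦ not (i == φ p) ⟧
                  each i with i ≟ φ p
                  ... | yes refl rewrite any-true⁺ {p = λ x → E x w ∧ (φ x == φ p)} p∈ (cong₂ _∧_ Epw (==-refl (φ p))) = ≤-refl
                  ... | no _ with R.seen P w φ i
                  ...   | true = z≤n
                  ...   | false = ≤-refl

      φv≡φu : φ v ≡ φ u
      φv≡φu = ≡-sym (frozen φ proper)

      h-base : ∀ l {w} → φ w ≡ φ u → w ≡ u ⊎ w ≡ v → h l w ≡ 1
      h-base l {w} φw≡φu eq rewrite φw≡φu | ==-refl (φ u) = lemma eq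
        where
          lemma : w ≡ u ⊎ w ≡ v → 1 * (if not (w == u) ∧ (not (w == v) ∧ true) then (if initial l w then q else k) else 1) ≡ 1
          lemma (inj₁ refl) rewrite ==-refl u = refl
          lemma (inj₂ refl) rewrite ==-refl v | Bool.∧-zeroʳ (not (v == u)) = refl

      cost≤ : ∀ {l P} → l ∈ orders m → Built (Revealed l) P → R.cost P φ ≤ ∏ P (h l)
      cost≤ {l} l∈ base = ≤-reflexive (≡-trans cost-base (≡-sym (cong₂ (λ a b → a * (b * 1))
        (h-base l φv≡φu (inj₂ refl)) (h-base l {u} refl (inj₁ refl)))))
        where
          cost-base : R.cost (v ∷ u ∷ []) φ ≡ 1
          cost-base rewrite ==-≢ v≢u | ==-refl u | ==-refl v = refl
      cost≤ {l} l∈ (step {w} {P} w∉ r B) = ≤-trans (≤-reflexive cost-step)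
        (*-mono-≤ (revealed-bound l∈ w≢u w≢v (built-u B) (built-v B) r) (cost≤ l∈ B))
        where
          w≢u : w ≢ u
          w≢u refl = w∉ (built-u B)
          w≢v : w ≢ v
          w≢v refl = w∉ (built-v B)
          cost-step : R.cost (w ∷ P) φ ≡ R.unseen P w φ * R.cost P φ
          cost-step rewrite ==-≢ w≢u | ==-≢ w≢v = refl

      -- The dominant vertex of the colour `j` has the colour `j`, so these vertices are distinct
      -- and the product can be indexed by the colours.
      ∏-D : ∀ l → ∏ (allFin m) (D l) ≡ ∏ (allFin q) (F l)
      ∏-D l = begin
        ∏ (allFin m) (D l) ≡⟨ ∏-cong (allFin m) expand ⟩
        ∏ (allFin m) (λ w → ∏ (allFin q) (G w)) ≡⟨ ∏-swap G (allFin m) (allFin q) ⟩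
        ∏ (allFin q) (λ j → ∏ (allFin m) (λ w → G w j)) ≡⟨ ∏-cong (allFin q) (λ j → ∏-δ (λ _ → F l j) (allFin⁺ m) (∈-allFin (y j))) ⟩
        ∏ (allFin q) (F l) ∎
        where
          open ≡-Reasoning
          G : Fin m → Fin q → ℕ
          G w j = if w == y j then F l j else 1
          concentrate : ∀ w j → G w j ≡ (if j == φ w then G w j else 1)
          concentrate w j with j ≟ φ w
          ... | yes _ = refl
          ... | no j≢φw with w ≟ y j
          ...   | no _ = refl
          ...   | yes refl with j ≟ φ u
          ...     | yes refl = refl
          ...     | no j≢φu = contradiction (≡-sym (φ-y-no j≢φu)) j≢φw
            where
              φ-y-no : (j≢ : j ≢ φ u) → φ (proj₁ (dom j j≢)) ≡ j
              φ-y-no j≢ = proj₁ (proj₂ (proj₂ (dom j j≢)))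
          expand : ∀ w → D l w ≡ ∏ (allFin q) (G w)
          expand w = ≡-sym (≡-trans (∏-cong (allFin q) (concentrate w))
            (≡-trans (∏-δ (G w) (allFin⁺ q) (∈-allFin (φ w))) (cases (φ w ≟ φ u))))
            where
              cases : Dec (φ w ≡ φ u) → G w (φ w) ≡ D l w
              cases (yes φw≡φu) rewrite φw≡φu | ==-refl (φ u) | F-φu l with w == y (φ u)
              ... | true = refl
              ... | false = refl
              cases (no φw≢φu) rewrite ==-≢ φw≢φu = refl

      ∑-isDom : ∑ (allFin m) (λ w → ⟦ isDom w ⟧) ≡ k
      ∑-isDom = begin
        ∑ (allFin m) (λ w → ⟦ isDom w ⟧) ≡⟨ ∑-cong (allFin m) expand ⟩
        ∑ (allFin m) (λ w → ∑ (allFin q) (G w)) ≡⟨ ∑-swap G (allFin m) (allFin q) ⟩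
        ∑ (allFin q) (λ j → ∑ (allFin m) (λ w → G w j)) ≡⟨ ∑-cong (allFin q) (λ j → ∑-δ (λ _ → ⟦ not (j == φ u) ⟧) (allFin⁺ m) (∈-allFin (y j))) ⟩
        ∑ (allFin q) (λ j → ⟦ not (j == φ u) ⟧) ≡⟨ ∑-≢ (φ u) ⟩
        k ∎
        where
          open ≡-Reasoning
          G : Fin m → Fin q → ℕ
          G w j = ⟦ w == y j ⟧ * ⟦ not (j == φ u) ⟧
          concentrate : ∀ w j → G w j ≡ ⟦ j == φ w ⟧ * G w j
          concentrate w j = cases (j ≟ φ w) (w ≟ y j) (j ≟ φ u)
            where
              cases : Dec (j ≡ φ w) → Dec (w ≡ y j) → Dec (j ≡ φ u) → G w j ≡ ⟦ j == φ w ⟧ * G w j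
              cases (yes j≡φw) _ _ rewrite ==-≡ j≡φw = ≡-sym (*-identityˡ _)
              cases (no _) (no w≢yj) _ rewrite ==-≢ w≢yj = ≡-sym (*-zeroʳ ⟦ j == φ w ⟧)
              cases (no _) (yes _) (yes refl) rewrite ==-refl (φ u) | *-zeroʳ ⟦ w == y (φ u) ⟧ = ≡-sym (*-zeroʳ ⟦ φ u == φ w ⟧)
              cases (no j≢φw) (yes w≡yj) (no j≢φu) = contradiction (≡-sym (≡-trans (cong φ w≡yj) (φ-y j j≢φu))) j≢φw
          expand : ∀ w → ⟦ isDom w ⟧ ≡ ∑ (allFin q) (G w)
          expand w = ≡-sym (≡-trans (∑-cong (allFin q) (concentrate w))
            (≡-trans (∑-δ (G w) (allFin⁺ q) (∈-allFin (φ w))) (both (w == y (φ w)) (φ w == φ u))))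
            where
              both : ∀ a b → ⟦ a ⟧ * ⟦ not b ⟧ ≡ ⟦ not b ∧ a ⟧
              both true true = refl
              both true false = refl
              both false true = refl
              both false false = refl

      -- The dominant vertices avoid the common colour of `u` and `v`, so they and the pair make up
      -- `2 + k` different vertices.
      ∑-free : ∑ (allFin m) (λ w → ⟦ free w ⟧) ≡ m ∸ 2 ∸ k
      ∑-free = ≡-sym (≡-trans (∸-+-assoc m 2 k) (≡-trans (cong (_∸ (2 + k)) (≡-sym total)) (m+n∸n≡m _ (2 + k))))
        where
          open ≡-Reasoning
          V = allFin m
          a b c d : Fin m → ℕ
          a w = ⟦ free w ⟧
          b w = ⟦ w == u ⟧ * 1
          c w = ⟦ w == v ⟧ * 1
          d w = ⟦ isDom w ⟧
          total : ∑ V a + (2 + k) ≡ m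
          total = begin
            ∑ V a + (2 + k) ≡⟨ cong (∑ V a +_) (cong₂ (λ x y → x + (y + k)) (∑-δ (λ _ → 1) (allFin⁺ m) (∈-allFin u)) (∑-δ (λ _ → 1) (allFin⁺ m) (∈-allFin v))) ⟨
            ∑ V a + (∑ V b + (∑ V c + k)) ≡⟨ cong (λ x → ∑ V a + (∑ V b + (∑ V c + x))) ∑-isDom ⟨
            ∑ V a + (∑ V b + (∑ V c + ∑ V d)) ≡⟨ cong (λ x → ∑ V a + (∑ V b + x)) (∑-distrib-+ V) ⟨
            ∑ V a + (∑ V b + ∑ V (λ w → c w + d w)) ≡⟨ cong (∑ V a +_) (∑-distrib-+ V) ⟨
            ∑ V a + ∑ V (λ w → b w + (c w + d w)) ≡⟨ ∑-distrib-+ V ⟨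
            ∑ V (λ w → a w + (b w + (c w + d w))) ≡⟨ ∑-cong V (λ w → each w (w ≟ u) (w ≟ v)) ⟩
            ∑ V (λ _ → 1) ≡⟨ ∑-const 1 V ⟩
            length V * 1 ≡⟨ ≡-trans (*-identityʳ _) (length-tabulate id) ⟩
            m ∎
            where
              each : ∀ w → Dec (w ≡ u) → Dec (w ≡ v) → a w + (b w + (c w + d w)) ≡ 1
              each w (yes refl) (yes refl) = contradiction refl v≢u
              each w (yes refl) (no w≢v) rewrite ==-refl u | ==-≢ w≢v | ==-refl (φ u) = refl
              each w (no w≢u) (yes refl) rewrite ==-≢ w≢u | ==-refl v | φv≡φu | ==-refl (φ u) = refl
              each w (no w≢u) (no w≢v) rewrite ==-≢ w≢u | ==-≢ w≢v with isDom w
              ... | true = refl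
              ... | false = refl

      ∏-rest : ∀ l {σ} → ∑ (allFin m) (λ w → ⟦ initial l w ⟧) ≤ σ →
        ∏ (allFin m) (λ w → if free w then (if initial l w then q else k) else 1) ≤ q ^ σ * k ^ (m ∸ 2 ∸ k ∸ σ)
      ∏-rest l {σ} few = begin
        ∏ V (λ w → if free w then (if initial l w then q else k) else 1) ≡⟨ ∏-cong V (λ w → split (free w) (initial l w)) ⟩
        ∏ V (λ w → q ^ a w * k ^ b w) ≡⟨ ∏-distrib-* V ⟩
        ∏ V (λ w → q ^ a w) * ∏ V (λ w → k ^ b w) ≡⟨ cong₂ _*_ (∏-exponents q a V) (∏-exponents k b V) ⟩
        q ^ ∑ V a * k ^ ∑ V b ≤⟨ power-trade (∑ V a) (∑ V b) (≤-trans (∑-mono V (λ w → fewer (free w) (initial l w))) few) ⟩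
        q ^ σ * k ^ (∑ V a + ∑ V b ∸ σ) ≡⟨ cong (λ x → q ^ σ * k ^ (x ∸ σ)) (≡-trans (≡-sym (∑-distrib-+ V)) (≡-trans (∑-cong V (λ w → join (free w) (initial l w))) ∑-free)) ⟩
        q ^ σ * k ^ (m ∸ 2 ∸ k ∸ σ) ∎
        where
          open ≤-Reasoning
          V = allFin m
          a b : Fin m → ℕ
          a w = ⟦ free w ∧ initial l w ⟧
          b w = ⟦ free w ∧ not (initial l w) ⟧
          split : ∀ f s → (if f then (if s then q else k) else 1) ≡ q ^ ⟦ f ∧ s ⟧ * k ^ ⟦ f ∧ not s ⟧
          split true true = ≡-sym (≡-trans (*-identityʳ _) (*-identityʳ q))
          split true false = ≡-sym (≡-trans (*-identityˡ _) (*-identityʳ k))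
          split false s = refl
          fewer : ∀ f s → ⟦ f ∧ s ⟧ ≤ ⟦ s ⟧
          fewer true s = ≤-refl
          fewer false s = z≤n
          join : ∀ f s → ⟦ f ∧ s ⟧ + ⟦ f ∧ not s ⟧ ≡ ⟦ f ⟧
          join true true = refl
          join true false = refl
          join false s = refl

      -- Each of the `k` colours other than `φ u` contributes in the geometric mean at most the
      -- `k`-th root of `k !`, by `bregman`. The case `k = 0`, where there is no root to take, has
      -- `φ u` as its only colour.
      ∏∏-F : ∏ (orders m) (λ l → ∏ (allFin q) (F l)) ≤ (k !) ^ length (orders m)
      ∏∏-F = ≤-trans (≤-reflexive (∏-swap F (orders m) (allFin q))) (root k refl)
        where
          X : Fin q → ℕ
          X j = ∏ (orders m) (λ l → F l j)
          T = length (orders m)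
          X-φu : X (φ u) ≡ 1
          X-φu = ≡-trans (∏-cong (orders m) F-φu) (∏-1 (orders m))
          X^k : ∀ j → X j ^ k ≤ ((k !) ^ T) ^ ⟦ not (j == φ u) ⟧
          X^k j with j ≟ φ u
          ... | yes _ rewrite ∏-1 (orders m) = ≤-reflexive (^-zeroˡ k)
          ... | no j≢φu = ≤-trans (Averaging.bregman g g-y ∑g) (≤-reflexive (≡-sym (*-identityʳ _)))
            where open Tokens φ proper j≢φu (proj₂ (dom j j≢φu))
          power : ∏ (allFin q) X ^ k ≤ ((k !) ^ T) ^ k
          power = begin
            ∏ (allFin q) X ^ k ≡⟨ ∏-^ k (allFin q) ⟨
            ∏ (allFin q) (λ j → X j ^ k) ≤⟨ ∏-mono (allFin q) X^k ⟩
            ∏ (allFin q) (λ j → ((k !) ^ T) ^ ⟦ not (j == φ u) ⟧) ≡⟨ ∏-exponents ((k !) ^ T) (λ j → ⟦ not (j == φ u) ⟧) (allFin q) ⟩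
            ((k !) ^ T) ^ ∑ (allFin q) (λ j → ⟦ not (j == φ u) ⟧) ≡⟨ cong (((k !) ^ T) ^_) (∑-≢ (φ u)) ⟩
            ((k !) ^ T) ^ k ∎
            where open ≤-Reasoning
          root : ∀ r → r ≡ k → ∏ (allFin q) X ≤ (k !) ^ T
          root zero refl = ≤-reflexive (≡-trans (∏-cong (allFin q) (λ j → ≡-trans (cong X (only j (φ u))) X-φu))
            (≡-trans (∏-1 (allFin q)) (≡-sym (^-zeroˡ T))))
            where
              only : ∀ (i j : Fin 1) → i ≡ j
              only zero zero = refl
          root (suc r) refl = ^-cancelˡ-≤ k power

      ∏-cost : ∀ {σ} → (∀ {l} → l ∈ orders m → ∑ (allFin m) (λ w → ⟦ initial l w ⟧) ≤ σ) →
        ∏ (orders m) (λ l → R.cost (reveal l) φ) ≤ (k ! * (q ^ σ * k ^ (m ∸ 2 ∸ k ∸ σ))) ^ length (orders m)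
      ∏-cost {σ} few = begin
        ∏ Ω (λ l → R.cost (reveal l) φ) ≤⟨ ∏-mono-∈ Ω each ⟩
        ∏ Ω (λ l → ∏ (allFin q) (F l) * W) ≡⟨ ∏-distrib-* Ω ⟩
        ∏ Ω (λ l → ∏ (allFin q) (F l)) * ∏ Ω (λ _ → W) ≤⟨ *-mono-≤ ∏∏-F (≤-reflexive (∏-const W Ω)) ⟩
        (k !) ^ length Ω * W ^ length Ω ≡⟨ ^-distribʳ-* (k !) W (length Ω) ⟨
        (k ! * W) ^ length Ω ∎
        where
          open ≤-Reasoning
          Ω = orders m
          W = q ^ σ * k ^ (m ∸ 2 ∸ k ∸ σ)
          each : ∀ l → l ∈ Ω → R.cost (reveal l) φ ≤ ∏ (allFin q) (F l) * W
          each l l∈ = begin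
            R.cost (reveal l) φ ≤⟨ cost≤ l∈ B ⟩
            ∏ (reveal l) (h l) ≡⟨ ∏-↭ (unique∧complete⇒↭ (built-unique v≢u B) (allFin⁺ m) complete ∈-allFin) ⟩
            ∏ (allFin m) (h l) ≡⟨ ∏-distrib-* {f = D l} (allFin m) ⟩
            ∏ (allFin m) (D l) * ∏ (allFin m) (λ w → if free w then (if initial l w then q else k) else 1)
            ≤⟨ *-mono-≤ (≤-reflexive (∏-D l)) (∏-rest l (few l∈)) ⟩
            ∏ (allFin q) (F l) * W ∎
            where
              correct = reveal-correct v≢u l (proj₂ (orders-sound l∈))
              B = proj₁ correct
              complete = proj₂ correct

    frozen-count : ∀ {σ} → (∀ {l} → l ∈ orders m → ∑ (allFin m) (λ w → ⟦ initial l w ⟧) ≤ σ) →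
      (adm : Vec (Fin q) m → Bool) → (∀ f → adm f ≡ true → Proper (lookup f)) →
      countB adm (allVecs q m) ≤ q * (k ! * (q ^ σ * k ^ (m ∸ 2 ∸ k ∸ σ)))
    frozen-count {σ} few adm adm⇒proper = R.count-bound v≢u reveal (orders-nonempty m) (s≤s z≤n)
      (λ l l∈ → based (proj₁ (correct l l∈)))
      (λ l l∈ → ≡-trans (↭-length (unique∧complete⇒↭ (built-unique v≢u (proj₁ (correct l l∈))) (allFin⁺ m) (proj₂ (correct l l∈)) ∈-allFin))
        (length-tabulate id))
      adm (λ f af → adm⇒proper f af , ≡-sym (frozen (lookup f) (adm⇒proper f af)) , Cost.∏-cost (lookup f) (adm⇒proper f af) few)
      where
        correct : ∀ l → l ∈ orders m → Built (Revealed l) (reveal l) × (∀ x → x ∈ reveal l)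
        correct l l∈ = reveal-correct v≢u l (proj₂ (orders-sound l∈))
        based : ∀ {Q P} → Built Q P → R.Based P
        based base = R.base
        based (step w∉ _ B) = R.step w∉ (based B)

-- Boolean tests and enumerations

∧-trueˡ : ∀ {a b} → a ∧ b ≡ true → a ≡ true
∧-trueˡ {true} _ = refl

∧-trueʳ : ∀ {a b} → a ∧ b ≡ true → b ≡ true
∧-trueʳ {true} h = h

all-true⁻ : {A : Set} {p : A → Bool} {xs : List A} → all p xs ≡ true → ∀ {x} → x ∈ xs → p x ≡ true
all-true⁻ {p = p} h (here refl) = ∧-trueˡ h
all-true⁻ {p = p} {y ∷ xs} h (there x∈) = all-true⁻ {p = p} (∧-trueʳ {p y} h) x∈

all-true⁺ : {A : Set} {p : A → Bool} (xs : List A) → (∀ x → x ∈ xs → p x ≡ true) → all p xs ≡ true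
all-true⁺ [] h = refl
all-true⁺ (x ∷ xs) h = cong₂ _∧_ (h x (here refl)) (all-true⁺ xs λ y y∈ → h y (there y∈))

∈-concatMap-map : {A B C : Set} (h : A → B → C) {xs : List A} {ys : List B} {x : A} {y : B} → x ∈ xs → y ∈ ys →
  h x y ∈ concatMap (λ a → map (h a) ys) xs
∈-concatMap-map h {ys = ys} {x} {y} x∈ y∈ = ∈-concatMap⁺ (λ a → map (h a) ys) (lemma x∈)
  where
    lemma : ∀ {zs} → x ∈ zs → Any (λ z → h x y ∈ map (h z) ys) zs
    lemma (here refl) = here (∈-map⁺ (h x) y∈)
    lemma (there x∈) = there (lemma x∈)

∈-allPairs : ∀ {m} (i j : Fin m) → (i , j) ∈ allPairs m
∈-allPairs i j = ∈-concatMap-map _,_ (∈-allFin i) (∈-allFin j)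

∈-allVecs : ∀ {c m} (f : Vec (Fin c) m) → f ∈ allVecs c m
∈-allVecs []ᵥ = here refl
∈-allVecs (x ∷ᵥ f) = ∈-concatMap-map _∷ᵥ_ (∈-allFin x) (∈-allVecs f)

T⇒true : ∀ {b} → True b → b ≡ true
T⇒true {true} _ = refl

true⇒T : ∀ {b} → b ≡ true → True b
true⇒T refl = tt

∈-upPairs⁺ : ∀ {m} {i j : Fin m} → toℕ i < toℕ j → (i , j) ∈ upPairs m
∈-upPairs⁺ {i = i} {j} i<j = ∈-filter⁺ _ (∈-allPairs i j) (<⇒<ᵇ i<j)

∈-upPairs⁻ : ∀ {m} {i j : Fin m} → (i , j) ∈ upPairs m → toℕ i < toℕ j
∈-upPairs⁻ {m} {i} {j} ij∈ = <ᵇ⇒< _ _ (proj₂ (∈-filter⁻ (λ p → Bool.T? (toℕ (proj₁ p) <ᵇ toℕ (proj₂ p))) {v = i , j} {xs = allPairs m} ij∈))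

-- Chromatic number and critical edges

module _ (H : Graph) where

  ProperColouring : {c : ℕ} → (Fin (v H) → Fin c) → Set
  ProperColouring φ = ∀ x y → adj H x y ≡ true → φ x ≢ φ y

  proper⇒ : ∀ {c} {f : Vec (Fin c) (v H)} → proper H f ≡ true → ProperColouring (lookup f)
  proper⇒ {f = f} h x y Exy same = contradiction (≡-trans (≡-sym (all-true⁻ h (∈-allPairs x y)))
    (cong₂ (λ a b → not a ∨ not b) Exy (==-≡ same))) λ ()

  ⇒proper : ∀ {c} {f : Vec (Fin c) (v H)} → ProperColouring (lookup f) → proper H f ≡ true
  ⇒proper {f = f} h = all-true⁺ (allPairs (v H)) λ (x , y) _ → each x y
    where
      each : ∀ x y → not (adj H x y) ∨ not (lookup f x == lookup f y) ≡ true
      each x y with adj H x y in eq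
      ... | false = refl
      ... | true = cong not (==-≢ (h x y eq))

  uncolourable : ∀ {c} → colourable c H ≡ false → ∀ (φ : Fin (v H) → Fin c) → ¬ ProperColouring φ
  uncolourable {c} h φ proper-φ = contradiction (≡-trans (≡-sym (any-true⁺ {p = proper H} (∈-allVecs (tabulate φ))
    (⇒proper {f = tabulate φ} (λ x y Exy same → proper-φ x y Exy (≡-trans (≡-sym (lookup∘tabulate φ x)) (≡-trans same (lookup∘tabulate φ y))))))) h) λ ()

  χsearch-≥ : ∀ c fuel → c ≤ χsearch H c fuel
  χsearch-≥ c zero = ≤-refl
  χsearch-≥ c (suc fuel) with colourable c H
  ... | true = ≤-refl
  ... | false = ≤-trans (n≤1+n c) (χsearch-≥ (suc c) fuel)

  -- Each number that the search has passed was tested and rejected, also when it stops for want of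
  -- fuel.
  χsearch-minimal : ∀ c fuel d → c ≤ d → d < χsearch H c fuel → colourable d H ≡ false
  χsearch-minimal c zero d c≤d d< = contradiction (<-≤-trans d< c≤d) (<-irrefl refl)
  χsearch-minimal c (suc fuel) d c≤d d< with colourable c H in eq
  ... | true = contradiction (<-≤-trans d< c≤d) (<-irrefl refl)
  ... | false with m≤n⇒m<n∨m≡n c≤d
  ...   | inj₁ c<d = χsearch-minimal (suc c) fuel d c<d d<
  ...   | inj₂ refl = eq

  χsearch-≤ : ∀ c fuel d → c ≤ d → colourable d H ≡ true → χsearch H c fuel ≤ d
  χsearch-≤ c zero d c≤d _ = c≤d
  χsearch-≤ c (suc fuel) d c≤d h with colourable c H in eq
  ... | true = c≤d
  ... | false with m≤n⇒m<n∨m≡n c≤d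
  ...   | inj₁ c<d = χsearch-≤ (suc c) fuel d c<d h
  ...   | inj₂ refl = contradiction (≡-trans (≡-sym h) eq) λ ()

  <χ⇒uncolourable : ∀ {d} → d < χ H → colourable d H ≡ false
  <χ⇒uncolourable {d} d< = χsearch-minimal 0 (v H) d z≤n d<

  leader : Fin (v H) → Bool
  leader i = not (any (λ j → (toℕ j <ᵇ toℕ i) ∧ connected H i j) (allFin (v H)))

  reach-closed : {C : Fin (v H) → Set} → (∀ {x y} → adj H x y ≡ true → C x → C y) →
    ∀ t {i j} → reach H t i j ≡ true → C j → C i
  reach-closed step zero h Cj = subst _ (≡-sym (==⇒≡ h)) Cj
  reach-closed {C} step (suc t) {i} {j} h Cj with any-true⁻ (allFin (v H)) h
  ... | l , _ , hl = reach-closed step t (∧-trueˡ hl) (last (l ≟ j))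
    where
      last : Dec (l ≡ j) → C l
      last (yes refl) = Cj
      last (no l≢j) = step (≡-trans (Graph.sym H j l) (≡-trans (cong (_∨ adj H l j) (≡-sym (==-≢ l≢j))) (∧-trueʳ {reach H t i l} hl))) Cj

  -- A smaller vertex connected to `b` would lie in `C`, and following the path would bring `b` into
  -- `C`.
  leader⁺ : {C : Fin (v H) → Set} → (∀ {x y} → adj H x y ≡ true → C x → C y) →
    ∀ {b} → ¬ C b → (∀ {j} → j Fin.< b → C j) → leader b ≡ true
  leader⁺ {C} step {b} ¬Cb smaller with any (λ j → (toℕ j <ᵇ toℕ b) ∧ connected H b j) (allFin (v H)) in eq
  ... | false = refl
  ... | true = let j , _ , h = any-true⁻ (allFin (v H)) eq in
    contradiction (reach-closed step (v H) (∧-trueʳ {toℕ j <ᵇ toℕ b} h) (smaller (<ᵇ⇒< _ _ (true⇒T (∧-trueˡ h))))) ¬Cb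

  leader-least : {C : Fin (v H) → Set} → (∀ {x y} → adj H x y ≡ true → C x → C y) →
    ∀ {b} → C b → (∀ {j} → j Fin.< b → ¬ C j) → leader b ≡ true
  leader-least {C} step {b} Cb smaller = leader⁺ {λ x → ¬ C x}
    (λ {x} {y} Exy ¬Cx Cy → ¬Cx (step (≡-trans (Graph.sym H y x) Exy) Cy)) (λ ¬Cb → ¬Cb Cb) smaller

least : ∀ {m} {C : Fin m → Set} → (∀ x → Dec (C x)) → ∃ C → ∃ λ b → C b × (∀ {j} → j Fin.< b → ¬ C j)
least {suc m} {C} C? (x , Cx) with C? zero
... | yes C0 = zero , C0 , λ ()
... | no ¬C0 with least (C? ∘ suc) (down x Cx)
  where
    down : ∀ x → C x → ∃ (C ∘ suc)
    down zero C0 = contradiction C0 ¬C0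
    down (suc x) Cx = x , Cx
... | b , Cb , minimal = suc b , Cb , below
  where
    below : ∀ {j} → j Fin.< suc b → ¬ C j
    below {zero} _ = ¬C0
    below {suc j} (s≤s j<b) = minimal j<b

k-∑ : ∀ H → k H ≡ ∑ (allFin (v H)) (λ i → ⟦ leader H i ⟧)
k-∑ H = countB-∑ (leader H) (allFin (v H))

k≤v : ∀ H → k H ≤ v H
k≤v H = ≤-trans (≤-reflexive (k-∑ H)) (≤-trans (∑-mono (allFin (v H)) (λ i → ⟦⟧≤1 (leader H i)))
  (≤-reflexive (≡-trans (∑-const 1 (allFin (v H))) (≡-trans (*-identityʳ _) (length-tabulate id)))))

module CriticalEdge (H : Graph) (r : ℕ) (uncol : colourable (suc r) H ≡ false) (a b : Fin (v H)) (Eab : adj H a b ≡ true) where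

  private
    q = suc r
    m = v H
    K = deleteEdge H a b
    E = adj K

  b≢a : b ≢ a
  b≢a refl = contradiction (≡-trans (≡-sym Eab) (Graph.irrefl H a)) λ ()

  survives : ∀ {i j} → adj H i j ≡ true → (i ≡ a × j ≡ b) ⊎ (i ≡ b × j ≡ a) ⊎ E i j ≡ true
  survives {i} {j} Eij = cases (i ≟ a) (j ≟ b) (i ≟ b) (j ≟ a)
    where
      kept : (i == a) ∧ (j == b) ≡ false → (j == a) ∧ (i == b) ≡ false → E i j ≡ true
      kept h h′ = cong₂ (λ x y → x ∧ not y) Eij (cong₂ _∨_ h h′)
      cases : Dec (i ≡ a) → Dec (j ≡ b) → Dec (i ≡ b) → Dec (j ≡ a) → (i ≡ a × j ≡ b) ⊎ (i ≡ b × j ≡ a) ⊎ E i j ≡ true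
      cases (yes p) (yes p′) _ _ = inj₁ (p , p′)
      cases _ _ (yes p) (yes p′) = inj₂ (inj₁ (p , p′))
      cases (no p) _ (no p′) _ = inj₂ (inj₂ (kept (cong (_∧ (j == b)) (==-≢ p)) (≡-trans (cong ((j == a) ∧_) (==-≢ p′)) (∧-zeroʳ _))))
      cases (no p) _ (yes _) (no p′) = inj₂ (inj₂ (kept (cong (_∧ (j == b)) (==-≢ p)) (cong (_∧ (i == b)) (==-≢ p′))))
      cases (yes _) (no p) (no p′) _ = inj₂ (inj₂ (kept (≡-trans (cong ((i == a) ∧_) (==-≢ p)) (∧-zeroʳ _)) (≡-trans (cong ((j == a) ∧_) (==-≢ p′)) (∧-zeroʳ _))))
      cases (yes _) (no p) (yes _) (no p′) = inj₂ (inj₂ (kept (≡-trans (cong ((i == a) ∧_) (==-≢ p)) (∧-zeroʳ _)) (cong (_∧ (i == b)) (==-≢ p′))))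

  frozen : ∀ (φ : Fin m → Fin q) → (∀ x y → E x y ≡ true → φ x ≢ φ y) → φ a ≡ φ b
  frozen φ proper-φ with φ a ≟ φ b
  ... | yes same = same
  ... | no different = contradiction whole (uncolourable H uncol φ)
    where
      whole : ProperColouring H φ
      whole x y Exy with survives Exy
      ... | inj₁ (refl , refl) = different
      ... | inj₂ (inj₁ (refl , refl)) = different ∘ ≡-sym
      ... | inj₂ (inj₂ Exy′) = proper-φ x y Exy′

  open Search E a b

  -- The leader of the component that contains the edge from `a` to `b`. That component is entered
  -- through `a` and `b` and not through a fresh vertex, so `initial` omits its leader. The value
  -- `a` is a default for an empty component.
  home : List (Fin m) → Fin m
  home l with Fin.any? (λ x → x ∈? component l)
  ... | yes inhabited = proj₁ (least (λ x → x ∈? component l) inhabited)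
  ... | no _ = a

  home-least : ∀ {l} → a ∈ component l → home l ∈ component l × (∀ {j} → j Fin.< home l → j ∉ component l)
  home-least {l} a∈ with Fin.any? (λ x → x ∈? component l)
  ... | yes inhabited = proj₂ (least (λ x → x ∈? component l) inhabited)
  ... | no none = contradiction (a , a∈) none

  initial : List (Fin m) → Fin m → Bool
  initial l w = leader H w ∧ not (w == home l)

  spread : ∀ {P} → a ∈ P → b ∈ P → FullyClosed P → ∀ {x y} → adj H x y ≡ true → x ∈ P → y ∈ P
  spread a∈ b∈ closed Exy x∈ with survives Exy
  ... | inj₁ (_ , refl) = b∈
  ... | inj₂ (inj₁ (_ , refl)) = a∈
  ... | inj₂ (inj₂ Exy′) = closed x∈ Exy′

  module _ {l : List (Fin m)} (l∈ : l ∈ orders m) where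

    private
      complete = proj₂ (orders-sound l∈)
      a∈ = component-∋u b≢a l complete
      b∈ = component-∋v b≢a l complete

    fresh⇒initial : ∀ {w} → Fresh (component l) w → initial l w ≡ true
    fresh⇒initial {w} fresh = cong₂ (λ x y → x ∧ not y)
      (leader⁺ H (spread (region-⊇ a∈) (region-⊇ b∈) region-closed) region-∌ region-smaller)
      (==-≢ λ { refl → region-∌ (region-⊇ (proj₁ (home-least a∈))) })
      where open Fresh fresh

    home-leader : leader H (home l) ≡ true
    home-leader = leader-least H (spread a∈ b∈ (component-closed b≢a l complete)) (proj₁ (home-least a∈)) (proj₂ (home-least a∈))

    initial-few : suc (∑ (allFin m) (λ w → ⟦ initial l w ⟧)) ≤ k H
    initial-few = ≤-reflexive (begin
      1 + ∑ V (λ w → ⟦ initial l w ⟧) ≡⟨ cong (_+ ∑ V (λ w → ⟦ initial l w ⟧)) (∑-δ (λ _ → 1) (allFin⁺ m) (∈-allFin (home l))) ⟨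
      ∑ V (λ w → ⟦ w == home l ⟧ * 1) + ∑ V (λ w → ⟦ initial l w ⟧) ≡⟨ ∑-distrib-+ V ⟨
      ∑ V (λ w → ⟦ w == home l ⟧ * 1 + ⟦ initial l w ⟧) ≡⟨ ∑-cong V each ⟩
      ∑ V (λ w → ⟦ leader H w ⟧) ≡⟨ k-∑ H ⟨
      k H ∎)
      where
        open ≡-Reasoning
        V = allFin m
        each : ∀ w → ⟦ w == home l ⟧ * 1 + ⟦ initial l w ⟧ ≡ ⟦ leader H w ⟧
        each w = cases (w ≟ home l)
          where
            cases : Dec (w ≡ home l) → ⟦ w == home l ⟧ * 1 + ⟦ leader H w ∧ not (w == home l) ⟧ ≡ ⟦ leader H w ⟧
            cases (yes refl) rewrite ==-refl w | home-leader = refl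
            cases (no w≢) rewrite ==-≢ w≢ | Bool.∧-identityʳ (leader H w) = refl

  -- At most `k H ∸ 1` vertices are fresh; together with `a` they account for the `k H` factors `q`.
  count-K : countB (proper K) (allVecs q m) ≤ r ! * r ^ ((m + 1) ∸ suc (suc r) ∸ k H) * q ^ k H
  count-K = ≤-trans (Frozen.frozen-count E a b (Graph.sym K) b≢a frozen initial (λ l∈ → fresh⇒initial l∈) few (proper K) (λ f → proper⇒ K {f = f}))
    (≤-reflexive (rearrange κ≥1))
    where
      few : ∀ {l} → l ∈ orders m → ∑ (allFin m) (λ w → ⟦ initial l w ⟧) ≤ k H ∸ 1
      few l∈ = ∸-monoˡ-≤ 1 (initial-few l∈)
      κ≥1 : 1 ≤ k H
      κ≥1 = witness (orders m) (orders-nonempty m) λ l∈ → ≤-trans (s≤s z≤n) (initial-few l∈)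
        where
          witness : ∀ {A B : Set} (xs : List A) → 1 ≤ length xs → (∀ {x} → x ∈ xs → B) → B
          witness (x ∷ xs) _ h = h (here refl)
      rearrange : ∀ {κ} → 1 ≤ κ →
        q * (r ! * (q ^ (κ ∸ 1) * r ^ (m ∸ 2 ∸ r ∸ (κ ∸ 1)))) ≡ r ! * r ^ ((m + 1) ∸ suc (suc r) ∸ κ) * q ^ κ
      rearrange {suc κ} _ = ≡-trans (shape q (r !) (q ^ κ) _) (cong (λ x → r ! * r ^ x * (q * q ^ κ)) exponent)
        where
          shape : ∀ q f p s → q * (f * (p * s)) ≡ f * s * (q * p)
          shape = solve-∀
          exponent : m ∸ 2 ∸ r ∸ κ ≡ (m + 1) ∸ suc (suc r) ∸ suc κ
          exponent = begin
            m ∸ 2 ∸ r ∸ κ ≡⟨ cong (_∸ κ) (∸-+-assoc m 2 r) ⟩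
            m ∸ (2 + r) ∸ κ ≡⟨ ∸-+-assoc m (2 + r) κ ⟩
            (1 + m) ∸ (1 + (2 + r + κ)) ≡⟨ cong₂ _∸_ (+-comm 1 m) (≡-sym (+-suc (2 + r) κ)) ⟩
            (m + 1) ∸ (suc (suc r) + suc κ) ≡⟨ ∸-+-assoc (m + 1) (suc (suc r)) (suc κ) ⟨
            (m + 1) ∸ suc (suc r) ∸ suc κ ∎
            where open ≡-Reasoning

module _ (H : Graph) (r : ℕ) (χ≡ : χ H ≡ suc (suc r)) where

  private
    q = suc r
    m = v H

  -- The given edge is then the only monochromatic one: it must be monochromatic because `H` itself
  -- has no proper `q`-colouring.
  sole : Fin m × Fin m → Vec (Fin q) m → Bool
  sole (i , j) f = adj H i j ∧ proper (deleteEdge H i j) f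

  uncolourable-q : colourable q H ≡ false
  uncolourable-q = <χ⇒uncolourable H (≤-reflexive (≡-sym χ≡))

  -- An edge with at least one such colouring is critical, as its deletion leaves a graph with a
  -- proper `q`-colouring. The other edges contribute 0.
  ∑-sole : ∑ (allVecs q m) (λ f → ∑ (upPairs m) (λ p → ⟦ sole p f ⟧)) ≤
    crit H * (r ! * r ^ ((m + 1) ∸ suc (suc r) ∸ k H) * q ^ k H)
  ∑-sole = begin
    ∑ (allVecs q m) (λ f → ∑ (upPairs m) (λ p → ⟦ sole p f ⟧)) ≡⟨ ∑-swap (λ f p → ⟦ sole p f ⟧) (allVecs q m) (upPairs m) ⟩
    ∑ (upPairs m) (λ p → ∑ (allVecs q m) (λ f → ⟦ sole p f ⟧)) ≤⟨ ∑-mono (upPairs m) (λ (i , j) → each i j) ⟩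
    ∑ (upPairs m) (λ p → ⟦ critical p ⟧ * W) ≡⟨ ∑-*ʳ W (upPairs m) ⟩
    ∑ (upPairs m) (λ p → ⟦ critical p ⟧) * W ≡⟨ cong (_* W) (countB-∑ critical (upPairs m)) ⟨
    crit H * W ∎
    where
      open ≤-Reasoning
      W = r ! * r ^ ((m + 1) ∸ suc (suc r) ∸ k H) * q ^ k H
      critical : Fin m × Fin m → Bool
      critical p = adj H (proj₁ p) (proj₂ p) ∧ (χ (deleteEdge H (proj₁ p) (proj₂ p)) <ᵇ χ H)
      smaller : ∀ i j → colourable q (deleteEdge H i j) ≡ true → χ (deleteEdge H i j) < χ H
      smaller i j col = ≤-trans (s≤s (χsearch-≤ (deleteEdge H i j) 0 m q z≤n col)) (≤-reflexive (≡-sym χ≡))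
      each : ∀ i j → ∑ (allVecs q m) (λ f → ⟦ sole (i , j) f ⟧) ≤ ⟦ critical (i , j) ⟧ * W
      each i j with adj H i j in Eij
      ... | false = ≤-reflexive (≡-trans (∑-const 0 (allVecs q m)) (*-zeroʳ (length (allVecs q m))))
      ... | true with colourable q (deleteEdge H i j) in col
      ...   | false = ≤-trans (≤-reflexive (≡-trans (∑-cong (allVecs q m) none) (≡-trans (∑-const 0 (allVecs q m)) (*-zeroʳ (length (allVecs q m)))))) z≤n
        where
          none : ∀ f → ⟦ proper (deleteEdge H i j) f ⟧ ≡ 0
          none f with proper (deleteEdge H i j) f in eq
          ... | false = refl
          ... | true = contradiction (≡-trans (≡-sym (any-true⁺ {p = proper (deleteEdge H i j)} (∈-allVecs f) eq)) col) λ ()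
      ...   | true rewrite T⇒true (<⇒<ᵇ {χ (deleteEdge H i j)} {χ H} (smaller i j col)) = begin
        ∑ (allVecs q m) (λ f → ⟦ proper (deleteEdge H i j) f ⟧) ≡⟨ countB-∑ (proper (deleteEdge H i j)) (allVecs q m) ⟨
        countB (proper (deleteEdge H i j)) (allVecs q m) ≤⟨ CriticalEdge.count-K H r uncolourable-q i j Eij ⟩
        W ≡⟨ *-identityˡ W ⟨
        1 * W ∎

-- Monochromatic pairs under a random map

module _ {M m : ℕ} where

  private
    V = allVecs M m

  ∑-identify : (F : Vec (Fin M) m → ℕ) {w x : Fin m} → w ≢ x → (∀ f c → F (f [ w ]≔ c) ≡ F f) →
    M * ∑ V (λ f → F f * ⟦ lookup f w == lookup f x ⟧) ≡ ∑ V F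
  ∑-identify F {w} {x} w≢x indep = ≡-trans (∑-resample w _) (∑-cong V each)
    where
      each : ∀ f → ∑ (allFin M) (λ c → F (f [ w ]≔ c) * ⟦ lookup (f [ w ]≔ c) w == lookup (f [ w ]≔ c) x ⟧) ≡ F f
      each f = ≡-trans (∑-cong (allFin M) inner) (∑-δ (λ _ → F f) (allFin⁺ M) (∈-allFin (lookup f x)))
        where
          inner : ∀ c → F (f [ w ]≔ c) * ⟦ lookup (f [ w ]≔ c) w == lookup (f [ w ]≔ c) x ⟧ ≡ ⟦ c == lookup f x ⟧ * F f
          inner c rewrite indep f c | lookup∘update w f c | lookup∘update′ {i = x} (w≢x ∘ ≡-sym) f c = *-comm (F f) _

  mono : Fin m × Fin m → Vec (Fin M) m → ℕ
  mono (i , j) f = ⟦ lookup f i == lookup f j ⟧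

  ∑-mono-pair : ∀ {i j} → i ≢ j → M * ∑ V (mono (i , j)) ≡ M ^ m
  ∑-mono-pair {i} {j} i≢j = ≡-trans (cong (M *_) (∑-cong V λ f → ≡-sym (*-identityˡ (mono (i , j) f))))
    (≡-trans (∑-identify (λ _ → 1) i≢j (λ _ _ → refl)) (∑-allVecs-1 m))

  mono-indep : ∀ {i j w} → w ≢ i → w ≢ j → ∀ f c → mono (i , j) (f [ w ]≔ c) ≡ mono (i , j) f
  mono-indep w≢i w≢j f c rewrite lookup∘update′ (w≢i ∘ ≡-sym) f c | lookup∘update′ (w≢j ∘ ≡-sym) f c = refl

  -- Two different pairs are independent events: some end of the first pair is outside the second,
  -- and resampling it affects only the first event.
  ∑-mono-two : ∀ {p p′} → p ∈ upPairs m → p′ ∈ upPairs m → p ≢ p′ → M * (M * ∑ V (λ f → mono p f * mono p′ f)) ≡ M ^ m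
  ∑-mono-two {i , j} {i′ , j′} p∈ p′∈ p≢p′ = cases (i ≟ i′) (i ≟ j′) (j ≟ i′) (j ≟ j′)
    where
      i<j = ∈-upPairs⁻ p∈
      i′<j′ = ∈-upPairs⁻ p′∈
      i≢j : i ≢ j
      i≢j refl = <-irrefl refl i<j
      i′≢j′ : i′ ≢ j′
      i′≢j′ refl = <-irrefl refl i′<j′
      Goal = M * (M * ∑ V (λ f → mono (i , j) f * mono (i′ , j′) f)) ≡ M ^ m
      by-i : i ≢ i′ → i ≢ j′ → Goal
      by-i i≢i′ i≢j′ = ≡-trans (cong (M *_) (≡-trans (cong (M *_) (∑-cong V λ f → *-comm (mono (i , j) f) _))
        (∑-identify (mono (i′ , j′)) i≢j (mono-indep i≢i′ i≢j′)))) (∑-mono-pair i′≢j′)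
      by-j : j ≢ i′ → j ≢ j′ → Goal
      by-j j≢i′ j≢j′ = ≡-trans (cong (M *_) (≡-trans (cong (M *_) (∑-cong V λ f →
          ≡-trans (cong (λ b → ⟦ b ⟧ * mono (i′ , j′) f) (==-comm (lookup f i) (lookup f j))) (*-comm ⟦ lookup f j == lookup f i ⟧ _)))
        (∑-identify (mono (i′ , j′)) (i≢j ∘ ≡-sym) (mono-indep j≢i′ j≢j′)))) (∑-mono-pair i′≢j′)
      cases : Dec (i ≡ i′) → Dec (i ≡ j′) → Dec (j ≡ i′) → Dec (j ≡ j′) → Goal
      cases (no i≢i′) (no i≢j′) _ _ = by-i i≢i′ i≢j′
      cases _ _ (no j≢i′) (no j≢j′) = by-j j≢i′ j≢j′
      cases (yes refl) _ _ (yes refl) = contradiction refl p≢p′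
      cases _ (yes refl) (yes refl) _ = contradiction i<j (<-asym i′<j′)
      cases (yes refl) _ (yes refl) _ = contradiction refl i≢j
      cases _ (yes refl) _ (yes refl) = contradiction refl i≢j

-- The number of M-colourings of H, up to second order

allPairs≡ : ∀ {A B : Set} (xs : List A) (ys : List B) → concatMap (λ x → map (x ,_) ys) xs ≡ cartesianProduct xs ys
allPairs≡ [] ys = refl
allPairs≡ (x ∷ xs) ys = cong (map (x ,_) ys ++_) (allPairs≡ xs ys)

upPairs-unique : ∀ m → Unique (upPairs m)
upPairs-unique m = filter⁺ _ (subst Unique (≡-sym (allPairs≡ (allFin m) (allFin m))) (cartesianProduct⁺ (allFin⁺ m) (allFin⁺ m)))

module _ {A : Set} (x : A → ℕ) where

  pairSum : List A → ℕ
  pairSum [] = 0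
  pairSum (p ∷ ps) = x p * ∑ ps x + pairSum ps

  -- If `n` of the values are 1, then `pairSum` counts the pairs among them, and
  -- `n ≤ 1 + n (n - 1) / 2`.
  bonferroni : (∀ p → x p ≤ 1) → ∀ ps → ∑ ps x ≤ 1 + pairSum ps
  bonferroni x≤1 [] = z≤n
  bonferroni x≤1 (p ∷ ps) with x p | x≤1 p
  ... | zero | _ = bonferroni x≤1 ps
  ... | suc zero | _ = s≤s (≤-trans (≤-reflexive (≡-sym (*-identityˡ _))) (m≤m+n _ (pairSum ps)))
  ... | suc (suc _) | s≤s ()

pairCount : {A : Set} → List A → ℕ
pairCount [] = 0
pairCount (p ∷ ps) = length ps + pairCount ps

length-filterᵇ : {A : Set} (p : A → Bool) (xs : List A) → length (filterᵇ p xs) ≡ countB p xs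
length-filterᵇ p [] = refl
length-filterᵇ p (x ∷ xs) with p x
... | true = cong suc (length-filterᵇ p xs)
... | false = length-filterᵇ p xs

edges : (H : Graph) → List (Fin (v H) × Fin (v H))
edges H = filterᵇ (λ p → adj H (proj₁ p) (proj₂ p)) (upPairs (v H))

length-edges : ∀ H → length (edges H) ≡ e H
length-edges H = length-filterᵇ _ (upPairs (v H))

edges-unique : ∀ H → Unique (edges H)
edges-unique H = filter⁺ _ (upPairs-unique (v H))

∈-edges⁻ : ∀ H {i j} → (i , j) ∈ edges H → (i , j) ∈ upPairs (v H) × adj H i j ≡ true
∈-edges⁻ H {i} {j} p∈ = let p∈′ , t = ∈-filter⁻ (λ p → Bool.T? (adj H (proj₁ p) (proj₂ p))) {v = i , j} {xs = upPairs (v H)} p∈ in p∈′ , T⇒true t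

module _ (H : Graph) (M : ℕ) where

  private
    m = v H
    V = allVecs M m

  ∑-pairSum : ∀ {ps} → Unique ps → (∀ {p} → p ∈ ps → p ∈ upPairs m) →
    M * (M * ∑ V (λ f → pairSum (λ p → mono p f) ps)) ≡ pairCount ps * M ^ m
  ∑-pairSum {[]} _ _ = ≡-trans (cong (λ z → M * (M * z)) (≡-trans (∑-const 0 V) (*-zeroʳ (length V)))) (zeros M)
    where
      zeros : ∀ a → a * (a * 0) ≡ 0
      zeros = solve-∀
  ∑-pairSum {p ∷ ps} (p∉ ∷ U) up = begin
    M * (M * ∑ V (λ f → mono p f * ∑ ps (λ p′ → mono p′ f) + pairSum (λ p → mono p f) ps))
      ≡⟨ cong (λ z → M * (M * z)) (∑-distrib-+ V) ⟩
    M * (M * (∑ V (λ f → mono p f * ∑ ps (λ p′ → mono p′ f)) + ∑ V (λ f → pairSum (λ p → mono p f) ps)))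
      ≡⟨ distribute M _ _ ⟩
    M * (M * ∑ V (λ f → mono p f * ∑ ps (λ p′ → mono p′ f))) + M * (M * ∑ V (λ f → pairSum (λ p → mono p f) ps))
      ≡⟨ cong₂ _+_ first (∑-pairSum U (up ∘ there)) ⟩
    length ps * M ^ m + pairCount ps * M ^ m
      ≡⟨ *-distribʳ-+ (M ^ m) (length ps) (pairCount ps) ⟨
    pairCount (p ∷ ps) * M ^ m ∎
    where
      open ≡-Reasoning
      distribute : ∀ a b c → a * (a * (b + c)) ≡ a * (a * b) + a * (a * c)
      distribute = solve-∀
      first : M * (M * ∑ V (λ f → mono p f * ∑ ps (λ p′ → mono p′ f))) ≡ length ps * M ^ m
      first = begin
        M * (M * ∑ V (λ f → mono p f * ∑ ps (λ p′ → mono p′ f))) ≡⟨ cong (λ z → M * (M * z)) (∑-cong V (λ f → ∑-*ˡ (mono p f) ps)) ⟨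
        M * (M * ∑ V (λ f → ∑ ps (λ p′ → mono p f * mono p′ f))) ≡⟨ cong (λ z → M * (M * z)) (∑-swap (λ f p′ → mono p f * mono p′ f) V ps) ⟩
        M * (M * ∑ ps (λ p′ → ∑ V (λ f → mono p f * mono p′ f))) ≡⟨ cong (M *_) (∑-*ˡ M ps) ⟨
        M * ∑ ps (λ p′ → M * ∑ V (λ f → mono p f * mono p′ f)) ≡⟨ ∑-*ˡ M ps ⟨
        ∑ ps (λ p′ → M * (M * ∑ V (λ f → mono p f * mono p′ f))) ≡⟨ ∑-cong-∈ ps (λ p′ p′∈ → ∑-mono-two (up (here refl)) (up (there p′∈)) (All.lookup p∉ p′∈)) ⟩
        ∑ ps (λ _ → M ^ m) ≡⟨ ∑-const (M ^ m) ps ⟩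
        length ps * M ^ m ∎

  -- In terms of probabilities: a random map is proper with probability at most
  -- `1 - e / M + C / M²`, where `C` is the number of pairs of edges. The negative term stands on
  -- the left.
  proper-count : M * (M * ∑ V (λ f → ⟦ proper H f ⟧)) + M * (e H * M ^ m) ≤ M * (M * M ^ m) + pairCount (edges H) * M ^ m
  proper-count = begin
    M * (M * ∑ V p) + M * (e H * M ^ m) ≡⟨ cong (M * (M * ∑ V p) +_) (cong (M *_) monos) ⟨
    M * (M * ∑ V p) + M * (M * ∑ V s) ≡⟨ distribute M _ _ ⟨
    M * (M * (∑ V p + ∑ V s)) ≡⟨ cong (λ z → M * (M * z)) (∑-distrib-+ V) ⟨
    M * (M * ∑ V (λ f → p f + s f)) ≤⟨ *-monoʳ-≤ M (*-monoʳ-≤ M (∑-mono V each)) ⟩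
    M * (M * ∑ V (λ f → 1 + d f)) ≡⟨ cong (λ z → M * (M * z)) (∑-distrib-+ V) ⟩
    M * (M * (∑ V (λ _ → 1) + ∑ V d)) ≡⟨ distribute M _ _ ⟩
    M * (M * ∑ V (λ _ → 1)) + M * (M * ∑ V d) ≡⟨ cong₂ (λ a b → M * (M * a) + b) (∑-allVecs-1 m) (∑-pairSum (edges-unique H) (λ {(i , j)} p∈ → proj₁ (∈-edges⁻ H p∈))) ⟩
    M * (M * M ^ m) + pairCount (edges H) * M ^ m ∎
    where
      open ≤-Reasoning
      p s d : Vec (Fin M) m → ℕ
      p f = ⟦ proper H f ⟧
      s f = ∑ (edges H) (λ p → mono p f)
      d f = pairSum (λ p → mono p f) (edges H)
      distribute : ∀ a b c → a * (a * (b + c)) ≡ a * (a * b) + a * (a * c)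
      distribute = solve-∀
      each : ∀ f → p f + s f ≤ 1 + d f
      each f with proper H f in eq
      ... | false = bonferroni (λ p → mono p f) (λ (i , j) → ⟦⟧≤1 (lookup f i == lookup f j)) (edges H)
      ... | true = s≤s (≤-trans (≤-reflexive (≡-trans (∑-cong-∈ (edges H) none) (≡-trans (∑-const 0 (edges H)) (*-zeroʳ (length (edges H)))))) z≤n)
        where
          none : ∀ p → p ∈ edges H → mono p f ≡ 0
          none (i , j) p∈ = cong ⟦_⟧ (==-≢ (proper⇒ H {f = f} eq i j (proj₂ (∈-edges⁻ H p∈))))
      monos : M * ∑ V s ≡ e H * M ^ m
      monos = ≡-trans (cong (M *_) (∑-swap (λ f p → mono p f) V (edges H))) (≡-trans (≡-sym (∑-*ˡ M (edges H)))
        (≡-trans (∑-cong-∈ (edges H) (λ (i , j) p∈ → ∑-mono-pair {i = i} {j} (λ { refl → <-irrefl refl (∈-upPairs⁻ (proj₁ (∈-edges⁻ H p∈))) })))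
          (≡-trans (∑-const (M ^ m) (edges H)) (cong (_* M ^ m) (length-edges H)))))

-- Maps that are constant on components

module _ (H : Graph) (q : ℕ) (1≤q : 1 ≤ q) where

  private
    m = v H

  constant : Vec (Fin q) m → Bool
  constant f = all (λ (i , j) → not (adj H i j) ∨ (lookup f i == lookup f j)) (allPairs m)

  smaller-connected : ∀ w → leader H w ≡ false → ∃ λ j → toℕ j < toℕ w × connected H w j ≡ true
  smaller-connected w h with any (λ j → (toℕ j <ᵇ toℕ w) ∧ connected H w j) (allFin m) in eq
  ... | true = let j , _ , p = any-true⁻ {p = λ j → (toℕ j <ᵇ toℕ w) ∧ connected H w j} (allFin m) eq in
    j , <ᵇ⇒< _ _ (true⇒T (∧-trueˡ p)) , ∧-trueʳ {toℕ j <ᵇ toℕ w} p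

  abstract
    parent : Fin m → Fin m
    parent w = choose (leader H w Bool.≟ false)
      where
        choose : Dec (leader H w ≡ false) → Fin m
        choose (yes h) = proj₁ (smaller-connected w h)
        choose (no _) = w

    parent-spec : ∀ w → leader H w ≡ false → toℕ (parent w) < toℕ w × connected H w (parent w) ≡ true
    parent-spec w h with leader H w Bool.≟ false
    ... | yes h′ = proj₂ (smaller-connected w h′)
    ... | no ¬h = contradiction h ¬h

  private
    γ : List (Fin m) → Fin m → Vec (Fin q) m → ℕ
    γ P w f = if leader H w then 1 else ⟦ lookup f w == lookup f (parent w) ⟧

    size : Fin m → ℕ
    size w = if leader H w then q else 1

  open Sequential γ size

  -- Heads are revealed last, so the vertices come in increasing order, and a vertex that is not a
  -- leader finds its parent already revealed.
  downward : (j : ℕ) → j ≤ m → List (Fin m)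
  downward zero _ = []
  downward (suc j) j<m = Fin.fromℕ< j<m ∷ downward j (<⇒≤ j<m)

  ∈-downward⁺ : ∀ j (j≤m : j ≤ m) {x} → toℕ x < j → x ∈ downward j j≤m
  ∈-downward⁺ (suc j) j<m {x} (s≤s x≤j) with m≤n⇒m<n∨m≡n x≤j
  ... | inj₁ x<j = there (∈-downward⁺ j (<⇒≤ j<m) x<j)
  ... | inj₂ x≡j = here (Fin.toℕ-injective (≡-trans x≡j (≡-sym (Fin.toℕ-fromℕ< j<m))))

  ∈-downward⁻ : ∀ j (j≤m : j ≤ m) {x} → x ∈ downward j j≤m → toℕ x < j
  ∈-downward⁻ (suc j) j<m (here refl) = s≤s (≤-reflexive (Fin.toℕ-fromℕ< j<m))
  ∈-downward⁻ (suc j) j<m (there x∈) = m<n⇒m<1+n (∈-downward⁻ j (<⇒≤ j<m) x∈)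

  downward-layered : ∀ j (j≤m : j ≤ m) → Layered (downward j j≤m)
  downward-layered zero _ = tt
  downward-layered (suc j) j<m = (w∉ , local , total) , downward-layered j (<⇒≤ j<m)
    where
      w = Fin.fromℕ< j<m
      w≡j = Fin.toℕ-fromℕ< j<m
      P = downward j (<⇒≤ j<m)
      w∉ : w ∉ P
      w∉ w∈ = <-irrefl w≡j (∈-downward⁻ j (<⇒≤ j<m) w∈)
      parent∈ : leader H w ≡ false → parent w ∈ P
      parent∈ h = ∈-downward⁺ j (<⇒≤ j<m) (<-≤-trans (proj₁ (parent-spec w h)) (≤-reflexive w≡j))
      local : ∀ x c f → x ∉ P → x ≢ w → γ P w (f [ x ]≔ c) ≡ γ P w f
      local x c f x∉ x≢w with leader H w in eq
      ... | true = refl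
      ... | false rewrite lookup∘update′ {i = w} (x≢w ∘ ≡-sym) f c
        | lookup∘update′ {i = parent w} {j = x} (λ { refl → x∉ (parent∈ eq) }) f c = refl
      total : ∀ f → ∑ (allFin q) (λ c → γ P w (f [ w ]≔ c)) ≤ size w
      total f with leader H w in eq
      ... | true = ≤-reflexive (≡-trans (∑-const 1 (allFin q)) (≡-trans (*-identityʳ _) (length-tabulate id)))
      ... | false = ≤-reflexive (≡-trans (∑-cong (allFin q) each) (∑-δ (λ _ → 1) (allFin⁺ q) (∈-allFin (lookup f (parent w)))))
        where
          each : ∀ c → ⟦ lookup (f [ w ]≔ c) w == lookup (f [ w ]≔ c) (parent w) ⟧ ≡ ⟦ c == lookup f (parent w) ⟧ * 1
          each c rewrite lookup∘update w f c
            | lookup∘update′ {i = parent w} {j = w} (λ eq′ → w∉ (subst (_∈ P) eq′ (parent∈ eq))) f c = ≡-sym (*-identityʳ _)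

  constant-weight : ∀ f → constant f ≡ true → ∀ P → weight P f ≡ 1
  constant-weight f h [] = refl
  constant-weight f h (w ∷ P) with leader H w in eq
  ... | true = ≡-trans (*-identityˡ _) (constant-weight f h P)
  ... | false = cong₂ (λ a b → ⟦ a ⟧ * b) (==-≡ (≡-sym agree)) (constant-weight f h P)
    where
      along : ∀ {x y} → adj H x y ≡ true → lookup f (parent w) ≡ lookup f x → lookup f (parent w) ≡ lookup f y
      along {x} {y} Exy same = ≡-trans same (==⇒≡ (≡-trans (cong (λ b → not b ∨ (lookup f x == lookup f y)) (≡-sym Exy))
        (all-true⁻ h (∈-allPairs x y))))
      agree : lookup f (parent w) ≡ lookup f w
      agree = reach-closed H {λ x → lookup f (parent w) ≡ lookup f x} along m (proj₂ (parent-spec w eq)) refl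

  -- Every vertex that is not a leader copies its parent, which leaves a free choice only at the
  -- leaders.
  constant-count : ∑ (allVecs q m) (λ f → ⟦ constant f ⟧) ≤ q ^ k H
  constant-count = *-cancelˡ-≤ (q ^ m) {{m^n≢0 q m {{>-nonZero 1≤q}}}} (begin
    q ^ m * ∑ V (λ f → ⟦ constant f ⟧) ≤⟨ *-monoʳ-≤ (q ^ m) (∑-mono V each) ⟩
    q ^ m * ∑ V (weight P) ≡⟨ cong (λ a → q ^ a * ∑ V (weight P)) length-P ⟨
    q ^ length P * ∑ V (weight P) ≤⟨ weight-bound (downward-layered m ≤-refl) ⟩
    q ^ m * ∏ P size ≡⟨ cong (q ^ m *_) (∏-↭ P↭) ⟩
    q ^ m * ∏ (allFin m) size ≡⟨ cong (q ^ m *_) (∏-cong (allFin m) (λ w → as-power (leader H w))) ⟩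
    q ^ m * ∏ (allFin m) (λ w → q ^ ⟦ leader H w ⟧) ≡⟨ cong (q ^ m *_) (∏-exponents q (λ w → ⟦ leader H w ⟧) (allFin m)) ⟩
    q ^ m * q ^ ∑ (allFin m) (λ w → ⟦ leader H w ⟧) ≡⟨ cong (λ a → q ^ m * q ^ a) (k-∑ H) ⟨
    q ^ m * q ^ k H ∎)
    where
      open ≤-Reasoning
      V = allVecs q m
      P = downward m ≤-refl
      layered⇒unique : ∀ {P} → Layered P → Unique P
      layered⇒unique {[]} _ = []
      layered⇒unique {w ∷ P} ((w∉ , _) , L) = All.tabulate (λ x∈ → λ { refl → w∉ x∈ }) ∷ layered⇒unique L
      P↭ : P ↭ allFin m
      P↭ = unique∧complete⇒↭ (layered⇒unique (downward-layered m ≤-refl)) (allFin⁺ m) (λ x → ∈-downward⁺ m ≤-refl (Fin.toℕ<n x)) ∈-allFin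
      length-P : length P ≡ m
      length-P = ≡-trans (↭-length P↭) (length-tabulate id)
      as-power : ∀ b → (if b then q else 1) ≡ q ^ ⟦ b ⟧
      as-power true = ≡-sym (*-identityʳ q)
      as-power false = refl
      each : ∀ f → ⟦ constant f ⟧ ≤ weight P f
      each f with constant f in eq
      ... | false = z≤n
      ... | true = ≤-reflexive (≡-sym (constant-weight f eq P))

-- The disjoint union of q complete M-partite graphs with parts of size s

∑-remQuot : ∀ a b (F : Fin a → Fin b → ℕ) →
  ∑ (allFin (a * b)) (λ x → uncurry F (remQuot b x)) ≡ ∑ (allFin a) (λ i → ∑ (allFin b) (F i))
∑-remQuot a b F = begin
  ∑ (allFin (a * b)) G ≡⟨ ∑-↭ (unique∧complete⇒↭ (allFin⁺ (a * b)) (map⁺ (λ {(i , j)} {(i′ , j′)} eq → uncurry (cong₂ _,_) (Fin.combine-injective i j i′ j′ eq)) (cartesianProduct⁺ (allFin⁺ a) (allFin⁺ b))) ∈-allFin complete) ⟩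
  ∑ (map (uncurry combine) pairs) G ≡⟨ ∑-map (uncurry combine) pairs ⟩
  ∑ pairs (G ∘ uncurry combine) ≡⟨ ∑-cong pairs (λ (i , j) → cong (uncurry F) (Fin.remQuot-combine i j)) ⟩
  ∑ pairs (uncurry F) ≡⟨ cong (λ l → ∑ l (uncurry F)) (allPairs≡ (allFin a) (allFin b)) ⟨
  ∑ (concatMap (λ i → map (i ,_) (allFin b)) (allFin a)) (uncurry F) ≡⟨ ∑-concatMap _ (allFin a) ⟩
  ∑ (allFin a) (λ i → ∑ (map (i ,_) (allFin b)) (uncurry F)) ≡⟨ ∑-cong (allFin a) (λ i → ∑-map (i ,_) (allFin b)) ⟩
  ∑ (allFin a) (λ i → ∑ (allFin b) (F i)) ∎
  where
    open ≡-Reasoning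
    G : Fin (a * b) → ℕ
    G x = uncurry F (remQuot b x)
    pairs = cartesianProduct (allFin a) (allFin b)
    complete : ∀ x → x ∈ map (uncurry combine) pairs
    complete x = subst (_∈ map (uncurry combine) pairs) (Fin.combine-remQuot {a} b x)
      (∈-map⁺ (uncurry combine) (∈-cartesianProduct⁺ (∈-allFin (proj₁ (remQuot {a} b x))) (∈-allFin (proj₂ (remQuot {a} b x)))))

module _ (a b : ℕ) where

  quot : Fin (a * b) → Fin a
  quot x = proj₁ (remQuot b x)

  rem : Fin (a * b) → Fin b
  rem x = proj₂ (remQuot {a} b x)

  ∑-allVecs-* : ∀ m (F : Vec (Fin a) m → Vec (Fin b) m → ℕ) →
    ∑ (allVecs (a * b) m) (λ f → F (mapᵥ quot f) (mapᵥ rem f)) ≡ ∑ (allVecs a m) (λ φ → ∑ (allVecs b m) (F φ))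
  ∑-allVecs-* zero F = ≡-sym (+-identityʳ _)
  ∑-allVecs-* (suc m) F = begin
    ∑ (allVecs (a * b) (suc m)) (λ f → F (mapᵥ quot f) (mapᵥ rem f))
      ≡⟨ ∑-allVecs-suc {a * b} m (λ f → F (mapᵥ quot f) (mapᵥ rem f)) ⟩
    ∑ (allFin (a * b)) (λ x → ∑ (allVecs (a * b) m) (λ f → F (quot x ∷ᵥ mapᵥ quot f) (rem x ∷ᵥ mapᵥ rem f)))
      ≡⟨ ∑-cong (allFin (a * b)) (λ x → ∑-allVecs-* m (λ φ ψ → F (quot x ∷ᵥ φ) (rem x ∷ᵥ ψ))) ⟩
    ∑ (allFin (a * b)) (λ x → ∑ (allVecs a m) (λ φ → ∑ (allVecs b m) (λ ψ → F (quot x ∷ᵥ φ) (rem x ∷ᵥ ψ))))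
      ≡⟨ ∑-remQuot a b (λ i j → ∑ (allVecs a m) (λ φ → ∑ (allVecs b m) (λ ψ → F (i ∷ᵥ φ) (j ∷ᵥ ψ)))) ⟩
    ∑ (allFin a) (λ i → ∑ (allFin b) (λ j → ∑ (allVecs a m) (λ φ → ∑ (allVecs b m) (λ ψ → F (i ∷ᵥ φ) (j ∷ᵥ ψ)))))
      ≡⟨ ∑-cong (allFin a) (λ i → ∑-swap (λ j φ → ∑ (allVecs b m) (λ ψ → F (i ∷ᵥ φ) (j ∷ᵥ ψ))) (allFin b) (allVecs a m)) ⟩
    ∑ (allFin a) (λ i → ∑ (allVecs a m) (λ φ → ∑ (allFin b) (λ j → ∑ (allVecs b m) (λ ψ → F (i ∷ᵥ φ) (j ∷ᵥ ψ)))))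
      ≡⟨ ∑-cong (allFin a) (λ i → ∑-cong (allVecs a m) (λ φ → ∑-allVecs-suc m (F (i ∷ᵥ φ)))) ⟨
    ∑ (allFin a) (λ i → ∑ (allVecs a m) (λ φ → ∑ (allVecs b (suc m)) (F (i ∷ᵥ φ))))
      ≡⟨ ∑-allVecs-suc {a} m (λ φ → ∑ (allVecs b (suc m)) (F φ)) ⟨
    ∑ (allVecs a (suc m)) (λ φ → ∑ (allVecs b (suc m)) (F φ)) ∎
    where open ≡-Reasoning

module Construction (q M s : ℕ) where

  part : Fin (q * (M * s)) → Fin q
  part = quot q (M * s)

  block : Fin (q * (M * s)) → Fin M
  block x = quot M s (rem q (M * s) x)

  G : Graph
  G = record
    { n = q * (M * s)
    ; adj = λ x y → (part x == part y) ∧ not (block x == block y)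
    ; sym = λ x y → cong₂ (λ a b → a ∧ not b) (==-comm (part x) (part y)) (==-comm (block x) (block y))
    ; irrefl = λ x → cong₂ (λ a b → a ∧ not b) (==-refl (part x)) (==-refl (block x))
    }

  ∑-blowup : ∀ m (Φ : Vec (Fin q) m → Vec (Fin M) m → ℕ) →
    ∑ (allVecs (q * (M * s)) m) (λ f → Φ (mapᵥ part f) (mapᵥ block f)) ≡
    s ^ m * ∑ (allVecs q m) (λ φ → ∑ (allVecs M m) (Φ φ))
  ∑-blowup m Φ = begin
    ∑ (allVecs (q * (M * s)) m) (λ f → Φ (mapᵥ part f) (mapᵥ block f))
      ≡⟨ ∑-cong (allVecs (q * (M * s)) m) (λ f → cong (Φ (mapᵥ part f)) (map-∘ (quot M s) (rem q (M * s)) f)) ⟩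
    ∑ (allVecs (q * (M * s)) m) (λ f → Φ (mapᵥ part f) (mapᵥ (quot M s) (mapᵥ (rem q (M * s)) f)))
      ≡⟨ ∑-allVecs-* q (M * s) m (λ φ τ → Φ φ (mapᵥ (quot M s) τ)) ⟩
    ∑ (allVecs q m) (λ φ → ∑ (allVecs (M * s) m) (λ τ → Φ φ (mapᵥ (quot M s) τ)))
      ≡⟨ ∑-cong (allVecs q m) inner ⟩
    ∑ (allVecs q m) (λ φ → s ^ m * ∑ (allVecs M m) (Φ φ))
      ≡⟨ ∑-*ˡ (s ^ m) (allVecs q m) ⟩
    s ^ m * ∑ (allVecs q m) (λ φ → ∑ (allVecs M m) (Φ φ)) ∎
    where
      open ≡-Reasoning
      inner : ∀ φ → ∑ (allVecs (M * s) m) (λ τ → Φ φ (mapᵥ (quot M s) τ)) ≡ s ^ m * ∑ (allVecs M m) (Φ φ)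
      inner φ = begin
        ∑ (allVecs (M * s) m) (λ τ → Φ φ (mapᵥ (quot M s) τ)) ≡⟨ ∑-allVecs-* M s m (λ ψ _ → Φ φ ψ) ⟩
        ∑ (allVecs M m) (λ ψ → ∑ (allVecs s m) (λ _ → Φ φ ψ)) ≡⟨ ∑-cong (allVecs M m) (λ ψ → ≡-trans (∑-cong (allVecs s m) λ _ → ≡-sym (*-identityʳ (Φ φ ψ))) (∑-*ˡ (Φ φ ψ) (allVecs s m))) ⟩
        ∑ (allVecs M m) (λ ψ → Φ φ ψ * ∑ (allVecs s m) (λ _ → 1)) ≡⟨ ∑-*ʳ _ (allVecs M m) ⟩
        ∑ (allVecs M m) (Φ φ) * ∑ (allVecs s m) (λ _ → 1) ≡⟨ *-comm _ (∑ (allVecs s m) (λ _ → 1)) ⟩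
        ∑ (allVecs s m) (λ _ → 1) * ∑ (allVecs M m) (Φ φ) ≡⟨ cong (_* ∑ (allVecs M m) (Φ φ)) (∑-allVecs-1 m) ⟩
        s ^ m * ∑ (allVecs M m) (Φ φ) ∎

  module _ (H : Graph) where

    private
      m = v H

    -- Each component of `H` stays within one of the `q` pieces, and the blocks form a proper
    -- `M`-colouring. The two coordinates are bounded separately, and the position inside a block is
    -- free.
    hom-G : 1 ≤ q → hom H G ≤ s ^ m * (q ^ k H * ∑ (allVecs M m) (λ ψ → ⟦ proper H ψ ⟧))
    hom-G 1≤q = begin
      hom H G ≡⟨ countB-∑ (isHom H G) (allVecs (v G) m) ⟩
      ∑ (allVecs (v G) m) (λ f → ⟦ isHom H G f ⟧) ≤⟨ ∑-mono (allVecs (v G) m) each ⟩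
      ∑ (allVecs (v G) m) (λ f → ⟦ constant H q 1≤q (mapᵥ part f) ⟧ * ⟦ proper H (mapᵥ block f) ⟧) ≡⟨ ∑-blowup m (λ φ ψ → ⟦ constant H q 1≤q φ ⟧ * ⟦ proper H ψ ⟧) ⟩
      s ^ m * ∑ (allVecs q m) (λ φ → ∑ (allVecs M m) (λ ψ → ⟦ constant H q 1≤q φ ⟧ * ⟦ proper H ψ ⟧))
            ≡⟨ cong (s ^ m *_) (≡-trans (∑-cong (allVecs q m) λ φ → ∑-*ˡ ⟦ constant H q 1≤q φ ⟧ (allVecs M m)) (∑-*ʳ _ (allVecs q m))) ⟩
      s ^ m * (∑ (allVecs q m) (λ φ → ⟦ constant H q 1≤q φ ⟧) * ∑ (allVecs M m) (λ ψ → ⟦ proper H ψ ⟧))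
            ≤⟨ *-monoʳ-≤ (s ^ m) (*-monoˡ-≤ _ (constant-count H q 1≤q)) ⟩
      s ^ m * (q ^ k H * ∑ (allVecs M m) (λ ψ → ⟦ proper H ψ ⟧)) ∎
      where
        open ≤-Reasoning
        each : ∀ f → ⟦ isHom H G f ⟧ ≤ ⟦ constant H q 1≤q (mapᵥ part f) ⟧ * ⟦ proper H (mapᵥ block f) ⟧
        each f with isHom H G f in eq
        ... | false = z≤n
        ... | true = ≤-reflexive (≡-sym (cong₂ (λ a b → ⟦ a ⟧ * ⟦ b ⟧)
          (all-true⁺ (allPairs m) λ (i , j) _ → const i j (edge i j))
          (⇒proper H {f = mapᵥ block f} λ i j Eij same → contradiction (≡-trans (≡-sym (∧-trueʳ {part (lookup f i) == part (lookup f j)} (edge i j Eij)))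
            (cong not (==-≡ (≡-trans (≡-sym (lookup-map i block f)) (≡-trans same (lookup-map j block f)))))) λ ())))
          where
            edge : ∀ i j → adj H i j ≡ true → adj G (lookup f i) (lookup f j) ≡ true
            edge i j Eij = ≡-trans (cong (λ b → not b ∨ adj G (lookup f i) (lookup f j)) (≡-sym Eij)) (all-true⁻ eq (∈-allPairs i j))
            const : ∀ i j → (adj H i j ≡ true → adj G (lookup f i) (lookup f j) ≡ true) →
              not (adj H i j) ∨ (lookup (mapᵥ part f) i == lookup (mapᵥ part f) j) ≡ true
            const i j h with adj H i j
            ... | false = refl
            ... | true = ≡-trans (cong₂ _==_ (lookup-map i part f) (lookup-map j part f)) (∧-trueˡ (h refl))

    -- Relaxes the condition for a map into the complement: adjacent vertices may also share an
    -- image. This can only enlarge the count, and the condition then depends on parts and blocks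
    -- alone.
    compatible : Vec (Fin q) m → Vec (Fin M) m → Bool
    compatible φ ψ = all (λ (i , j) → not (adj H i j) ∨ not ((lookup φ i == lookup φ j) ∧ not (lookup ψ i == lookup ψ j))) (allPairs m)

    hom-complement : hom H (complement G) ≤ s ^ m * ∑ (allVecs q m) (λ φ → ∑ (allVecs M m) (λ ψ → ⟦ compatible φ ψ ⟧))
    hom-complement = begin
      hom H (complement G) ≡⟨ countB-∑ (isHom H (complement G)) (allVecs (v G) m) ⟩
      ∑ (allVecs (v G) m) (λ f → ⟦ isHom H (complement G) f ⟧) ≤⟨ ∑-mono (allVecs (v G) m) each ⟩
      ∑ (allVecs (v G) m) (λ f → ⟦ compatible (mapᵥ part f) (mapᵥ block f) ⟧) ≡⟨ ∑-blowup m (λ φ ψ → ⟦ compatible φ ψ ⟧) ⟩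
      s ^ m * ∑ (allVecs q m) (λ φ → ∑ (allVecs M m) (λ ψ → ⟦ compatible φ ψ ⟧)) ∎
      where
        open ≤-Reasoning
        each : ∀ f → ⟦ isHom H (complement G) f ⟧ ≤ ⟦ compatible (mapᵥ part f) (mapᵥ block f) ⟧
        each f with isHom H (complement G) f in eq
        ... | false = z≤n
        ... | true = ≤-reflexive (≡-sym (cong ⟦_⟧ (all-true⁺ (allPairs m) λ (i , j) _ → pair i j (all-true⁻ eq (∈-allPairs i j)))))
          where
            pair : ∀ i j → not (adj H i j) ∨ adj (complement G) (lookup f i) (lookup f j) ≡ true →
              not (adj H i j) ∨ not ((lookup (mapᵥ part f) i == lookup (mapᵥ part f) j) ∧ not (lookup (mapᵥ block f) i == lookup (mapᵥ block f) j)) ≡ true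
            pair i j h rewrite lookup-map i part f | lookup-map j part f | lookup-map i block f | lookup-map j block f with adj H i j
            ... | false = refl
            ... | true = ∧-trueˡ h

-- Homomorphisms into the complement

module ComplementCount (H : Graph) (r : ℕ) (χ≡ : χ H ≡ suc (suc r)) (M s : ℕ) where

  private
    q = suc r
    m = v H

  open Construction q M s

  module _ (φ : Vec (Fin q) m) where

    Mono : Fin m × Fin m → Set
    Mono (i , j) = toℕ i < toℕ j × adj H i j ≡ true × lookup φ i ≡ lookup φ j

    mono? : ∀ p → Dec (Mono p)
    mono? (i , j) = (toℕ i <? toℕ j) ×-dec (adj H i j Bool.≟ true) ×-dec (lookup φ i ≟ lookup φ j)

    any-pair? : {C : Fin m × Fin m → Set} → (∀ p → Dec (C p)) → Dec (∃ C)
    any-pair? C? with Fin.any? (λ i → Fin.any? (λ j → C? (i , j)))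
    ... | yes (i , j , c) = yes ((i , j) , c)
    ... | no none = no λ ((i , j) , c) → none (i , j , c)

    orient : ∀ {i j} → adj H i j ≡ true → lookup φ i ≡ lookup φ j → Mono (i , j) ⊎ Mono (j , i)
    orient {i} {j} Eij same with <-cmp (toℕ i) (toℕ j)
    ... | tri< i<j _ _ = inj₁ (i<j , Eij , same)
    ... | tri> _ _ j<i = inj₂ (j<i , ≡-trans (Graph.sym H j i) Eij , ≡-sym same)
    ... | tri≈ _ i≡j _ = contradiction (≡-trans (≡-sym Eij) (≡-trans (cong (adj H i) (≡-sym (Fin.toℕ-injective i≡j))) (Graph.irrefl H i))) λ ()

    some-mono : ∃ Mono
    some-mono = decidable-stable (any-pair? mono?) λ none →
      uncolourable H (uncolourable-q H r χ≡) (lookup φ) λ i j Eij same → case none i j (orient Eij same)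
      where
        case : ¬ ∃ Mono → ∀ i j → ¬ (Mono (i , j) ⊎ Mono (j , i))
        case none i j (inj₁ c) = none ((i , j) , c)
        case none i j (inj₂ c) = none ((j , i) , c)

    compatible-mono : ∀ {p} → Mono p → ∀ ψ → ⟦ compatible H φ ψ ⟧ ≤ mono p ψ
    compatible-mono {i , j} (_ , Eij , same) ψ with compatible H φ ψ in eq
    ... | false = z≤n
    ... | true = identify (all-true⁻ eq (∈-allPairs i j))
      where
        identify : not (adj H i j) ∨ not ((lookup φ i == lookup φ j) ∧ not (lookup ψ i == lookup ψ j)) ≡ true → 1 ≤ mono (i , j) ψ
        identify h rewrite Eij | ==-≡ same with lookup ψ i == lookup ψ j
        ... | true = ≤-refl

    deleted : ∀ {i j} → adj (deleteEdge H i j) i j ≡ false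
    deleted {i} {j} rewrite ==-refl i | ==-refl j = ∧-zeroʳ (adj H i j)

    sole-mono : ∀ {p} → Mono p → (∀ p′ → Mono p′ → p′ ≡ p) → sole H r χ≡ p φ ≡ true
    sole-mono {i , j} (i<j , Eij , same) only = cong₂ _∧_ Eij (⇒proper K {f = φ} λ x y Kxy φx≡φy → absurd x y Kxy (orient (∧-trueˡ Kxy) φx≡φy))
      where
        K = deleteEdge H i j
        absurd : ∀ x y → adj K x y ≡ true → ¬ (Mono (x , y) ⊎ Mono (y , x))
        absurd x y Kxy (inj₁ c) with refl ← only _ c = contradiction (≡-trans (≡-sym Kxy) (deleted {x} {y})) λ ()
        absurd x y Kxy (inj₂ c) with refl ← only _ c = contradiction (≡-trans (≡-sym Kxy) (≡-trans (Graph.sym K x y) (deleted {y} {x}))) λ ()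

    -- There is a monochromatic edge because `H` has no proper `q`-colouring, and its ends must
    -- share a block, with probability `1 / M`. If it is the only one, `sole` counts it. Two such
    -- edges have probability `1 / M²`, which the summand 1 covers.
    compatible-count : M * (M * ∑ (allVecs M m) (λ ψ → ⟦ compatible H φ ψ ⟧)) ≤
      (M * ∑ (upPairs m) (λ p → ⟦ sole H r χ≡ p φ ⟧) + 1) * M ^ m
    compatible-count with some-mono
    ... | p@(i , j) , c@(i<j , _) with any-pair? (λ p′ → mono? p′ ×-dec ¬? (≡-dec _≟_ _≟_ p′ p))
    ...   | yes (p′@(i′ , j′) , c′@(i′<j′ , _) , p′≢p) = begin
      M * (M * ∑ V (λ ψ → ⟦ compatible H φ ψ ⟧)) ≤⟨ *-monoʳ-≤ M (*-monoʳ-≤ M (∑-mono V both)) ⟩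
      M * (M * ∑ V (λ ψ → mono p ψ * mono p′ ψ)) ≡⟨ ∑-mono-two (∈-upPairs⁺ i<j) (∈-upPairs⁺ i′<j′) (p′≢p ∘ ≡-sym) ⟩
      M ^ m ≡⟨ *-identityˡ (M ^ m) ⟨
      1 * M ^ m ≤⟨ *-monoˡ-≤ (M ^ m) (m≤n+m 1 (M * ∑ (upPairs m) (λ p → ⟦ sole H r χ≡ p φ ⟧))) ⟩
      (M * ∑ (upPairs m) (λ p → ⟦ sole H r χ≡ p φ ⟧) + 1) * M ^ m ∎
      where
        open ≤-Reasoning
        V = allVecs M m
        both : ∀ ψ → ⟦ compatible H φ ψ ⟧ ≤ mono p ψ * mono p′ ψ
        both ψ with compatible H φ ψ | compatible-mono c ψ | compatible-mono c′ ψ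
        ... | false | _ | _ = z≤n
        ... | true | h | h′ = *-mono-≤ h h′
    ...   | no none = begin
      M * (M * ∑ V (λ ψ → ⟦ compatible H φ ψ ⟧)) ≤⟨ *-monoʳ-≤ M (*-monoʳ-≤ M (∑-mono V (compatible-mono c))) ⟩
      M * (M * ∑ V (mono p)) ≡⟨ cong (M *_) (∑-mono-pair {i = i} {j} λ { refl → <-irrefl refl i<j }) ⟩
      M * M ^ m ≤⟨ *-monoˡ-≤ (M ^ m) (≤-trans (≤-reflexive (≡-sym (*-identityʳ M))) (≤-trans (*-monoʳ-≤ M one) (m≤m+n _ 1))) ⟩
      (M * ∑ (upPairs m) (λ p → ⟦ sole H r χ≡ p φ ⟧) + 1) * M ^ m ∎
      where
        open ≤-Reasoning
        V = allVecs M m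
        only : ∀ p′ → Mono p′ → p′ ≡ p
        only p′ c′ = decidable-stable (≡-dec _≟_ _≟_ p′ p) λ p′≢p → none (p′ , c′ , p′≢p)
        one : 1 ≤ ∑ (upPairs m) (λ p → ⟦ sole H r χ≡ p φ ⟧)
        one = ≤-trans (≤-reflexive (cong ⟦_⟧ (≡-sym (sole-mono c only)))) (∑-single (λ p → ⟦ sole H r χ≡ p φ ⟧) (∈-upPairs⁺ i<j))

  complement-count : M * (M * hom H (complement G)) ≤
    s ^ m * ((M * (crit H * (r ! * r ^ ((m + 1) ∸ suc (suc r) ∸ k H) * q ^ k H)) + q ^ m) * M ^ m)
  complement-count = begin
    M * (M * hom H (complement G)) ≤⟨ *-monoʳ-≤ M (*-monoʳ-≤ M (hom-complement H)) ⟩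
    M * (M * (s ^ m * ∑ Q (λ φ → ∑ V (c φ)))) ≡⟨ shape M (s ^ m) _ ⟩
    s ^ m * (M * (M * ∑ Q (λ φ → ∑ V (c φ)))) ≡⟨ cong (λ z → s ^ m * (M * z)) (∑-*ˡ M Q) ⟨
    s ^ m * (M * ∑ Q (λ φ → M * ∑ V (c φ))) ≡⟨ cong (s ^ m *_) (∑-*ˡ M Q) ⟨
    s ^ m * ∑ Q (λ φ → M * (M * ∑ V (c φ))) ≤⟨ *-monoʳ-≤ (s ^ m) (∑-mono Q compatible-count) ⟩
    s ^ m * ∑ Q (λ φ → (M * τ φ + 1) * M ^ m) ≡⟨ cong (s ^ m *_) (∑-*ʳ (M ^ m) Q) ⟩
    s ^ m * (∑ Q (λ φ → M * τ φ + 1) * M ^ m) ≡⟨ cong (λ z → s ^ m * (z * M ^ m)) (∑-distrib-+ Q) ⟩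
    s ^ m * ((∑ Q (λ φ → M * τ φ) + ∑ Q (λ _ → 1)) * M ^ m) ≡⟨ cong (λ z → s ^ m * (z * M ^ m)) (cong₂ _+_ (∑-*ˡ M Q) (∑-allVecs-1 m)) ⟩
    s ^ m * ((M * ∑ Q τ + q ^ m) * M ^ m) ≤⟨ *-monoʳ-≤ (s ^ m) (*-monoˡ-≤ (M ^ m) (+-monoˡ-≤ (q ^ m) (*-monoʳ-≤ M (∑-sole H r χ≡)))) ⟩
    s ^ m * ((M * (crit H * (r ! * r ^ ((m + 1) ∸ suc (suc r) ∸ k H) * q ^ k H)) + q ^ m) * M ^ m) ∎
    where
      open ≤-Reasoning
      Q = allVecs q m
      V = allVecs M m
      c : Vec (Fin q) m → Vec (Fin M) m → ℕ
      c φ ψ = ⟦ compatible H φ ψ ⟧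
      τ : Vec (Fin q) m → ℕ
      τ φ = ∑ (upPairs m) (λ p → ⟦ sole H r χ≡ p φ ⟧)
      shape : ∀ a b c → a * (a * (b * c)) ≡ b * (a * (a * c))
      shape = solve-∀

-- Fractions of natural numbers

fromℚᵘ-+ : ∀ x y → fromℚᵘ x +ℚ fromℚᵘ y ≡ fromℚᵘ (x +ᵘ y)
fromℚᵘ-+ x y = ℚ.toℚᵘ-injective (ℚᵘ.≃-trans (ℚ.toℚᵘ-homo-+ (fromℚᵘ x) (fromℚᵘ y))
  (ℚᵘ.≃-trans (ℚᵘ.+-cong (ℚ.toℚᵘ-fromℚᵘ x) (ℚ.toℚᵘ-fromℚᵘ y)) (ℚᵘ.≃-sym (ℚ.toℚᵘ-fromℚᵘ (x +ᵘ y)))))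

fromℚᵘ-* : ∀ x y → fromℚᵘ x *ℚ fromℚᵘ y ≡ fromℚᵘ (x *ᵘ y)
fromℚᵘ-* x y = ℚ.toℚᵘ-injective (ℚᵘ.≃-trans (ℚ.toℚᵘ-homo-* (fromℚᵘ x) (fromℚᵘ y))
  (ℚᵘ.≃-trans (ℚᵘ.*-cong (ℚ.toℚᵘ-fromℚᵘ x) (ℚ.toℚᵘ-fromℚᵘ y)) (ℚᵘ.≃-sym (ℚ.toℚᵘ-fromℚᵘ (x *ᵘ y)))))

pos-*-mono : ∀ {a b c d} → a * b ≤ c * d → (pos a ℤ.* pos b) ℤ.≤ (pos c ℤ.* pos d)
pos-*-mono {a} {b} {c} {d} h = subst₂ ℤ._≤_ (ℤ.pos-* a b) (ℤ.pos-* c d) (ℤ.+≤+ h)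

frac-≤ : ∀ {a b d d′} .{{_ : NonZero d}} .{{_ : NonZero d′}} → a * d′ ≤ b * d → frac a d ≤ℚ frac b d′
frac-≤ {a} {b} {suc d} {suc d′} h = ℚ.toℚᵘ-cancel-≤ (ℚᵘ.≤-respˡ-≃ (ℚᵘ.≃-sym (ℚ.toℚᵘ-fromℚᵘ (mkℚᵘ (pos a) d)))
  (ℚᵘ.≤-respʳ-≃ (ℚᵘ.≃-sym (ℚ.toℚᵘ-fromℚᵘ (mkℚᵘ (pos b) d′))) (*≤* (pos-*-mono {a} {suc d′} {b} {suc d} h))))

frac-<⁻ : ∀ {a b d d′} .{{_ : NonZero d}} .{{_ : NonZero d′}} → frac a d <ℚ frac b d′ → a * d′ < b * d
frac-<⁻ {a} {b} {suc d} {suc d′} h with ℚᵘ.<-respˡ-≃ (ℚ.toℚᵘ-fromℚᵘ (mkℚᵘ (pos a) d))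
  (ℚᵘ.<-respʳ-≃ (ℚ.toℚᵘ-fromℚᵘ (mkℚᵘ (pos b) d′)) (ℚ.toℚᵘ-mono-< h))
... | *<* p = ℤ.drop‿+<+ (subst₂ ℤ._<_ (≡-sym (ℤ.pos-* a (suc d′))) (≡-sym (ℤ.pos-* b (suc d))) p)

frac<ℕ⇒< : ∀ a d b .{{_ : NonZero d}} → frac a d <ℚ ℕtoℚ b → a < b * d
frac<ℕ⇒< a d b h = subst (_< b * d) (*-identityʳ a) (frac-<⁻ {a} {b} {d} {1} h)

frac-< : ∀ {a b d d′} .{{_ : NonZero d}} .{{_ : NonZero d′}} → a * d′ < b * d → frac a d <ℚ frac b d′
frac-< {a} {b} {suc d} {suc d′} h = ℚ.toℚᵘ-cancel-< (ℚᵘ.<-respˡ-≃ (ℚᵘ.≃-sym (ℚ.toℚᵘ-fromℚᵘ (mkℚᵘ (pos a) d)))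
  (ℚᵘ.<-respʳ-≃ (ℚᵘ.≃-sym (ℚ.toℚᵘ-fromℚᵘ (mkℚᵘ (pos b) d′)))
    (*<* (subst₂ ℤ._<_ (ℤ.pos-* a (suc d′)) (ℤ.pos-* b (suc d)) (ℤ.+<+ h)))))

frac-+ : ∀ a b d .{{_ : NonZero d}} → frac a d +ℚ frac b d ≡ frac (a + b) d
frac-+ a b (suc d) = ≡-trans (fromℚᵘ-+ (mkℚᵘ (pos a) d) (mkℚᵘ (pos b) d)) (ℚ.fromℚᵘ-cong {mkℚᵘ (pos a) d +ᵘ mkℚᵘ (pos b) d} {mkℚᵘ (pos (a + b)) d} (*≡* (begin
  (pos a ℤ.* pos suc d ℤ.+ pos b ℤ.* pos suc d) ℤ.* pos suc d ≡⟨ cong (ℤ._* pos suc d) (cong₂ ℤ._+_ (ℤ.pos-* a (suc d)) (ℤ.pos-* b (suc d))) ⟨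
  pos (a * suc d + b * suc d) ℤ.* pos suc d ≡⟨ ℤ.pos-* (a * suc d + b * suc d) (suc d) ⟨
  pos ((a * suc d + b * suc d) * suc d) ≡⟨ cong pos_ (shape a b (suc d)) ⟩
  pos ((a + b) * (suc d * suc d)) ≡⟨ ℤ.pos-* (a + b) (suc d * suc d) ⟩
  pos (a + b) ℤ.* pos (suc d * suc d) ∎)))
  where
    open ≡-Reasoning
    shape : ∀ a b c → (a * c + b * c) * c ≡ (a + b) * (c * c)
    shape = solve-∀

frac-* : ∀ c a d .{{_ : NonZero d}} → ℕtoℚ c *ℚ frac a d ≡ frac (c * a) d
frac-* c a (suc d) = ≡-trans (fromℚᵘ-* (mkℚᵘ (pos c) 0) (mkℚᵘ (pos a) d)) (ℚ.fromℚᵘ-cong {mkℚᵘ (pos c) 0 *ᵘ mkℚᵘ (pos a) d} {mkℚᵘ (pos (c * a)) d} (*≡* (begin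
  (pos c ℤ.* pos a) ℤ.* pos suc d ≡⟨ cong (ℤ._* pos suc d) (ℤ.pos-* c a) ⟨
  pos (c * a) ℤ.* pos suc d ≡⟨ cong (λ x → pos (c * a) ℤ.* pos x) (+-identityʳ (suc d)) ⟨
  pos (c * a) ℤ.* pos (1 * suc d) ∎)))
  where open ≡-Reasoning

density-≤ : ∀ c h D x Q .{{_ : NonZero D}} .{{_ : NonZero Q}} → c * h * Q ≤ x * D → ℕtoℚ c *ℚ frac h D ≤ℚ frac x Q
density-≤ c h D x Q le = subst (_≤ℚ frac x Q) (≡-sym (frac-* c h D)) (frac-≤ {c * h} {x} {D} {Q} le)

-- With the common denominator `Q` the goodness condition for `ε = 1 / Q` becomes a comparison of
-- integers.
gap : ∀ {y₁ y₂ : ℚ} x₁ x₂ Q .{{_ : NonZero Q}} → y₁ ≤ℚ frac x₁ Q → y₂ ≤ℚ frac x₂ Q → x₁ + x₂ + 1 < Q →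
  ¬ (1ℚ -ℚ frac 1 Q) ≤ℚ (y₁ +ℚ y₂)
gap {y₁} {y₂} x₁ x₂ Q y₁≤ y₂≤ small h = ℚ.<-irrefl refl (ℚ.≤-<-trans one≤ (frac-< {x₁ + x₂ + 1} {1} {Q} {1} small′))
  where
    small′ : (x₁ + x₂ + 1) * 1 < 1 * Q
    small′ = subst₂ _<_ (≡-sym (*-identityʳ _)) (≡-sym (*-identityˡ Q)) small
    cancel : (1ℚ -ℚ frac 1 Q) +ℚ frac 1 Q ≡ 1ℚ
    cancel = ≡-trans (ℚ.+-assoc 1ℚ (-ℚ frac 1 Q) (frac 1 Q)) (≡-trans (cong (1ℚ +ℚ_) (ℚ.+-inverseˡ (frac 1 Q))) (ℚ.+-identityʳ 1ℚ))
    one≤ : 1ℚ ≤ℚ frac (x₁ + x₂ + 1) Q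
    one≤ = subst₂ _≤ℚ_ cancel (≡-trans (cong (_+ℚ frac 1 Q) (frac-+ x₁ x₂ Q)) (frac-+ (x₁ + x₂) 1 Q))
      (ℚ.+-monoˡ-≤ (frac 1 Q) (ℚ.≤-trans h (ℚ.+-mono-≤ y₁≤ y₂≤)))

-- Choice of the parameters

module Witness (H₁ H₂ : Graph) (r : ℕ) (χ≡ : χ H₂ ≡ suc (suc r)) (p : ℕ) where

  q R a : ℕ
  q = suc r
  R = v H₂ ∸ k H₂
  a = crit H₂ * (r !) * r ^ ((v H₂ + 1) ∸ suc (suc r) ∸ k H₂) * p ^ R

  not-good : a < e H₁ * q ^ R → ¬ (∀ (ε : ℚ) → 0ℚ <ℚ ε → Σ ℕ λ N → ∀ (G : Graph) → N ≤ v G → (1ℚ -ℚ ε) ≤ℚ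
    ((ℕtoℚ (q ^ (v H₁ ∸ k H₁)) *ℚ t H₁ G) +ℚ (ℕtoℚ (p ^ R) *ℚ t H₂ (complement G))))
  not-good a< good = gap (2 * x₁) (2 * x₂) (2 * Q) bound₁ bound₂ small (proj₂ (good (frac 1 (2 * Q)) positive) G large)
    where
      m₁ = v H₁
      m₂ = v H₂
      e₁ = e H₁
      C = pairCount (edges H₁)
      -- Larger than the second-order terms of both counts together, and larger than `e₁`, so that
      -- the truncated subtraction in `x₁` is exact.
      M = suc (q ^ R * C + p ^ R * q ^ R + e₁)
      -- The two summands are at most `x₁ / Q`, which is `1 - e₁ / M + C / M²`, and `x₂ / Q`, whose
      -- leading term is `a / (q ^ R * M)`.
      Q = q ^ R * (M * M)
      x₁ = q ^ R * (M * M + C) ∸ q ^ R * M * e₁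
      x₂ = M * a + p ^ R * q ^ R
      instance
        Q≢0 : NonZero Q
        Q≢0 = m*n≢0 (q ^ R) (M * M) {{m^n≢0 q R}}
        2Q≢0 : NonZero (2 * Q)
        2Q≢0 = m*n≢0 2 Q
      positive : 0ℚ <ℚ frac 1 (2 * Q)
      positive = frac-< {0} {1} {1} {2 * Q} (s≤s z≤n)
      N s : ℕ
      N = proj₁ (good (frac 1 (2 * Q)) positive)
      -- The block size only makes `G` large; the bounds on the densities do not depend on it.
      s = suc N
      open Construction q M s
      large : N ≤ v G
      large = ≤-trans (n≤1+n N) (≤-trans (m≤n*m s M) (m≤n*m (M * s) q))
      G≢0 : NonZero (v G)
      G≢0 = m*n≢0 q (M * s) {{_}} {{m*n≢0 M s}}
      vG^ : ∀ m → v G ^ m ≡ q ^ m * (M ^ m * s ^ m)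
      vG^ m = ≡-trans (^-distribʳ-* q (M * s) m) (cong (q ^ m *_) (^-distribʳ-* M s m))
      P = ∑ (allVecs M m₁) (λ ψ → ⟦ proper H₁ ψ ⟧)

      count₁ : q ^ (m₁ ∸ k H₁) * hom H₁ G * Q + q ^ R * M * e₁ * v G ^ m₁ ≤ q ^ R * (M * M + C) * v G ^ m₁
      count₁ = begin
        q ^ (m₁ ∸ k H₁) * hom H₁ G * Q + q ^ R * M * e₁ * v G ^ m₁
          ≤⟨ +-monoˡ-≤ _ (*-monoˡ-≤ Q (*-monoʳ-≤ (q ^ (m₁ ∸ k H₁)) (hom-G H₁ (s≤s z≤n)))) ⟩
        q ^ (m₁ ∸ k H₁) * (s ^ m₁ * (q ^ k H₁ * P)) * Q + q ^ R * M * e₁ * v G ^ m₁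
          ≡⟨ cong₂ _+_ (shape₁ (q ^ (m₁ ∸ k H₁)) (s ^ m₁) (q ^ k H₁) P (q ^ R) M) (cong (q ^ R * M * e₁ *_) (vG^ m₁)) ⟩
        q ^ (m₁ ∸ k H₁) * q ^ k H₁ * (q ^ R * s ^ m₁ * (M * (M * P))) + q ^ R * M * e₁ * (q ^ m₁ * (M ^ m₁ * s ^ m₁))
          ≡⟨ cong (λ z → z * (q ^ R * s ^ m₁ * (M * (M * P))) + q ^ R * M * e₁ * (q ^ m₁ * (M ^ m₁ * s ^ m₁)))
               (≡-trans (≡-sym (^-distribˡ-+-* q (m₁ ∸ k H₁) (k H₁))) (cong (q ^_) (m∸n+n≡m (k≤v H₁)))) ⟩
        q ^ m₁ * (q ^ R * s ^ m₁ * (M * (M * P))) + q ^ R * M * e₁ * (q ^ m₁ * (M ^ m₁ * s ^ m₁))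
          ≡⟨ shape₂ (q ^ m₁) (q ^ R) (s ^ m₁) M P e₁ (M ^ m₁) ⟩
        q ^ m₁ * q ^ R * s ^ m₁ * (M * (M * P) + M * (e₁ * M ^ m₁))
          ≤⟨ *-monoʳ-≤ (q ^ m₁ * q ^ R * s ^ m₁) (proper-count H₁ M) ⟩
        q ^ m₁ * q ^ R * s ^ m₁ * (M * (M * M ^ m₁) + C * M ^ m₁)
          ≡⟨ shape₃ (q ^ m₁) (q ^ R) (s ^ m₁) M C (M ^ m₁) ⟩
        q ^ R * (M * M + C) * (q ^ m₁ * (M ^ m₁ * s ^ m₁))
          ≡⟨ cong (q ^ R * (M * M + C) *_) (vG^ m₁) ⟨
        q ^ R * (M * M + C) * v G ^ m₁ ∎
        where
          open ≤-Reasoning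
          shape₁ : ∀ b c d f g h → b * (c * (d * f)) * (g * (h * h)) ≡ b * d * (g * c * (h * (h * f)))
          shape₁ = solve-∀
          shape₂ : ∀ b c d f g h l → b * (c * d * (f * (f * g))) + c * f * h * (b * (l * d)) ≡ b * c * d * (f * (f * g) + f * (h * l))
          shape₂ = solve-∀
          shape₃ : ∀ b c d f g h → b * c * d * (f * (f * h) + g * h) ≡ c * (f * f + g) * (b * (h * d))
          shape₃ = solve-∀

      double-left : ∀ b c → 2 * (b * c) ≡ b * (2 * c)
      double-left = solve-∀

      bound₁ : ℕtoℚ (q ^ (m₁ ∸ k H₁)) *ℚ t H₁ G ≤ℚ frac (2 * x₁) (2 * Q)
      bound₁ = density-≤ (q ^ (m₁ ∸ k H₁)) (hom H₁ G) (v G ^ m₁) (2 * x₁) (2 * Q) {{m^n≢0 (v G) m₁ {{G≢0}}}}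
        (subst₂ _≤_ (double-left (q ^ (m₁ ∸ k H₁) * hom H₁ G) Q) (≡-sym (*-assoc 2 x₁ (v G ^ m₁)))
          (*-monoʳ-≤ 2 (≤-trans (m+n≤o⇒m≤o∸n (q ^ (m₁ ∸ k H₁) * hom H₁ G * Q) count₁)
          (≤-reflexive (≡-sym (*-distribʳ-∸ (v G ^ m₁) (q ^ R * (M * M + C)) (q ^ R * M * e₁)))))))

      count₂ : p ^ R * hom H₂ (complement G) * Q ≤ x₂ * v G ^ m₂
      count₂ = begin
        p ^ R * h * (q ^ R * (M * M)) ≡⟨ shape₁ (p ^ R) h (q ^ R) M ⟩
        p ^ R * q ^ R * (M * (M * h)) ≤⟨ *-monoʳ-≤ (p ^ R * q ^ R) (ComplementCount.complement-count H₂ r χ≡ M s) ⟩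
        p ^ R * q ^ R * (s ^ m₂ * ((M * (crit H₂ * (r ! * w * q ^ k H₂)) + q ^ m₂) * M ^ m₂))
          ≡⟨ cong (λ z → p ^ R * q ^ R * (s ^ m₂ * ((M * (crit H₂ * (r ! * w * q ^ k H₂)) + z) * M ^ m₂))) q^m₂ ⟩
        p ^ R * q ^ R * (s ^ m₂ * ((M * (crit H₂ * (r ! * w * q ^ k H₂)) + q ^ R * q ^ k H₂) * M ^ m₂))
          ≡⟨ shape₂ (p ^ R) (q ^ R) (s ^ m₂) M (crit H₂) (r !) w (q ^ k H₂) (M ^ m₂) ⟩
        x₂ * (q ^ R * q ^ k H₂ * (M ^ m₂ * s ^ m₂)) ≡⟨ cong (λ z → x₂ * (z * (M ^ m₂ * s ^ m₂))) q^m₂ ⟨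
        x₂ * (q ^ m₂ * (M ^ m₂ * s ^ m₂)) ≡⟨ cong (x₂ *_) (vG^ m₂) ⟨
        x₂ * v G ^ m₂ ∎
        where
          open ≤-Reasoning
          h = hom H₂ (complement G)
          w = r ^ ((m₂ + 1) ∸ suc (suc r) ∸ k H₂)
          q^m₂ : q ^ m₂ ≡ q ^ R * q ^ k H₂
          q^m₂ = ≡-trans (cong (q ^_) (≡-sym (m∸n+n≡m (k≤v H₂)))) (^-distribˡ-+-* q R (k H₂))
          shape₁ : ∀ b c d f → b * c * (d * (f * f)) ≡ b * d * (f * (f * c))
          shape₁ = solve-∀
          shape₂ : ∀ b c d f g h l n o → b * c * (d * ((f * (g * (h * l * n)) + c * n) * o)) ≡
            (f * (g * h * l * b) + b * c) * (c * n * (o * d))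
          shape₂ = solve-∀

      bound₂ : ℕtoℚ (p ^ R) *ℚ t H₂ (complement G) ≤ℚ frac (2 * x₂) (2 * Q)
      bound₂ = density-≤ (p ^ R) (hom H₂ (complement G)) (v G ^ m₂) (2 * x₂) (2 * Q) {{m^n≢0 (v G) m₂ {{G≢0}}}}
        (subst₂ _≤_ (double-left (p ^ R * hom H₂ (complement G)) Q) (≡-sym (*-assoc 2 x₂ (v G ^ m₂))) (*-monoʳ-≤ 2 count₂))

      -- Between the integers `a` and `e₁ * q ^ R` there is a gap of at least 1. Multiplied by `M`
      -- it outweighs the second-order terms.
      x₁+x₂<Q : x₁ + x₂ < Q
      x₁+x₂<Q = +-cancelʳ-< M _ _ (begin-strict
        x₁ + x₂ + M ≡⟨ shape₁ x₁ M a (p ^ R * q ^ R) ⟩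
        x₁ + (M * suc a + p ^ R * q ^ R) ≤⟨ +-monoʳ-≤ x₁ (+-monoˡ-≤ (p ^ R * q ^ R) (*-monoʳ-≤ M a<)) ⟩
        x₁ + (M * (e₁ * q ^ R) + p ^ R * q ^ R) ≡⟨ shape₂ x₁ M e₁ (q ^ R) (p ^ R * q ^ R) ⟩
        x₁ + q ^ R * M * e₁ + p ^ R * q ^ R ≡⟨ cong (_+ p ^ R * q ^ R) (m∸n+n≡m enough) ⟩
        q ^ R * (M * M + C) + p ^ R * q ^ R ≡⟨ shape₃ (q ^ R) M C (p ^ R) ⟩
        Q + (q ^ R * C + p ^ R * q ^ R) <⟨ +-monoʳ-< Q (s≤s (m≤m+n _ e₁)) ⟩
        Q + M ∎)
        where
          open ≤-Reasoning
          enough : q ^ R * M * e₁ ≤ q ^ R * (M * M + C)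
          enough = ≤-trans (≤-reflexive (*-assoc (q ^ R) M e₁)) (*-monoʳ-≤ (q ^ R) (≤-trans (*-monoʳ-≤ M (≤-trans (m≤n+m e₁ _) (n≤1+n _))) (m≤m+n (M * M) C)))
          shape₁ : ∀ b c d f → b + (c * d + f) + c ≡ b + (c * (1 + d) + f)
          shape₁ = solve-∀
          shape₂ : ∀ b c d f g → b + (c * (d * f) + g) ≡ b + f * c * d + g
          shape₂ = solve-∀
          shape₃ : ∀ b c d f → b * (c * c + d) + f * b ≡ b * (c * c) + (b * d + f * b)
          shape₃ = solve-∀

      -- Doubling turns the gap of 1 into a gap of 2: one unit goes to `ε = 1 / (2 * Q)`, the other
      -- keeps the inequality strict.
      small : 2 * x₁ + 2 * x₂ + 1 < 2 * Q
      small = ≤-trans (≤-reflexive (shape x₁ x₂)) (*-monoʳ-≤ 2 x₁+x₂<Q)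
        where
          shape : ∀ b c → 1 + (2 * b + 2 * c + 1) ≡ 2 * (1 + (b + c))
          shape = solve-∀

-- Lower bounds for `χ` and for `v ∸ k`

module _ (H : Graph) where

  colourable⇒ : ∀ {c} → colourable c H ≡ true → ∃ λ (φ : Fin (v H) → Fin c) → ProperColouring H φ
  colourable⇒ {c} h = let f , _ , hf = any-true⁻ (allVecs c (v H)) h in lookup f , proper⇒ H {f = f} hf

  some-edge : 1 ≤ e H → ∃ λ i → ∃ λ j → toℕ i < toℕ j × adj H i j ≡ true
  some-edge h = pick (edges H) refl (≤-trans h (≤-reflexive (≡-sym (length-edges H))))
    where
      pick : ∀ es → es ≡ edges H → 1 ≤ length es → ∃ λ i → ∃ λ j → toℕ i < toℕ j × adj H i j ≡ true
      pick ((i , j) ∷ es) eq _ = let up , Eij = ∈-edges⁻ H (subst ((i , j) ∈_) eq (here refl)) in i , j , ∈-upPairs⁻ up , Eij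

  2≤χ : 1 ≤ e H → 2 ≤ χ H
  2≤χ h = search (v H) 2≤v (uncol 0 λ φ → ⊥-elim (¬Fin0 (φ i))) (uncol 1 λ φ → only (φ i) (φ j))
    where
      i = proj₁ (some-edge h)
      j = proj₁ (proj₂ (some-edge h))
      i<j = proj₁ (proj₂ (proj₂ (some-edge h)))
      Eij = proj₂ (proj₂ (proj₂ (some-edge h)))
      ¬Fin0 : ¬ Fin 0
      ¬Fin0 ()
      only : ∀ (a b : Fin 1) → a ≡ b
      only zero zero = refl
      2≤v : 2 ≤ v H
      2≤v = ≤-trans (s≤s (≤-trans (s≤s z≤n) i<j)) (toℕ<n j)
      uncol : ∀ c → (∀ (φ : Fin (v H) → Fin c) → φ i ≡ φ j) → colourable c H ≡ false
      uncol c same with colourable c H in eq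
      ... | false = refl
      ... | true = let φ , proper-φ = colourable⇒ eq in contradiction (same φ) (proper-φ i j Eij)
      search : ∀ fuel → 2 ≤ fuel → colourable 0 H ≡ false → colourable 1 H ≡ false → 2 ≤ χsearch H 0 fuel
      search (suc (suc fuel)) _ c₀ c₁ rewrite c₀ | c₁ = χsearch-≥ H 2 fuel
      search (suc zero) (s≤s ()) _ _

  reach-refl : ∀ t i → reach H t i i ≡ true
  reach-refl zero i = ==-refl i
  reach-refl (suc t) i = any-true⁺ {p = λ l → reach H t i l ∧ ((l == i) ∨ adj H l i)} (∈-allFin i)
    (cong₂ _∧_ (reach-refl t i) (cong (_∨ adj H i i) (==-refl i)))

  reach-adj : ∀ t {i j} → adj H i j ≡ true → reach H (suc t) i j ≡ true
  reach-adj t {i} {j} Eij = any-true⁺ {p = λ l → reach H t i l ∧ ((l == j) ∨ adj H l j)} (∈-allFin i)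
    (cong₂ _∧_ (reach-refl t i) (≡-trans (cong ((i == j) ∨_) Eij) (∨-zeroʳ (i == j))))

  not-leader : ∀ {i j} → toℕ j < toℕ i → adj H i j ≡ true → leader H i ≡ false
  not-leader {i} {j} j<i Eij = cong not (any-true⁺ {p = λ j → (toℕ j <ᵇ toℕ i) ∧ connected H i j} (∈-allFin j)
    (cong₂ _∧_ (T⇒true (<⇒<ᵇ j<i)) (step (v H) (≤-trans (s≤s z≤n) (toℕ<n i)))))
    where
      step : ∀ t → 1 ≤ t → reach H t i j ≡ true
      step (suc t) _ = reach-adj t Eij

  -- With at most one vertex that is not least in its component, two colours suffice.
  2≤v∸k : 3 ≤ χ H → 2 ≤ v H ∸ k H
  2≤v∸k 3≤χ = decidable-stable (2 ≤? v H ∸ k H) λ few → uncolourable H {2} (<χ⇒uncolourable H 3≤χ) φ (φ-proper few)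
    where
      V = allFin (v H)
      φ : Fin (v H) → Fin 2
      φ w = if leader H w then zero else suc zero
      non-leaders : k H + ∑ V (λ w → ⟦ not (leader H w) ⟧) ≡ v H
      non-leaders = ≡-trans (cong (_+ ∑ V (λ w → ⟦ not (leader H w) ⟧)) (k-∑ H)) (≡-trans (≡-sym (∑-distrib-+ V))
        (≡-trans (∑-cong V (λ w → split (leader H w))) (≡-trans (∑-const 1 V) (≡-trans (*-identityʳ _) (length-tabulate id)))))
        where
          split : ∀ b → ⟦ b ⟧ + ⟦ not b ⟧ ≡ 1
          split true = refl
          split false = refl
      two : ∀ {x y} → x ≢ y → leader H x ≡ false → leader H y ≡ false → 2 ≤ v H ∸ k H
      two {x} {y} x≢y lx ly = begin
        2 ≡⟨ cong₂ _+_ (∑-δ (λ _ → 1) (allFin⁺ (v H)) (∈-allFin x)) (∑-δ (λ _ → 1) (allFin⁺ (v H)) (∈-allFin y)) ⟨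
        ∑ V (λ w → ⟦ w == x ⟧ * 1) + ∑ V (λ w → ⟦ w == y ⟧ * 1) ≡⟨ ∑-distrib-+ V ⟨
        ∑ V (λ w → ⟦ w == x ⟧ * 1 + ⟦ w == y ⟧ * 1) ≤⟨ ∑-mono V each ⟩
        ∑ V (λ w → ⟦ not (leader H w) ⟧) ≡⟨ m+n∸m≡n (k H) _ ⟨
        k H + ∑ V (λ w → ⟦ not (leader H w) ⟧) ∸ k H ≡⟨ cong (_∸ k H) non-leaders ⟩
        v H ∸ k H ∎
        where
          open ≤-Reasoning
          each : ∀ w → ⟦ w == x ⟧ * 1 + ⟦ w == y ⟧ * 1 ≤ ⟦ not (leader H w) ⟧
          each w = cases (w ≟ x) (w ≟ y)
            where
              cases : Dec (w ≡ x) → Dec (w ≡ y) → ⟦ w == x ⟧ * 1 + ⟦ w == y ⟧ * 1 ≤ ⟦ not (leader H w) ⟧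
              cases (yes refl) (yes refl) = contradiction refl x≢y
              cases (yes refl) (no w≢y) rewrite ==-refl w | ==-≢ w≢y | lx = ≤-refl
              cases (no w≢x) (yes refl) rewrite ==-≢ w≢x | ==-refl w | ly = ≤-refl
              cases (no w≢x) (no w≢y) rewrite ==-≢ w≢x | ==-≢ w≢y = z≤n
      φ-proper : ¬ (2 ≤ v H ∸ k H) → ProperColouring H φ
      φ-proper few x y Exy with leader H x in lx | leader H y in ly
      ... | true | false = λ ()
      ... | false | true = λ ()
      ... | false | false = λ _ → few (two (λ { refl → contradiction (≡-trans (≡-sym Exy) (Graph.irrefl H x)) λ () }) lx ly)
      ... | true | true = λ _ → order (<-cmp (toℕ x) (toℕ y))
        where
          Eyx : adj H y x ≡ true
          Eyx = ≡-trans (Graph.sym H y x) Exy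
          order : Tri (toℕ x < toℕ y) (toℕ x ≡ toℕ y) (toℕ y < toℕ x) → ⊥
          order (tri< x<y _ _) = contradiction (≡-trans (≡-sym ly) (not-leader x<y Eyx)) λ ()
          order (tri> _ _ y<x) = contradiction (≡-trans (≡-sym lx) (not-leader y<x Exy)) λ ()
          order (tri≈ _ x≡y _) with refl ← toℕ-injective x≡y = contradiction (≡-trans (≡-sym Exy) (Graph.irrefl H x)) λ ()

-- Lets the hypothesis for `χ H₂ ≡ 4` imply the generic one. Without truncation the left side is
-- `2 ^ (v ∸ κ ∸ 2)`; if the exponent is cut off at 0, the left side is 2, and `2 ≤ v ∸ κ` still
-- suffices.
three-colours : ∀ v κ → 2 ≤ v ∸ κ → 2 * 2 ^ ((v + 1) ∸ 4 ∸ κ) ≤ 2 ^ (v ∸ κ ∸ 1)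
three-colours v κ 2≤ = ^-monoʳ-≤ 2 (≤-trans (≤-reflexive (cong suc exponent)) (lemma (v ∸ κ) 2≤))
  where
    exponent : (v + 1) ∸ 4 ∸ κ ≡ v ∸ κ ∸ 3
    exponent = ≡-trans (cong (λ x → x ∸ 4 ∸ κ) (+-comm v 1)) (≡-trans (∸-+-assoc v 3 κ)
      (≡-trans (cong (v ∸_) (+-comm 3 κ)) (≡-sym (∸-+-assoc v κ 3))))
    lemma : ∀ x → 2 ≤ x → suc (x ∸ 3) ≤ x ∸ 1
    lemma (suc (suc zero)) _ = ≤-refl
    lemma (suc (suc (suc x))) _ = n≤1+n (suc x)
    lemma (suc zero) (s≤s ())

theorem5p4 : (H₁ H₂ : Graph) →
  1 ≤ e H₂ →
  (χ H₂ ≢ 4 →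
    frac (crit H₂ * (χ H₂ ∸ 2) ! * (χ H₂ ∸ 2) ^ ((v H₂ + 1) ∸ χ H₂ ∸ k H₂)
            * (χ H₁ ∸ 1) ^ (v H₂ ∸ k H₂))
         ((χ H₂ ∸ 1) ^ (v H₂ ∸ k H₂))
      <ℚ ℕtoℚ (e H₁)) →
  (χ H₂ ≡ 4 →
    frac (crit H₂ * 2 ^ (v H₂ ∸ k H₂ ∸ 1) * (χ H₁ ∸ 1) ^ (v H₂ ∸ k H₂))
         (3 ^ (v H₂ ∸ k H₂))
      <ℚ ℕtoℚ (e H₁)) →
  ¬ MultiplicityGood H₁ H₂
theorem5p4 H₁ H₂ 1≤e generic four good = W.not-good few (subst Good χ≡ good)
  where
    r p R : ℕ
    r = χ H₂ ∸ 2
    p = χ H₁ ∸ 1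
    R = v H₂ ∸ k H₂
    -- As `H₂` has an edge, the subtractions in `χ H₂ ∸ 1` and `χ H₂ ∸ 2` are exact.
    χ≡ : χ H₂ ≡ suc (suc r)
    χ≡ = ≡-sym (m+[n∸m]≡n (2≤χ H₂ 1≤e))
    module W = Witness H₁ H₂ r χ≡ p
    Good : ℕ → Set
    Good c = ∀ (ε : ℚ) → 0ℚ <ℚ ε → Σ ℕ λ N → ∀ (G : Graph) → N ≤ v G → (1ℚ -ℚ ε) ≤ℚ
      ((ℕtoℚ ((c ∸ 1) ^ (v H₁ ∸ k H₁)) *ℚ t H₁ G) +ℚ (ℕtoℚ (p ^ R) *ℚ t H₂ (complement G)))
    Generic : ℕ → Set
    Generic c = frac (crit H₂ * (c ∸ 2) ! * (c ∸ 2) ^ ((v H₂ + 1) ∸ c ∸ k H₂) * p ^ R) ((c ∸ 1) ^ R) <ℚ ℕtoℚ (e H₁)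
    bounded : ∀ c → suc (suc c) ≡ χ H₂ → Generic (suc (suc c)) →
      crit H₂ * c ! * c ^ ((v H₂ + 1) ∸ suc (suc c) ∸ k H₂) * p ^ R < e H₁ * suc c ^ R
    bounded c _ h = frac<ℕ⇒< (crit H₂ * c ! * c ^ ((v H₂ + 1) ∸ suc (suc c) ∸ k H₂) * p ^ R) (suc c ^ R) (e H₁) {{m^n≢0 (suc c) R}} h
    bounded-four : χ H₂ ≡ 4 → crit H₂ * 2 ! * 2 ^ ((v H₂ + 1) ∸ 4 ∸ k H₂) * p ^ R < e H₁ * 3 ^ R
    bounded-four χ≡4 = ≤-<-trans
      (*-monoˡ-≤ (p ^ R) (≤-trans (≤-reflexive (*-assoc (crit H₂) (2 !) _))
        (*-monoʳ-≤ (crit H₂) (three-colours (v H₂) (k H₂) (2≤v∸k H₂ (≤-trans (n≤1+n 3) (≤-reflexive (≡-sym χ≡4))))))))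
      (frac<ℕ⇒< (crit H₂ * 2 ^ (R ∸ 1) * p ^ R) (3 ^ R) (e H₁) {{m^n≢0 3 R}} (four χ≡4))
    few : W.a < e H₁ * suc r ^ R
    few with χ H₂ ≟ℕ 4
    ... | no χ≢4 = bounded r (≡-sym χ≡) (subst Generic χ≡ (generic χ≢4))
    ... | yes χ≡4 = subst (λ c → crit H₂ * c ! * c ^ ((v H₂ + 1) ∸ suc (suc c) ∸ k H₂) * p ^ R < e H₁ * suc c ^ R)
      (≡-sym (cong (_∸ 2) χ≡4)) (bounded-four χ≡4)
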